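{- The decision problem "given a graph $G$, does $o(G)=\mathcal{D}$ hold?" is in $\mathsf{NP}$ when restricted to interval graphs $G$.
   Context: All graphs are finite and simple. An interval graph is the intersection graph of a family of closed intervals of the real line: each vertex corresponds to an interval, and two vertices are adjacent if and only if their intervals intersect. The Maker-Breaker domination game on a graph $G$: two players, Dominator and Staller, alternately claim a not-yet-claimed vertex of $G$. Dominator wins if at some point the vertices she has claimed form a dominating set of $G$. Otherwise, i.e. if Staller manages to claim a vertex and all its neighbors, Staller wins. The graph $G$ has outcome $\mathcal{D}$, written $o(G)=\mathcal{D}$, if Dominator has a winning strategy whoever starts (equivalently, if Dominator has a winning strategy when playing second, since no player benefits from skipping a turn). -}

module Defs where

open import Data.Bool.Base using (Bool; true; false; T)
open import Data.Fin.Base using (Fin)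
open import Data.Fin.Subset using (Subset; _∈_; _∉_; _∪_; ⁅_⁆) renaming (⊥ to ∅)
open import Data.List.Base using (List; []; _∷_; _++_; length; map; replicate; concat; tabulate)
open import Data.Nat.Base using (ℕ; zero; suc; _+_; _*_; _≤_)
open import Data.Product.Base using (∃-syntax; Σ-syntax; _×_; _,_)
open import Data.Rational.Base using (ℚ) renaming (_<_ to _<ℚ_)
open import Data.Sum.Base using (_⊎_)
open import Data.Vec.Base as Vec using (Vec)
open import Function.Bundles using (_⇔_; _↔_)
open import Level using (Level; _⊔_) renaming (suc to lsuc; zero to lzero)
open import Relation.Binary.PropositionalEquality using (_≡_; _≢_)
open import Relation.Nullary.Negation using (¬_)

-- Two-sided located Dedekind cuts.
record ℝ : Set₁ where
  field
    Lower Upper   : ℚ → Set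
    lower-inhab   : ∃[ q ] Lower q
    upper-inhab   : ∃[ q ] Upper q
    lower-rounded : ∀ q → Lower q ⇔ (∃[ r ] q <ℚ r × Lower r)
    upper-rounded : ∀ q → Upper q ⇔ (∃[ r ] r <ℚ q × Upper r)
    disjoint      : ∀ q → ¬ (Lower q × Upper q)
    located       : ∀ q r → q <ℚ r → Lower q ⊎ Upper r

infix 4 _≤ℝ_
_≤ℝ_ : ℝ → ℝ → Set
x ≤ℝ y = ∀ q → ℝ.Lower x q → ℝ.Lower y q

record ClosedInterval : Set₁ where
  field
    left right : ℝ
    left≤right : left ≤ℝ right

infix 4 _∈ᴵ_
_∈ᴵ_ : ℝ → ClosedInterval → Set
x ∈ᴵ I = ClosedInterval.left I ≤ℝ x × x ≤ℝ ClosedInterval.right I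

Intersect : ClosedInterval → ClosedInterval → Set₁
Intersect I J = ∃[ x ] x ∈ᴵ I × x ∈ᴵ J

record Graph (n : ℕ) : Set where
  field
    adj    : Fin n → Fin n → Bool
    sym    : ∀ u v → adj u v ≡ adj v u
    irrefl : ∀ v → adj v v ≡ false

  Adjacent : Fin n → Fin n → Set
  Adjacent u v = T (adj u v)

open Graph public using (Adjacent)

IsInterval : ∀ {n} → Graph n → Set₁
IsInterval {n} G =
  Σ[ I ∈ (Fin n → ClosedInterval) ]
    (∀ u v → u ≢ v → Adjacent G u v ⇔ Intersect (I u) (I v))

Dominating : ∀ {n} → Graph n → Subset n → Set
Dominating G D = ∀ v → ∃[ u ] u ∈ D × (u ≡ v ⊎ Adjacent G u v)

data Player : Set where
  dominator staller : Player

-- DominatorWins G p D S: Dominator has a winning strategy from the position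
-- where she has claimed D, Staller has claimed S, and p is to move; an
-- inhabitant is a strategy tree.  A full board on which D is not dominating
-- is lost for Dominator, hence the free vertex demanded in `reply`.
data DominatorWins {n} (G : Graph n) : Player → Subset n → Subset n → Set where
  dominated : ∀ {p D S} → Dominating G D → DominatorWins G p D S
  claim     : ∀ {D S} v → v ∉ D → v ∉ S →
              DominatorWins G staller (D ∪ ⁅ v ⁆) S →
              DominatorWins G dominator D S
  reply     : ∀ {D S} → (∃[ v ] v ∉ D × v ∉ S) →
              (∀ v → v ∉ D → v ∉ S → DominatorWins G dominator D (S ∪ ⁅ v ⁆)) →
              DominatorWins G staller D S

Outcome𝒟 : ∀ {n} → Graph n → Set
Outcome𝒟 G = ∀ p → DominatorWins G p ∅ ∅

Finite : Set → Set
Finite A = ∃[ n ] (A ↔ Fin n)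

data Symbol (A : Set) : Set where
  blank : Symbol A
  bit   : Bool → Symbol A
  aux   : A → Symbol A

data Move : Set where
  moveL stay moveR : Move

data Control (Q : Set) : Set where
  halt : (verdict : Bool) → Control Q
  at   : Q → Control Q

-- Tapes 0 and 1 hold the two inputs; there are `work` further tapes.
record TM : Set₁ where
  field
    State        : Set
    Aux          : Set
    state-finite : Finite State
    aux-finite   : Finite Aux
    work         : ℕ
    start        : State
    δ            : State → Vec (Symbol Aux) (2 + work) →
                   Control State × Vec (Symbol Aux × Move) (2 + work)

-- A two-way infinite tape: all cells outside the two lists are blank, and
-- both lists begin with the cell nearest the head.
record Tape (A : Set) : Set where
  constructor tape
  field
    before : List (Symbol A)
    head   : Symbol A
    after  : List (Symbol A)

module _ {A : Set} where

  shift : Move → Tape A → Tape A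
  shift stay  t                     = t
  shift moveL (tape []       s rs)  = tape [] blank (s ∷ rs)
  shift moveL (tape (l ∷ ls) s rs)  = tape ls l (s ∷ rs)
  shift moveR (tape ls s [])        = tape (s ∷ ls) blank []
  shift moveR (tape ls s (r ∷ rs))  = tape (s ∷ ls) r rs

  act : Symbol A × Move → Tape A → Tape A
  act (s , m) (tape ls _ rs) = shift m (tape ls s rs)

  load : List Bool → Tape A
  load []      = tape [] blank []
  load (b ∷ w) = tape [] (bit b) (map bit w)

module Run (M : TM) where
  open TM M

  record Config : Set where
    constructor config
    field
      control : Control State
      tapes   : Vec (Tape Aux) (2 + work)

  initial : List Bool → List Bool → Config
  initial x u =
    config (at start) (load x Vec.∷ load u Vec.∷ Vec.replicate work (load []))

  step : Config → Config
  step (config (halt b) ts) = config (halt b) ts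
  step (config (at q)   ts) with δ q (Vec.map Tape.head ts)
  ... | c , as = config c (Vec.zipWith act as ts)

  run : ℕ → Config → Config
  run zero    c = c
  run (suc t) c = run t (step c)

HaltsWithin : TM → ℕ → List Bool → List Bool → Bool → Set
HaltsWithin M t x u b = Config.control (run t (initial x u)) ≡ halt b
  where open Run M

Language : (ℓ : Level) → Set (lsuc ℓ)
Language ℓ = List Bool → Set ℓ

-- The polynomial with the given coefficients, constant term first.
poly : List ℕ → ℕ → ℕ
poly []       n = 0
poly (a ∷ as) n = a + n * poly as n

record PolyTimeVerifier {ℓ} (L : Language ℓ) : Set (lsuc lzero ⊔ ℓ) where
  field
    machine : TM
    size    : List ℕ
    time    : List ℕ

    halts   : ∀ x u → length u ≤ poly size (length x) →
              ∃[ b ] HaltsWithin machine (poly time (length x)) x u b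

    correct : ∀ x → L x ⇔
              (∃[ u ] length u ≤ poly size (length x) ×
                      HaltsWithin machine (poly time (length x)) x u true)

NP : ∀ {ℓ} → Language ℓ → Set (lsuc lzero ⊔ ℓ)
NP = PolyTimeVerifier

-- The number of vertices in unary, then the rows of the adjacency matrix.
encode : ∀ {n} → Graph n → List Bool
encode {n} G =
  replicate n true ++ false ∷ concat (tabulate λ u → tabulate λ v → Graph.adj G u v)

-- The problem "does the graph satisfy P?" on the class C of instances,
-- identified as usual with the set of encodings of its yes-instances.
ProblemRestrictedTo : ∀ {a b} → (∀ {n} → Graph n → Set a) → (∀ {n} → Graph n → Set b) →
                      Language (a ⊔ b)
ProblemRestrictedTo C P x = ∃[ n ] ∃[ G ] x ≡ encode {n} G × C G × P G

{-# OPTIONS --safe #-}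
module Submission where

-- An interval graph has a linear arrangement of (representatives of) its inclusion-minimal closed
-- neighbourhoods in which every vertex belongs to consecutive ones; Dominator has to hit each of these
-- points. Call a set of points an obstruction if it is a single point lying in at most one available
-- vertex, or splits into a left and a right part, crossed by at most one available vertex, both of which
-- are obstructions once the crossing vertex is gone. Staller wins on an obstruction by taking the
-- crossing vertex. Conversely, when there is none and Staller takes x, all obstructions created by this
-- move are hit by a single vertex, which is Dominator's reply. So o(G) = 𝒟 exactly if there is no
-- obstruction, and this is certified by a relation of arity four that is closed under the two rules
-- building obstructions and does not relate the ends of an unconstrained one. Together with an interval
-- model this makes the certificate a first-order structure on the vertices, and the verifier evaluates
-- a fixed first-order sentence with nested loops over unary counters.

open import Data.Bool.Base using (Bool; true; false; if_then_else_; _∧_; not; _∨_; T)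
open import Data.Bool.Properties using (T?; T-∧; T-≡)
open import Data.Empty using (⊥-elim; ⊥)
open import Data.Fin.Base using (Fin; zero; suc; toℕ; fromℕ<) renaming (_≤_ to _≤ᶠ_; _<_ to _<ᶠ_)
open import Data.Fin.Properties using (+↔⊎; 1↔⊤; _≟_; toℕ-fromℕ<; any?; toℕ<n; all?; ¬∀⟶∃¬; toℕ-injective)
open import Data.Fin.Subset using (Subset; _∈_; _∉_; _∪_; ⁅_⁆; _⊃_) renaming (⊥ to ∅)
open import Data.Fin.Subset.Induction using (⊃-wellFounded; Acc; acc)
open import Data.Fin.Subset.Properties using (x∈p∪q⁻; x∈p∪q⁺; x∈⁅x⁆; x∈⁅y⁆⇒x≡y; p⊆p∪q; q⊆p∪q; ∉⊥; _∈?_)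
open import Data.Integer.Base as ℤ using (ℤ; -[1+_])
import Data.Integer.Properties as ℤP
open import Data.List.Base using (List; []; _∷_; map; length; replicate; _++_; [_]; concat; tabulate; take;
  drop)
open import Data.List.Membership.Propositional using (find; lose) renaming (_∈_ to _∈ˡ_)
open import Data.List.Membership.Propositional.Properties using (∈-++⁺ˡ; ∈-++⁺ʳ; ∈-++⁻)
open import Data.List.Properties using (length-++; length-replicate; length-tabulate; tabulate-cong;
  take++drop≡id; length-drop)
open import Data.List.Relation.Unary.Any as Any using (here)
open import Data.Nat.Base using (ℕ; zero; suc; _+_; _≤_; z≤n; s≤s; _*_; _∸_; _⊓_; _<_; _<ᵇ_; _≡ᵇ_)
open import Data.Nat.Coprimality using (1-coprimeTo) renaming (sym to coprime-sym)
open import Data.Nat.Induction using (<-rec)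
open import Data.Nat.Properties as ℕP using (≤-refl; ≤-trans; ≤-reflexive; +-mono-≤; +-monoʳ-≤; *-monoˡ-≤;
  n≤1+n; m∸n≤m; 0∸n≡0; m≤m+n; m≤n+m; m⊓n≤m; m⊓n≤n; +-assoc; +-comm; +-suc; +-identityʳ; <⇒≤; +-monoˡ-≤;
  *-identityʳ; n∸n≡0; _<?_; ≮⇒≥; <-irrefl; *-monoʳ-≤; ⊓-pres-m<; _≤?_; *-mono-≤; <⇒≢; *-zeroʳ; ∸-monoʳ-<;
  ≤-total; <-trans; <-≤-trans; ≤-<-trans; ≰⇒>; ≤∧≢⇒<; ≤-antisym; m≤n⇒m<n∨m≡n; <ᵇ-reflects-<; ≡ᵇ⇒≡; ≡⇒≡ᵇ;
  <⇒≱; 1+n≰n; m≤n⇒m≤1+n; m+n∸m≡n; +-cancelˡ-≡; +-monoʳ-<)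
open import Data.Nat.Tactic.RingSolver using (solve-∀)
open import Data.Product.Base using (∃-syntax; _×_; _,_; map₁; proj₁; proj₂)
open import Data.Rational.Base as ℚ using (ℚ; mkℚ; *<*)
import Data.Rational.Properties as ℚP
open import Data.Sum.Base as Sum using (_⊎_; inj₁; inj₂) renaming ([_,_] to either)
open import Data.Sum.Function.Propositional using (_⊎-↔_)
open import Data.Unit.Base using (⊤; tt)
open import Data.Vec.Base as Vec using (Vec; []; _∷_; lookup; zipWith; _[_]≔_)
open import Data.Vec.Properties using (lookup∘update; lookup∘update′; lookup-replicate)
open import Defs
open import Function.Base using (_∘_; case_of_)
open import Function.Bundles using (mk⇔; _⇔_; Equivalence)
open import Function.Properties.Inverse using (↔-refl; ↔-sym; ↔-trans)
open import Relation.Binary.PropositionalEquality using (_≡_; _≢_; _≗_; refl; sym; trans; cong; cong₂;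
  subst; subst₂)
open import Relation.Nullary.Decidable using (yes; no; ⌊_⌋; True; False; toWitness; toWitnessFalse; Dec;
  map′; _×-dec_; _⊎-dec_; ¬?; decidable-stable; _→-dec_; _because_; ¬¬-excluded-middle)
open import Relation.Nullary.Negation using (contradiction; ¬_)
open import Relation.Nullary.Reflects using (Reflects; ofʸ; ofⁿ; T-reflects; ¬-reflects; _×-reflects_;
  _⊎-reflects_; _→-reflects_; fromEquivalence)
open import Relation.Unary using (Decidable)

open Equivalence using (to; from)

-- Structured programs and the machines running them

-- That no obstruction exists is a statement about exponentially many sets of points. Convexity
-- makes it local: a vertex that meets a part of an obstruction and also a chosen point outside this
-- part contains the chosen point next to the part. The vertices already used up are therefore known
-- from the two neighbouring chosen points, and a part is summarised by its two ends and these two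
-- neighbours, whence arity four. Every relation closed under the two rules contains all
-- obstructions, so a relation that is too large does no harm to soundness, and minimality is never
-- tested. The interval model belongs to the certificate because a yes-instance must also be shown
-- to be an interval graph. Endpoints are located Dedekind cuts, whose order is not decidable, and
-- the choice of Dominator's reply is classical. Both arguments run under double negation, which can
-- be removed because finite games and the bounded search for an accepted certificate are decidable.

Sym : Set
Sym = Symbol (Fin 0)

module Programs (work : ℕ) where

  Tapes : Set
  Tapes = Vec (Tape (Fin 0)) (2 + work)

  TapeIx : Set
  TapeIx = Fin (2 + work)

  data Prog : Set where
    act!   : TapeIx → (Sym → Bool × (Sym × Move)) → Prog
    branch : Prog → Prog → Prog → Prog
    seq    : Prog → Prog → Prog
    loop   : Prog → Prog

  St : Prog → Set
  St (act! _ _)     = ⊤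
  St (branch p q r) = St p ⊎ (St q ⊎ St r)
  St (seq p q)      = St p ⊎ St q
  St (loop p)       = St p

  start : ∀ p → St p
  start (act! _ _)     = tt
  start (branch p _ _) = inj₁ (start p)
  start (seq p _)      = inj₁ (start p)
  start (loop p)       = start p

  St-finite : ∀ p → Finite (St p)
  St-finite (act! _ _) = 1 , ↔-sym 1↔⊤
  St-finite (branch p q r) with St-finite p | St-finite q | St-finite r
  ... | k , f | l , g | m , h =
    k + (l + m) ,
    ↔-trans (f ⊎-↔ ↔-trans (g ⊎-↔ h) (↔-sym +↔⊎)) (↔-sym +↔⊎)
  St-finite (seq p q) with St-finite p | St-finite q
  ... | k , f | l , g = k + l , ↔-trans (f ⊎-↔ g) (↔-sym +↔⊎)
  St-finite (loop p) = St-finite p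

  branchNext : ∀ p q r → St p ⊎ Bool → St (branch p q r) ⊎ Bool
  branchNext p q r (inj₁ s)     = inj₁ (inj₁ s)
  branchNext p q r (inj₂ true)  = inj₁ (inj₂ (inj₁ (start q)))
  branchNext p q r (inj₂ false) = inj₁ (inj₂ (inj₂ (start r)))

  thenNext : ∀ p q r → St q ⊎ Bool → St (branch p q r) ⊎ Bool
  thenNext p q r (inj₁ s) = inj₁ (inj₂ (inj₁ s))
  thenNext p q r (inj₂ b) = inj₂ b

  elseNext : ∀ p q r → St r ⊎ Bool → St (branch p q r) ⊎ Bool
  elseNext p q r (inj₁ s) = inj₁ (inj₂ (inj₂ s))
  elseNext p q r (inj₂ b) = inj₂ b

  seqNext₁ : ∀ p q → St p ⊎ Bool → St (seq p q) ⊎ Bool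
  seqNext₁ p q (inj₁ s) = inj₁ (inj₁ s)
  seqNext₁ p q (inj₂ _) = inj₁ (inj₂ (start q))

  seqNext₂ : ∀ p q → St q ⊎ Bool → St (seq p q) ⊎ Bool
  seqNext₂ p q (inj₁ s) = inj₁ (inj₂ s)
  seqNext₂ p q (inj₂ b) = inj₂ b

  loopNext : ∀ p → St p ⊎ Bool → St p ⊎ Bool
  loopNext p (inj₁ s)     = inj₁ s
  loopNext p (inj₂ true)  = inj₁ (start p)
  loopNext p (inj₂ false) = inj₂ true

  actions : ∀ {k} → Fin k → (Sym × Move) → Vec Sym k → Vec (Sym × Move) k
  actions c a hs = Vec.map (_, stay) hs [ c ]≔ a

  -- An exit of a subprogram becomes the start of its successor within the same machine step, so
  -- composition takes no time of its own and the step counts of `Reach` simply add.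
  next : ∀ p → St p → Vec Sym (2 + work) → (St p ⊎ Bool) × Vec (Sym × Move) (2 + work)
  next (act! c g) tt hs with g (lookup hs c)
  ... | b , a = inj₂ b , actions c a hs
  next (branch p q r) (inj₁ s)        hs = map₁ (branchNext p q r) (next p s hs)
  next (branch p q r) (inj₂ (inj₁ s)) hs = map₁ (thenNext p q r) (next q s hs)
  next (branch p q r) (inj₂ (inj₂ s)) hs = map₁ (elseNext p q r) (next r s hs)
  next (seq p q) (inj₁ s) hs = map₁ (seqNext₁ p q) (next p s hs)
  next (seq p q) (inj₂ s) hs = map₁ (seqNext₂ p q) (next q s hs)
  next (loop p) s hs = map₁ (loopNext p) (next p s hs)

  toControl : ∀ {Q : Set} → Q ⊎ Bool → Control Q
  toControl (inj₁ s) = at s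
  toControl (inj₂ b) = halt b

  machineOf : Prog → TM
  machineOf p = record
    { State        = St p
    ; Aux          = Fin 0
    ; state-finite = St-finite p
    ; aux-finite   = 0 , ↔-refl
    ; work         = work
    ; start        = start p
    ; δ            = λ s hs → map₁ toControl (next p s hs)
    }

  heads : Tapes → Vec Sym (2 + work)
  heads = Vec.map Tape.head

  data Reach (p : Prog) : St p → Tapes → ℕ → Bool → Tapes → Set where
    exit : ∀ {s ts b as} → next p s (heads ts) ≡ (inj₂ b , as) →
           Reach p s ts 1 b (zipWith act as ts)
    more : ∀ {s s′ ts as k b ts′} → next p s (heads ts) ≡ (inj₁ s′ , as) →
           Reach p s′ (zipWith act as ts) k b ts′ → Reach p s ts (suc k) b ts′

  module _ {p q r : Prog} where

    reach-then : ∀ {s ts k b ts′} → Reach q s ts k b ts′ →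
                 Reach (branch p q r) (inj₂ (inj₁ s)) ts k b ts′
    reach-then (exit e)   = exit (cong (map₁ (thenNext p q r)) e)
    reach-then (more e h) = more (cong (map₁ (thenNext p q r)) e) (reach-then h)

    reach-else : ∀ {s ts k b ts′} → Reach r s ts k b ts′ →
                 Reach (branch p q r) (inj₂ (inj₂ s)) ts k b ts′
    reach-else (exit e)   = exit (cong (map₁ (elseNext p q r)) e)
    reach-else (more e h) = more (cong (map₁ (elseNext p q r)) e) (reach-else h)

    reach-branch-true : ∀ {s ts k l b ts′ ts″} → Reach p s ts k true ts′ →
                        Reach q (start q) ts′ l b ts″ →
                        Reach (branch p q r) (inj₁ s) ts (k + l) b ts″
    reach-branch-true (exit e)   g = more (cong (map₁ (branchNext p q r)) e) (reach-then g)
    reach-branch-true (more e h) g =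
      more (cong (map₁ (branchNext p q r)) e) (reach-branch-true h g)

    reach-branch-false : ∀ {s ts k l b ts′ ts″} → Reach p s ts k false ts′ →
                         Reach r (start r) ts′ l b ts″ →
                         Reach (branch p q r) (inj₁ s) ts (k + l) b ts″
    reach-branch-false (exit e)   g = more (cong (map₁ (branchNext p q r)) e) (reach-else g)
    reach-branch-false (more e h) g =
      more (cong (map₁ (branchNext p q r)) e) (reach-branch-false h g)

  module _ {p q : Prog} where

    reach-seq₂ : ∀ {s ts k b ts′} → Reach q s ts k b ts′ → Reach (seq p q) (inj₂ s) ts k b ts′
    reach-seq₂ (exit e)   = exit (cong (map₁ (seqNext₂ p q)) e)
    reach-seq₂ (more e h) = more (cong (map₁ (seqNext₂ p q)) e) (reach-seq₂ h)

    reach-seq : ∀ {s ts k l b b′ ts′ ts″} → Reach p s ts k b ts′ →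
                Reach q (start q) ts′ l b′ ts″ → Reach (seq p q) (inj₁ s) ts (k + l) b′ ts″
    reach-seq (exit e)   g = more (cong (map₁ (seqNext₁ p q)) e) (reach-seq₂ g)
    reach-seq (more e h) g = more (cong (map₁ (seqNext₁ p q)) e) (reach-seq h g)

  reach-loop-true : ∀ {p s ts k l b ts′ ts″} → Reach p s ts k true ts′ →
                    Reach (loop p) (start p) ts′ l b ts″ →
                    Reach (loop p) s ts (k + l) b ts″
  reach-loop-true {p} (exit e)   g = more (cong (map₁ (loopNext p)) e) g
  reach-loop-true {p} (more e h) g = more (cong (map₁ (loopNext p)) e) (reach-loop-true h g)

  reach-loop-false : ∀ {p s ts k ts′} → Reach p s ts k false ts′ →
                     Reach (loop p) s ts k true ts′
  reach-loop-false {p} (exit e)   = exit (cong (map₁ (loopNext p)) e)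
  reach-loop-false {p} (more e h) = more (cong (map₁ (loopNext p)) e) (reach-loop-false h)

  zipWith-stay : ∀ {k} (ts : Vec (Tape (Fin 0)) k) →
                 zipWith act (Vec.map (_, stay) (Vec.map Tape.head ts)) ts ≡ ts
  zipWith-stay []       = refl
  zipWith-stay (t ∷ ts) = cong (t ∷_) (zipWith-stay ts)

  zipWith-actions : ∀ {k} (c : Fin k) a (ts : Vec (Tape (Fin 0)) k) →
                    zipWith act (actions c a (Vec.map Tape.head ts)) ts ≡
                    ts [ c ]≔ act a (lookup ts c)
  zipWith-actions zero    a (t ∷ ts) = cong (act a t ∷_) (zipWith-stay ts)
  zipWith-actions (suc c) a (t ∷ ts) = cong (t ∷_) (zipWith-actions c a ts)

  lookup-heads : ∀ {k} (c : Fin k) (ts : Vec (Tape (Fin 0)) k) →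
                 lookup (Vec.map Tape.head ts) c ≡ Tape.head (lookup ts c)
  lookup-heads zero    (t ∷ ts) = refl
  lookup-heads (suc c) (t ∷ ts) = lookup-heads c ts

  reach-act : ∀ c g ts {b a} → g (Tape.head (lookup ts c)) ≡ (b , a) →
              Reach (act! c g) tt ts 1 b (ts [ c ]≔ act a (lookup ts c))
  reach-act c g ts {b} {a} e =
    subst (Reach (act! c g) tt ts 1 b) (zipWith-actions c a ts) (exit step)
    where
    step : next (act! c g) tt (heads ts) ≡ (inj₂ b , actions c a (heads ts))
    step rewrite lookup-heads c ts | e = refl

  module _ {p : Prog} where
    open Run (machineOf p)

    run-halted : ∀ t b ts → Config.control (run t (config (halt b) ts)) ≡ halt b
    run-halted zero    b ts = refl
    run-halted (suc t) b ts = run-halted t b ts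

    reach-halts : ∀ {s ts k b ts′ t} → Reach p s ts k b ts′ → k ≤ t →
                  Config.control (run t (config (at s) ts)) ≡ halt b
    reach-halts {b = b} {t = suc t} (exit {ts = ts} {as = as} e) (s≤s _)
      rewrite e = run-halted t b (zipWith act as ts)
    reach-halts (more e h) (s≤s k≤t) rewrite e = reach-halts h k≤t

    reach-haltsWithin : ∀ {k t b ts′} x u →
                        Reach p (start p) (load x ∷ load u ∷ Vec.replicate work (load [])) k b ts′ → k ≤ t →
                        HaltsWithin (machineOf p) t x u b
    reach-haltsWithin x u = reach-halts

-- Tape contents and Hoare triples

one : Sym
one = bit true

isOne isBlank : Sym → Bool
isOne (bit true)   = true
isOne (bit false)  = false
isOne blank        = false
isOne (aux _)      = false
isBlank blank      = true
isBlank (bit _)    = false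
isBlank (aux _)    = false

cell : List Sym → ℕ → Sym
cell []       _       = blank
cell (s ∷ _)  zero    = s
cell (_ ∷ ss) (suc k) = cell ss k

data Contents : Set where
  ones : ℕ → Contents
  word : List Bool → Contents

-- Cell 0 is a blank sentinel and the contents start at cell 1, where the head of a loaded tape
-- stands. A scan to the left stops at the sentinel.
symAt : Contents → ℕ → Sym
symAt _        zero    = blank
symAt (ones v) (suc j) = if j <ᵇ v then one else blank
symAt (word w) (suc j) = cell (map bit w) j

Desc : Set
Desc = Contents × ℕ

scanned : Desc → Sym
scanned (f , p) = symAt f p

-- Left of cell 0 truncated subtraction repeats cell 0, which is blank.
record Shows (f : ℕ → Sym) (p : ℕ) (t : Tape (Fin 0)) : Set where
  constructor shows
  field
    head≡   : Tape.head t ≡ f p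
    before≡ : ∀ k → cell (Tape.before t) k ≡ f (p ∸ suc k)
    after≡  : ∀ k → cell (Tape.after t) k ≡ f (suc p + k)

infix 4 _describes_
_describes_ : Desc → Tape (Fin 0) → Set
(f , p) describes t = Shows (symAt f) p t

Effect : Desc → Sym × Move → Desc → Set
Effect d a d′ = ∀ t → d describes t → d′ describes act a t

shows-right : ∀ {f p} t → Shows f p t → Shows f (suc p) (shift moveR t)
shows-right {f} {p} (tape ls s []) (shows h l r) =
  shows (trans (r 0) (cong (f ∘ suc) (+-identityʳ p)))
        (λ { zero → h ; (suc k) → l k })
        (λ k → trans (r (suc k)) (cong (f ∘ suc) (+-suc p k)))
shows-right {f} {p} (tape ls s (x ∷ rs)) (shows h l r) =
  shows (trans (r 0) (cong (f ∘ suc) (+-identityʳ p)))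
        (λ { zero → h ; (suc k) → l k })
        (λ k → trans (r (suc k)) (cong (f ∘ suc) (+-suc p k)))

shows-left : ∀ {f p} t → Shows f (suc p) t → Shows f p (shift moveL t)
shows-left {f} {p} (tape [] s rs) (shows h l r) =
  shows (l 0) (λ k → l (suc k))
        (λ { zero → trans h (cong (f ∘ suc) (sym (+-identityʳ p)))
           ; (suc k) → trans (r k) (cong (f ∘ suc) (sym (+-suc p k))) })
shows-left {f} {p} (tape (x ∷ ls) s rs) (shows h l r) =
  shows (l 0) (λ k → l (suc k))
        (λ { zero → trans h (cong (f ∘ suc) (sym (+-identityʳ p)))
           ; (suc k) → trans (r k) (cong (f ∘ suc) (sym (+-suc p k))) })

effect-right : ∀ {f p} → Effect (f , p) (symAt f p , moveR) (f , suc p)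
effect-right (tape ls s rs) (shows h l r) = shows-right (tape ls _ rs) (shows refl l r)

effect-left : ∀ {f p} → Effect (f , suc p) (symAt f (suc p) , moveL) (f , p)
effect-left (tape ls s rs) (shows h l r) = shows-left (tape ls _ rs) (shows refl l r)

effect-stay : ∀ {f p} → Effect (f , p) (symAt f p , stay) (f , p)
effect-stay (tape ls s rs) (shows h l r) = shows refl l r

below : ∀ {v j} → j < v → (j <ᵇ v) ≡ true
below {suc v} {zero}  _         = refl
below {suc v} {suc j} (s≤s j<v) = below j<v

notBelow : ∀ {v j} → v ≤ j → (j <ᵇ v) ≡ false
notBelow z≤n       = refl
notBelow (s≤s v≤j) = notBelow v≤j

ones-suc : ∀ v j → j ≢ v → symAt (ones v) (suc j) ≡ symAt (ones (suc v)) (suc j)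
ones-suc v j j≢v = cong (if_then one else blank) (lemma v j j≢v)
  where
  lemma : ∀ v j → j ≢ v → (j <ᵇ v) ≡ (j <ᵇ suc v)
  lemma zero    zero    j≢v = contradiction refl j≢v
  lemma zero    (suc j) j≢v = refl
  lemma (suc v) zero    j≢v = refl
  lemma (suc v) (suc j) j≢v = lemma v j (j≢v ∘ cong suc)

ones-last : ∀ v → symAt (ones (suc v)) (suc v) ≡ one
ones-last v rewrite below (≤-refl {suc v}) = refl

ones-end : ∀ v → symAt (ones v) (suc v) ≡ blank
ones-end v rewrite notBelow (≤-refl {v}) = refl

module _ (v : ℕ) where

  before-agree : ∀ k → symAt (ones v) (v ∸ k) ≡ symAt (ones (suc v)) (v ∸ k)
  before-agree k with v ∸ k in e
  ... | zero  = refl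
  ... | suc j = ones-suc v j λ { refl → contradiction (subst (_≤ v) e (m∸n≤m v k)) 1+n≰n }

  after-agree : ∀ k → symAt (ones v) (suc (suc v + k)) ≡ symAt (ones (suc v)) (suc (suc v + k))
  after-agree k = ones-suc v (suc v + k) λ e → contradiction (subst (suc v ≤_) e (m≤m+n (suc v) k)) 1+n≰n

  grow : Effect (ones v , suc v) (one , stay) (ones (suc v) , suc v)
  grow (tape ls s rs) (shows h l r) =
    shows (sym (ones-last v)) (λ k → trans (l k) (before-agree k)) (λ k → trans (r k) (after-agree k))

  shrink : Effect (ones (suc v) , suc v) (blank , stay) (ones v , suc v)
  shrink (tape ls s rs) (shows h l r) =
    shows (sym (ones-end v)) (λ k → trans (l k) (sym (before-agree k)))
          (λ k → trans (r k) (sym (after-agree k)))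

  grow-right : Effect (ones v , suc v) (one , moveR) (ones (suc v) , suc (suc v))
  grow-right t d = shows-right (act (one , stay) t) (grow t d)

  shrink-left : Effect (ones (suc v) , suc v) (blank , moveL) (ones v , v)
  shrink-left t d = shows-left (act (blank , stay) t) (shrink t d)

load-shows : ∀ w → (word w , 1) describes load w
load-shows []      = shows refl (λ k → cong (symAt (word [])) (sym (0∸n≡0 k))) (λ _ → refl)
load-shows (b ∷ w) = shows refl (λ k → cong (symAt (word (b ∷ w))) (sym (0∸n≡0 k))) (λ _ → refl)

load-ones : (ones 0 , 1) describes load []
load-ones = shows refl (λ k → cong (symAt (ones 0)) (sym (0∸n≡0 k))) (λ _ → refl)

module Triples (work : ℕ) where
  open Programs work public

  State : Set
  State = TapeIx → Desc

  infixl 6 _[_↦_]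
  _[_↦_] : State → TapeIx → Desc → State
  (σ [ c ↦ d ]) c′ = if ⌊ c′ ≟ c ⌋ then d else σ c′

  at-same : ∀ σ c d → (σ [ c ↦ d ]) c ≡ d
  at-same σ c d with c ≟ c
  ... | yes _  = refl
  ... | no c≢c = contradiction refl c≢c

  at-other : ∀ σ {c c′} d → c′ ≢ c → (σ [ c ↦ d ]) c′ ≡ σ c′
  at-other σ {c} {c′} d c′≢c with c′ ≟ c
  ... | yes e = contradiction e c′≢c
  ... | no _  = refl

  upd-cong : ∀ {σ τ} c d → σ ≗ τ → (σ [ c ↦ d ]) ≗ (τ [ c ↦ d ])
  upd-cong c d e c′ with c′ ≟ c
  ... | yes _ = refl
  ... | no _  = e c′

  upd-twice : ∀ σ c d d′ → (σ [ c ↦ d ] [ c ↦ d′ ]) ≗ (σ [ c ↦ d′ ])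
  upd-twice σ c d d′ c′ with c′ ≟ c
  ... | yes _ = refl
  ... | no _  = refl

  upd-id : ∀ σ c d → σ c ≡ d → (σ [ c ↦ d ]) ≗ σ
  upd-id σ c d e c′ with c′ ≟ c
  ... | yes refl = sym e
  ... | no _     = refl

  upd-swap : ∀ σ {c c′} d d′ → c ≢ c′ → (σ [ c ↦ d ] [ c′ ↦ d′ ]) ≗ (σ [ c′ ↦ d′ ] [ c ↦ d ])
  upd-swap σ {c} {c′} d d′ c≢c′ c″ with c″ ≟ c′ | c″ ≟ c
  ... | yes p | yes q = contradiction (trans (sym q) p) c≢c′
  ... | yes _ | no _  = refl
  ... | no _  | yes _ = refl
  ... | no _  | no _  = refl

  infix 4 _⊨_
  _⊨_ : Tapes → State → Set
  ts ⊨ σ = ∀ c → σ c describes lookup ts c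

  -- Total correctness with a time bound. A state prescribes every tape, so the frame condition is
  -- built in; states are functions compared pointwise, hence `pre` and `post`.
  Triple : Prog → State → Bool → State → ℕ → Set
  Triple p σ b τ k = ∀ ts → ts ⊨ σ →
    ∃[ l ] ∃[ ts′ ] l ≤ k × Reach p (start p) ts l b ts′ × ts′ ⊨ τ

  pre : ∀ {p σ σ′ b τ k} → σ ≗ σ′ → Triple p σ b τ k → Triple p σ′ b τ k
  pre e h ts m = h ts λ c → subst (_describes lookup ts c) (sym (e c)) (m c)

  post : ∀ {p σ b τ τ′ k} → τ ≗ τ′ → Triple p σ b τ k → Triple p σ b τ′ k
  post e h ts m with h ts m
  ... | l , ts′ , l≤k , r , m′ = l , ts′ , l≤k , r , λ c → subst (_describes lookup ts′ c) (e c) (m′ c)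

  result : ∀ {p σ b b′ τ k} → b ≡ b′ → Triple p σ b τ k → Triple p σ b′ τ k
  result refl h = h

  within : ∀ {p σ b τ k k′} → k ≤ k′ → Triple p σ b τ k → Triple p σ b τ k′
  within k≤k′ h ts m with h ts m
  ... | l , ts′ , l≤k , r = l , ts′ , ≤-trans l≤k k≤k′ , r

  t-act : ∀ {c g σ b a d} → g (scanned (σ c)) ≡ (b , a) → Effect (σ c) a d →
          Triple (act! c g) σ b (σ [ c ↦ d ]) 1
  t-act {c} {g} {σ} {b} {a} {d} e eff ts m =
    1 , _ , ≤-refl , reach-act c g ts (trans (cong g (Shows.head≡ (m c))) e) , fits
    where
    fits : (ts [ c ]≔ act a (lookup ts c)) ⊨ (σ [ c ↦ d ])
    fits c′ with c′ ≟ c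
    ... | yes refl rewrite lookup∘update c ts (act a (lookup ts c)) = eff _ (m c)
    ... | no c′≢c rewrite lookup∘update′ c′≢c ts (act a (lookup ts c)) = m c′

  t-then : ∀ {p q r σ τ υ b k l} → Triple p σ true τ k → Triple q τ b υ l →
           Triple (branch p q r) σ b υ (k + l)
  t-then f g ts m with f ts m
  ... | _ , ts′ , ≤k , r , m′ with g ts′ m′
  ...   | _ , ts″ , ≤l , r′ , m″ = _ , ts″ , +-mono-≤ ≤k ≤l , reach-branch-true r r′ , m″

  t-else : ∀ {p q r σ τ υ b k l} → Triple p σ false τ k → Triple r τ b υ l →
           Triple (branch p q r) σ b υ (k + l)
  t-else f g ts m with f ts m
  ... | _ , ts′ , ≤k , r , m′ with g ts′ m′
  ...   | _ , ts″ , ≤l , r′ , m″ = _ , ts″ , +-mono-≤ ≤k ≤l , reach-branch-false r r′ , m″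

  t-again : ∀ {p σ τ υ b k l} → Triple p σ true τ k → Triple (loop p) τ b υ l →
            Triple (loop p) σ b υ (k + l)
  t-again f g ts m with f ts m
  ... | _ , ts′ , ≤k , r , m′ with g ts′ m′
  ...   | _ , ts″ , ≤l , r′ , m″ = _ , ts″ , +-mono-≤ ≤k ≤l , reach-loop-true r r′ , m″

  t-stop : ∀ {p σ τ k} → Triple p σ false τ k → Triple (loop p) σ true τ k
  t-stop f ts m with f ts m
  ... | _ , ts′ , ≤k , r , m′ = _ , ts′ , ≤k , reach-loop-false r , m′

  t-seq : ∀ {p q σ τ υ b b′ k l} → Triple p σ b τ k → Triple q τ b′ υ l →
          Triple (seq p q) σ b′ υ (k + l)
  t-seq f g ts m with f ts m
  ... | _ , ts′ , ≤k , r , m′ with g ts′ m′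
  ...   | _ , ts″ , ≤l , r′ , m″ = _ , ts″ , +-mono-≤ ≤k ≤l , reach-seq r r′ , m″

  test : TapeIx → (Sym → Bool) → Prog
  test c g = act! c λ s → g s , s , stay

  const! : Bool → Prog
  const! b = test zero λ _ → b

  go : Move → TapeIx → Prog
  go m c = act! c λ s → true , s , m

  t-test : ∀ {c g σ b} → g (scanned (σ c)) ≡ b → Triple (test c g) σ b σ 1
  t-test {c} {g} {σ} e =
    post (upd-id σ c (σ c) refl) (t-act (cong (λ b → b , scanned (σ c) , stay) e) effect-stay)

  t-const : ∀ {b σ} → Triple (const! b) σ b σ 1
  t-const = t-test refl

  t-right : ∀ {c σ f p} → σ c ≡ (f , p) → Triple (go moveR c) σ true (σ [ c ↦ (f , suc p) ]) 1
  t-right {c} {σ} e = t-act refl (subst (λ d → Effect d (scanned d , moveR) _) (sym e) effect-right)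

  t-left : ∀ {c σ f p} → σ c ≡ (f , suc p) → Triple (go moveL c) σ true (σ [ c ↦ (f , p) ]) 1
  t-left {c} {σ} e = t-act refl (subst (λ d → Effect d (scanned d , moveL) _) (sym e) effect-left)

-- Unary counters and loops

module Layout (vars : ℕ) where
  open Triples (3 + vars) public

  inputTape certTape : TapeIx
  inputTape = zero
  certTape  = suc zero

  -- Passing over a block of n³ entries takes three nested loops, each with a counter of its own,
  -- hence three copies of n. The leading index of a tuple is counted on its variable tape, which
  -- gives the bound 4 on the arity of atoms.
  sizeTape : ℕ → TapeIx
  sizeTape zero          = suc (suc zero)
  sizeTape (suc zero)    = suc (suc (suc zero))
  sizeTape (suc (suc _)) = suc (suc (suc (suc zero)))

  varTape : Fin vars → TapeIx
  varTape i = suc (suc (suc (suc (suc i))))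

  varTape-injective : ∀ {i j} → varTape i ≡ varTape j → i ≡ j
  varTape-injective refl = refl

  backStep : Sym → Bool × (Sym × Move)
  backStep blank     = false , blank , moveR
  backStep (bit b)   = true , bit b , moveL
  backStep (aux a)   = true , aux a , moveL

  -- The first move leaves the blank behind the last mark, on which a completed scan stops; the loop
  -- then runs to the sentinel and steps back to cell 1.
  rewind : TapeIx → Prog
  rewind c = seq (go moveL c) (loop (act! c backStep))

  t-rewind : ∀ c {σ v p} → σ c ≡ (ones v , suc p) → p ≤ v →
             Triple (rewind c) σ true (σ [ c ↦ (ones v , 1) ]) (p + 2)
  t-rewind c {σ} {v} {p} e p≤v =
    within (≤-reflexive (+-comm 2 p)) (post (upd-twice σ c _ _)
      (t-seq (t-left e) (back (at-same σ c _) p≤v)))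
    where
    back : ∀ {σ p} → σ c ≡ (ones v , p) → p ≤ v →
           Triple (loop (act! c backStep)) σ true (σ [ c ↦ (ones v , 1) ]) (suc p)
    back {σ} {zero} e _ =
      t-stop (t-act (cong (backStep ∘ scanned) e)
                    (subst (λ d → Effect d (blank , moveR) (ones v , 1)) (sym e) effect-right))
    back {σ} {suc p} e p<v =
      post (upd-twice σ c _ _)
        (t-again (t-act (trans (cong (backStep ∘ scanned) e) (cong backStep sc))
                        (subst (λ d → Effect d (one , moveL) (ones v , p)) (sym e)
                          (subst (λ s → Effect (ones v , suc p) (s , moveL) (ones v , p)) sc effect-left)))
                 (back (at-same σ c _) (<⇒≤ p<v)))
      where
      sc : symAt (ones v) (suc p) ≡ one
      sc rewrite below p<v = refl

  -- The counter is the position of the head on `c`. The number on the tape survives, so a variable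
  -- can drive the very loop that walks to its entry in a table.
  for : TapeIx → Prog → Prog
  for c body = seq (loop (branch (test c isOne) (seq body (go moveR c)) (const! false))) (rewind c)

  one-below : ∀ {d v j} → d ≡ (ones v , suc j) → j < v → isOne (scanned d) ≡ true
  one-below refl j<v rewrite below j<v = refl

  not-one-above : ∀ {d v j} → d ≡ (ones v , suc j) → v ≤ j → isOne (scanned d) ≡ false
  not-one-above refl v≤j rewrite notBelow v≤j = refl

  t-for : ∀ c {body v k} (ρ : ℕ → State) →
          (∀ j → j < v → Triple body (ρ j [ c ↦ (ones v , suc j) ]) true
                                     (ρ (suc j) [ c ↦ (ones v , suc j) ]) k) →
          Triple (for c body) (ρ 0 [ c ↦ (ones v , 1) ]) true (ρ v [ c ↦ (ones v , 1) ])
                 (v * (k + 2) + (v + 4))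
  t-for c {body} {v} {k} ρ h =
    within (≤-reflexive (arith v k))
      (post (upd-twice (ρ v) c _ _)
        (t-seq (iterate v 0 refl) (t-rewind c (at-same (ρ v) c _) ≤-refl)))
    where
    arith : ∀ v k → v * (k + 2) + 2 + (v + 2) ≡ v * (k + 2) + (v + 4)
    arith = solve-∀
    iterate : ∀ m j → j + m ≡ v →
              Triple (loop (branch (test c isOne) (seq body (go moveR c)) (const! false)))
                     (ρ j [ c ↦ (ones v , suc j) ]) true (ρ v [ c ↦ (ones v , suc v) ]) (m * (k + 2) + 2)
    iterate zero j e rewrite trans (sym (+-identityʳ j)) e =
      t-stop (t-else (t-test (not-one-above (at-same (ρ v) c _) ≤-refl)) t-const)
    iterate (suc m) j e =
      within (≤-reflexive (arith′ m k))
        (t-again (t-then (t-test (one-below (at-same (ρ j) c _) j<v))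
                         (t-seq (h j j<v) (post (upd-twice (ρ (suc j)) c _ _)
                           (t-right (at-same (ρ (suc j)) c _)))))
                 (iterate m (suc j) (trans (sym (+-suc j m)) e)))
      where
      j<v : j < v
      j<v = subst (suc j ≤_) (trans (sym (+-suc j m)) e) (m≤m+n (suc j) m)
      arith′ : ∀ m k → 1 + (k + 1) + (m * (k + 2) + 2) ≡ suc m * (k + 2) + 2
      arith′ = solve-∀

  data Dir : Set where
    fwd bwd : Dir

  moveOf : Dir → Move
  moveOf fwd = moveR
  moveOf bwd = moveL

  -- A backward shift is described as leading from `a + s` to `a`. This avoids subtraction, and the
  -- way back ends literally where the way forth began.
  source target : Dir → ℕ → ℕ → ℕ
  source fwd a s = a
  source bwd a s = a + s
  target fwd a s = a + s
  target bwd a s = a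

  record Shifts (G : State → Set) (τ : TapeIx) (d : Dir) (p : Prog) (s k : ℕ) : Set where
    constructor shifting
    field
      shifts : ∀ σ f a → G σ → σ τ ≡ (f , source d a s) →
               Triple p σ true (σ [ τ ↦ (f , target d a s) ]) k
  open Shifts public

  Stable : (State → Set) → TapeIx → Set
  Stable G τ = ∀ {σ} d → G σ → G (σ [ τ ↦ d ])

  shifts-seq : ∀ {G τ d p q s s′ k k′} → Stable G τ → Shifts G τ d p s k → Shifts G τ d q s′ k′ →
               Shifts G τ d (seq p q) (s + s′) (k + k′)
  shifts-seq {τ = τ} {fwd} {s = s} {s′} st (shifting f) (shifting g) = shifting λ σ c a G e →
    post (λ x → trans (upd-twice σ τ _ _ x) (cong (λ b → (σ [ τ ↦ (c , b) ]) x) (+-assoc a s s′)))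
      (t-seq (f σ c a G e) (g _ c (a + s) (st _ G) (at-same σ τ _)))
  shifts-seq {τ = τ} {bwd} {s = s} {s′} st (shifting f) (shifting g) = shifting λ σ c a G e →
    post (upd-twice σ τ _ _)
      (t-seq (f σ c (a + s′) G (trans e (cong (c ,_) (arith a s s′)))) (g _ c a (st _ G) (at-same σ τ _)))
    where
    arith : ∀ a s s′ → a + (s + s′) ≡ a + s′ + s
    arith = solve-∀

  moves : Dir → TapeIx → ℕ → Prog
  moves d τ zero    = const! true
  moves d τ (suc z) = seq (go (moveOf d) τ) (moves d τ z)

  shifts-moves : ∀ {G τ} d z → Stable G τ → Shifts G τ d (moves d τ z) z (suc z)
  shifts-moves {τ = τ} fwd zero st = shifting λ σ f a G e →
    post (λ x → trans (sym (upd-id σ τ _ e x)) (cong (λ b → (σ [ τ ↦ (f , b) ]) x) (sym (+-identityʳ a))))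
      t-const
  shifts-moves {τ = τ} bwd zero st = shifting λ σ f a G e →
    post (λ x → trans (sym (upd-id σ τ _ e x)) (cong (λ b → (σ [ τ ↦ (f , b) ]) x) (+-identityʳ a))) t-const
  shifts-moves {G} {τ} fwd (suc z) st =
    shifts-seq st (shifting λ σ f a G e → subst (λ b → Triple (go moveR τ) σ true (σ [ τ ↦ (f , b) ]) 1)
      (+-comm 1 a) (t-right e))
                  (shifts-moves fwd z st)
  shifts-moves {G} {τ} bwd (suc z) st =
    shifts-seq st (shifting λ σ f a G e → t-left (trans e (cong (f ,_) (+-comm a 1))))
                  (shifts-moves bwd z st)

  -- While the loop runs, the head of `c` is away from cell 1, so the body may rely only on the
  -- weaker invariant `G′`.
  shifts-for : ∀ {G G′ τ d p s k v} c → c ≢ τ → (∀ {σ} → G σ → σ c ≡ (ones v , 1)) → Stable G τ →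
               (∀ {σ} j → G σ → G′ (σ [ c ↦ (ones v , suc j) ])) →
               Shifts G′ τ d p s k → Shifts G τ d (for c p) (v * s) (v * (k + 2) + (v + 4))
  shifts-for {τ = τ} {fwd} {p} {s} {k} {v} c c≢τ parked st weak (shifting h) = shifting λ σ f a G e →
    post (upd-id (σ [ τ ↦ (f , a + v * s) ]) c _ (trans (at-other σ _ c≢τ) (parked G)))
      (pre (λ x → trans (upd-cong c _ (upd-id σ τ _ (trans e (cong (f ,_) (sym (+-identityʳ a))))) x)
                        (upd-id σ c _ (parked G) x))
        (t-for c (λ j → σ [ τ ↦ (f , a + j * s) ]) λ j j<v →
          post (λ x → trans (upd-swap (σ [ τ ↦ _ ]) _ _ c≢τ x)
                     (upd-cong c _ (λ y → trans (upd-twice σ τ _ _ y)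
                       (cong (λ b → (σ [ τ ↦ (f , b) ]) y) (arith a j s))) x))
            (h _ f (a + j * s) (weak j (st _ G))
               (trans (at-other (σ [ τ ↦ _ ]) _ (c≢τ ∘ sym)) (at-same σ τ _)))))
    where
    arith : ∀ a j s → a + j * s + s ≡ a + suc j * s
    arith = solve-∀
  shifts-for {τ = τ} {bwd} {p} {s} {k} {v} c c≢τ parked st weak (shifting h) = shifting λ σ f a G e →
    post (λ x → trans (upd-id (σ [ τ ↦ (f , a + (v ∸ v) * s) ]) c _ (trans (at-other σ _ c≢τ) (parked G)) x)
                      (cong (λ b → (σ [ τ ↦ (f , b) ]) x)
                        (trans (cong (λ z → a + z * s) (n∸n≡0 v)) (+-identityʳ a))))
      (pre (λ x → trans (upd-cong c _ (upd-id σ τ _ e) x) (upd-id σ c _ (parked G) x))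
        (t-for c (λ j → σ [ τ ↦ (f , a + (v ∸ j) * s) ]) λ j j<v →
          post (λ x → trans (upd-swap (σ [ τ ↦ _ ]) _ _ c≢τ x)
                            (upd-cong c _ (upd-twice σ τ _ _) x))
            (h _ f (a + (v ∸ suc j) * s) (weak j (st _ G))
               (trans (at-other (σ [ τ ↦ _ ]) _ (c≢τ ∘ sym))
                 (trans (at-same σ τ _) (cong (f ,_) (trans (cong (λ z → a + z * s) (∸-suc j<v))
                   (arith a (v ∸ suc j) s))))))))
    where
    arith : ∀ a j s → a + suc j * s ≡ a + j * s + s
    arith = solve-∀
    ∸-suc : ∀ {j v} → j < v → v ∸ j ≡ suc (v ∸ suc j)
    ∸-suc {zero}  {suc v} _         = refl
    ∸-suc {suc j} {suc v} (s≤s j<v) = ∸-suc j<v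

  -- Comparing and changing unary counters

  advanceBoth : TapeIx → TapeIx → Prog
  advanceBoth c c′ =
    branch (test c isOne)
           (branch (test c′ isOne) (seq (go moveR c) (go moveR c′)) (const! false))
           (const! false)

  rewindBoth : TapeIx → TapeIx → Bool → Prog
  rewindBoth c c′ b = seq (rewind c) (seq (rewind c′) (const! b))

  verdictOn : (Sym → Bool) → (Sym → Bool) → TapeIx → TapeIx → Prog
  verdictOn g g′ c c′ =
    branch (branch (test c g) (test c′ g′) (const! false)) (rewindBoth c c′ true) (rewindBoth c c′ false)

  -- Both heads advance together up to the smaller number, and the two symbols found there decide:
  -- blank against one means less, blank against blank means equal. The two tapes have to differ,
  -- which is the side condition of `eq` and `lt`.
  cmp : (Sym → Bool) → (Sym → Bool) → TapeIx → TapeIx → Prog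
  cmp g g′ c c′ = seq (loop (advanceBoth c c′)) (verdictOn g g′ c c′)

  compared : (Sym → Bool) → (Sym → Bool) → ℕ → ℕ → Bool
  compared g g′ v w = g (symAt (ones v) (suc (v ⊓ w))) ∧ g′ (symAt (ones w) (suc (v ⊓ w)))

  t-cmp : ∀ g g′ c c′ {σ v w n} → c ≢ c′ → σ c ≡ (ones v , 1) → σ c′ ≡ (ones w , 1) → v ≤ n → w ≤ n →
          Triple (cmp g g′ c c′) σ (compared g g′ v w) σ (6 * n + 14)
  t-cmp g g′ c c′ {σ} {v} {w} {n} c≢c′ e e′ v≤n w≤n =
    within bound (pre start≗ (t-seq (scan m 0 refl) decide))
    where
    m = v ⊓ w
    both : ℕ → State
    both j = σ [ c ↦ (ones v , suc j) ] [ c′ ↦ (ones w , suc j) ]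
    both-c : ∀ j → both j c ≡ (ones v , suc j)
    both-c j = trans (at-other (σ [ c ↦ _ ]) _ c≢c′) (at-same σ c _)
    both-c′ : ∀ j → both j c′ ≡ (ones w , suc j)
    both-c′ j = at-same (σ [ c ↦ _ ]) c′ _
    set-c : ∀ j i → (both j [ c ↦ (ones v , suc i) ]) ≗ (σ [ c ↦ (ones v , suc i) ] [ c′ ↦ (ones w , suc j) ])
    set-c j i x = trans (upd-swap (σ [ c ↦ _ ]) _ _ (c≢c′ ∘ sym) x) (upd-cong c′ _ (upd-twice σ c _ _) x)
    set-both : ∀ j i → (both j [ c ↦ (ones v , suc i) ] [ c′ ↦ (ones w , suc i) ]) ≗ both i
    set-both j i x = trans (upd-cong c′ _ (set-c j i) x) (upd-twice (σ [ c ↦ _ ]) c′ _ _ x)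
    start≗ : both 0 ≗ σ
    start≗ x = trans (upd-cong c′ _ (upd-id σ c _ e) x) (upd-id σ c′ _ e′ x)
    scan : ∀ k j → j + k ≡ m → Triple (loop (advanceBoth c c′)) (both j) true (both m) (k * 4 + 3)
    scan zero j eq rewrite trans (sym (+-identityʳ j)) eq = t-stop stop
      where
      stop : Triple (advanceBoth c c′) (both m) false (both m) 3
      stop with m <? v | m <? w
      ... | no ¬p | _ =
        within (s≤s (s≤s z≤n)) (t-else (t-test (not-one-above (both-c m) (≮⇒≥ ¬p))) t-const)
      ... | yes p | no ¬q =
        t-then (t-test (one-below (both-c m) p)) (t-else (t-test (not-one-above (both-c′ m) (≮⇒≥ ¬q)))
          t-const)
      ... | yes p | yes q =
        contradiction (⊓-pres-m< p q) (<-irrefl refl)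
    scan (suc k) j eq =
      t-again (t-then (t-test (one-below (both-c j) (≤-trans j<m (m⊓n≤m v w))))
                      (t-then (t-test (one-below (both-c′ j) (≤-trans j<m (m⊓n≤n v w))))
                        (post (set-both j (suc j))
                          (t-seq (t-right (both-c j))
                                 (t-right (trans (at-other (both j) _ (c≢c′ ∘ sym)) (both-c′ j)))))))
              (scan k (suc j) (trans (sym (+-suc j k)) eq))
      where
      j<m : j < m
      j<m = subst (suc j ≤_) (trans (sym (+-suc j k)) eq) (m≤m+n (suc j) k)
    finish : ∀ b → Triple (rewindBoth c c′ b) (both m) b σ ((m + 2) + ((m + 2) + 1))
    finish b =
      post (λ x → trans (set-both m 0 x) (start≗ x))
        (t-seq (t-rewind c (both-c m) (m⊓n≤m v w))
          (t-seq (t-rewind c′ (trans (at-other (both m) _ (c≢c′ ∘ sym)) (both-c′ m)) (m⊓n≤n v w)) t-const))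
    decide : Triple (verdictOn g g′ c c′) (both m) (compared g g′ v w) σ (2 + ((m + 2) + ((m + 2) + 1)))
    decide with g (symAt (ones v) (suc m)) in eg
    ... | false = t-else (t-else (t-test (trans (cong (g ∘ scanned) (both-c m)) eg)) t-const) (finish false)
    ... | true with g′ (symAt (ones w) (suc m)) in eg′
    ...   | true  = t-then (t-then (t-test (trans (cong (g ∘ scanned) (both-c m)) eg))
                                   (t-test (trans (cong (g′ ∘ scanned) (both-c′ m)) eg′))) (finish true)
    ...   | false = t-else (t-then (t-test (trans (cong (g ∘ scanned) (both-c m)) eg))
                                   (t-test (trans (cong (g′ ∘ scanned) (both-c′ m)) eg′))) (finish false)
    arith : ∀ m → m * 4 + 3 + (2 + ((m + 2) + ((m + 2) + 1))) ≡ 6 * m + 10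
    arith = solve-∀
    bound : m * 4 + 3 + (2 + ((m + 2) + ((m + 2) + 1))) ≤ 6 * n + 14
    bound = ≤-trans (≤-reflexive (arith m))
              (+-mono-≤ (*-monoʳ-≤ 6 (≤-trans (m⊓n≤m v w) v≤n)) (m≤m+n 10 4))

  less equal : TapeIx → TapeIx → Prog
  less  = cmp isBlank isOne
  equal = cmp isBlank isBlank

  compared-less : ∀ v w → compared isBlank isOne v w ≡ (v <ᵇ w)
  compared-less zero    zero    = refl
  compared-less zero    (suc w) = refl
  compared-less (suc v) zero    = refl
  compared-less (suc v) (suc w) = compared-less v w

  compared-equal : ∀ v w → compared isBlank isBlank v w ≡ (v ≡ᵇ w)
  compared-equal zero    zero    = refl
  compared-equal zero    (suc w) = refl
  compared-equal (suc v) zero    = refl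
  compared-equal (suc v) (suc w) = compared-equal v w

  endStep : Sym → Bool × (Sym × Move)
  endStep blank   = false , blank , stay
  endStep (bit b) = true , bit b , moveR
  endStep (aux a) = true , aux a , moveR

  seekEnd : TapeIx → Prog
  seekEnd c = loop (act! c endStep)

  t-seekEnd : ∀ c {σ v} → σ c ≡ (ones v , 1) → Triple (seekEnd c) σ true (σ [ c ↦ (ones v , suc v) ]) (suc v)
  t-seekEnd c {σ} {v} e = pre (upd-id σ c _ e) (scan v 0 refl)
    where
    scan : ∀ k j → j + k ≡ v → Triple (seekEnd c) (σ [ c ↦ (ones v , suc j) ]) true
      (σ [ c ↦ (ones v , suc v) ]) (suc k)
    scan zero j eq rewrite trans (sym (+-identityʳ j)) eq =
      t-stop (post (upd-twice σ c _ _) (t-act {d = ones v , suc v}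
        (cong endStep (trans (cong scanned (at-same σ c _)) (ones-end v)))
        (subst (λ d → Effect d (blank , stay) (ones v , suc v)) (sym (at-same σ c _))
          (subst (λ s → Effect (ones v , suc v) (s , stay) (ones v , suc v)) (ones-end v) effect-stay))))
    scan (suc k) j eq =
      t-again (post (upd-twice σ c _ _) (t-act {d = ones v , suc (suc j)}
        (cong endStep (trans (cong scanned (at-same σ c _)) sc))
        (subst (λ d → Effect d (one , moveR) (ones v , suc (suc j))) (sym (at-same σ c _))
          (subst (λ s → Effect (ones v , suc j) (s , moveR) (ones v , suc (suc j))) sc effect-right))))
        (scan k (suc j) (trans (sym (+-suc j k)) eq))
      where
      sc : symAt (ones v) (suc j) ≡ one
      sc rewrite below (subst (suc j ≤_) (trans (sym (+-suc j k)) eq) (m≤m+n (suc j) k)) = refl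

  increment : TapeIx → Prog
  increment c = seq (seekEnd c) (seq (act! c λ _ → true , one , moveR) (seq (rewind c) (const! true)))

  t-increment : ∀ c {σ v} → σ c ≡ (ones v , 1) →
                Triple (increment c) σ true (σ [ c ↦ (ones (suc v) , 1) ]) (2 * v + 6)
  t-increment c {σ} {v} e =
    within (≤-reflexive (arith v))
      (post (upd-twice σ c _ _)
        (t-seq (t-seekEnd c e)
          (t-seq (t-act {d = ones (suc v) , suc (suc v)} refl
                        (subst (λ d → Effect d (one , moveR) _) (sym (at-same σ c _)) (grow-right v)))
            (t-seq (post (upd-twice (σ [ c ↦ _ ]) c _ _) (t-rewind c (at-same (σ [ c ↦ _ ]) c _) ≤-refl))
              t-const))))
    where
    arith : ∀ v → suc v + (1 + (suc v + 2 + 1)) ≡ 2 * v + 6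
    arith = solve-∀

  eraseStep : Sym → Bool × (Sym × Move)
  eraseStep blank   = false , blank , moveR
  eraseStep (bit _) = true , blank , moveL
  eraseStep (aux _) = true , blank , moveL

  clear : TapeIx → Prog
  clear c = seq (seekEnd c) (seq (go moveL c) (loop (act! c eraseStep)))

  t-clear : ∀ c {σ v} → σ c ≡ (ones v , 1) → Triple (clear c) σ true (σ [ c ↦ (ones 0 , 1) ]) (2 * v + 3)
  t-clear c {σ} {v} e =
    within (≤-reflexive (arith v))
      (post (upd-twice σ c _ _)
        (t-seq (t-seekEnd c e)
          (t-seq (t-left (at-same σ c _)) (post (upd-twice (σ [ c ↦ _ ]) c _ _)
            (erase v (at-same (σ [ c ↦ _ ]) c _))))))
    where
    arith : ∀ v → suc v + (1 + suc v) ≡ 2 * v + 3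
    arith = solve-∀
    erase : ∀ {σ} v → σ c ≡ (ones v , v) → Triple (loop (act! c eraseStep)) σ true
      (σ [ c ↦ (ones 0 , 1) ]) (suc v)
    erase {σ} zero e =
      t-stop (t-act (cong (eraseStep ∘ scanned) e) (subst (λ d → Effect d (blank , moveR) (ones 0 , 1))
        (sym e) effect-right))
    erase {σ} (suc v) e =
      post (upd-twice σ c _ _)
        (t-again (t-act {d = ones v , v} (cong eraseStep (trans (cong scanned e) (ones-last v)))
                        (subst (λ d → Effect d (blank , moveL) (ones v , v)) (sym e) (shrink-left v)))
                 (erase v (at-same σ c _)))

-- First-order formulas over bit tables

infixl 6 _⊕_
infixl 7 _⊗_
-- Symbolic polynomials with natural coefficients: time bounds follow the structure of programs, are
-- monotone for free, and become coefficient lists only at the end.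
data Cost : Set where
  K   : ℕ → Cost
  X   : Cost
  _⊕_ : Cost → Cost → Cost
  _⊗_ : Cost → Cost → Cost

⟦_⟧ : Cost → ℕ → ℕ
⟦ K a ⟧   n = a
⟦ X ⟧     n = n
⟦ e ⊕ f ⟧ n = ⟦ e ⟧ n + ⟦ f ⟧ n
⟦ e ⊗ f ⟧ n = ⟦ e ⟧ n * ⟦ f ⟧ n

infixl 6 _[_≔_]
_[_≔_] : ∀ {k} → (Fin k → ℕ) → Fin k → ℕ → Fin k → ℕ
(ρ [ c ≔ v ]) i = if ⌊ i ≟ c ⌋ then v else ρ i

data Source : Set where
  input certificate : Source

stride : Source → ℕ
stride input       = 1
stride certificate = 3

data Connective : Set where
  conj disj impl : Connective

connect : Connective → Bool → Bool → Bool
connect conj a b = a ∧ b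
connect disj a b = a ∨ b
connect impl a b = not a ∨ b

-- The index is the quantifier depth; `all` binds the variable of that number.
data Fm (vars : ℕ) : ℕ → Set where
  atom   : ∀ {d} (s : Source) (is : List (Fin vars)) (r : ℕ) {ok : True (length is ≤? 4)} → Fm vars d
  eq lt  : ∀ {d} (i j : Fin vars) {ok : False (i ≟ j)} → Fm vars d
  neg    : ∀ {d} → Fm vars d → Fm vars d
  bin    : ∀ {d} → Connective → Fm vars d → Fm vars d → Fm vars d
  all    : ∀ {d} {ok : True (d <? vars)} → Fm vars (suc d) → Fm vars d

allFrom : (ℕ → Bool) → ℕ → ℕ → Bool
allFrom f zero    v = true
allFrom f (suc m) v = f v ∧ allFrom f m (suc v)

volume : ℕ → ℕ → ℕ → ℕ
volume n z zero    = z
volume n z (suc k) = n * volume n z k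

bound : ∀ {d vars} → True (d <? vars) → Fin vars
bound ok = fromℕ< (toWitness ok)

module _ {vars : ℕ} (n : ℕ) where

  -- The row-major position of a tuple in a table whose entries have z bits; `r` selects the bit
  -- within the entry.
  offset : ℕ → (Fin vars → ℕ) → List (Fin vars) → ℕ → ℕ
  offset z ρ []       r = r
  offset z ρ (i ∷ is) r = ρ i * volume n z (length is) + offset z ρ is r

  eval : (Source → ℕ → Bool) → ∀ {d} → Fm vars d → (Fin vars → ℕ) → Bool
  eval rd (atom s is r) ρ = rd s (offset (stride s) ρ is r)
  eval rd (eq i j)      ρ = ρ i ≡ᵇ ρ j
  eval rd (lt i j)      ρ = ρ i <ᵇ ρ j
  eval rd (neg φ)       ρ = not (eval rd φ ρ)
  eval rd (bin c φ ψ)   ρ = connect c (eval rd φ ρ) (eval rd ψ ρ)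
  eval rd (all {ok = ok} φ) ρ = allFrom (λ v → eval rd φ (ρ [ bound ok ≔ v ])) n 0

-- Compilation of formulas into programs

module Compiler (vars : ℕ) where
  open Layout vars public

  sweep : Dir → TapeIx → ℕ → ℕ → Prog
  sweep d τ z zero    = moves d τ z
  sweep d τ z (suc k) = for (sizeTape k) (sweep d τ z k)

  sweepCost : ℕ → ℕ → Cost
  sweepCost z zero    = K (suc z)
  sweepCost z (suc k) = X ⊗ (sweepCost z k ⊕ K 2) ⊕ (X ⊕ K 4)

  sizeTape-distinct : ∀ {i k} → i < k → k < 3 → sizeTape k ≢ sizeTape i
  sizeTape-distinct {zero} {suc zero} _ _ ()
  sizeTape-distinct {zero} {suc (suc k)} _ _ ()
  sizeTape-distinct {suc zero} {suc (suc k)} _ _ ()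
  sizeTape-distinct {suc (suc i)} {suc (suc zero)} (s≤s (s≤s ())) _
  sizeTape-distinct {suc (suc i)} {suc (suc (suc k))} _ (s≤s (s≤s (s≤s ())))
  sizeTape-distinct {suc i} {suc zero} (s≤s ()) _

  -- Only the first k copies of n are at rest: the others may be counters of enclosing loops.
  SizesParked : ℕ → ℕ → State → Set
  SizesParked n k σ = ∀ i → i < k → σ (sizeTape i) ≡ (ones n , 1)

  module _ {τ : TapeIx} (size≢ : ∀ k → sizeTape k ≢ τ) where

    sizes-stable : ∀ {n k} → Stable (SizesParked n k) τ
    sizes-stable {n} {k} {σ} d P i i<k = trans (at-other σ d (size≢ i)) (P i i<k)

    shifts-sweep : ∀ {n} d z k → k ≤ 3 → Shifts (SizesParked n k) τ d (sweep d τ z k) (volume n z k)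
      (⟦ sweepCost z k ⟧ n)
    shifts-sweep {n} d z zero    _   = shifts-moves d z (λ {σ} → sizes-stable {n} {0} {σ})
    shifts-sweep {n} d z (suc k) k<3 =
      shifts-for (sizeTape k) (size≢ k) (λ P → P k ≤-refl) (λ {σ} → sizes-stable {n} {suc k} {σ})
        (λ {σ} j P i i<k → trans (at-other σ _ (λ e → sizeTape-distinct i<k k<3 (sym e)))
          (P i (≤-trans i<k (n≤1+n _))))
        (shifts-sweep d z k (<⇒≤ k<3))

  record Ready (n : ℕ) (ρ : Fin vars → ℕ) (σ : State) : Set where
    field
      sizes : SizesParked n 3 σ
      vals  : ∀ i → σ (varTape i) ≡ (ones (ρ i) , 1)

  varTape≢sizeTape : ∀ {i} k → varTape i ≢ sizeTape k
  varTape≢sizeTape zero ()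
  varTape≢sizeTape (suc zero) ()
  varTape≢sizeTape (suc (suc k)) ()

  walk : Dir → TapeIx → ℕ → List (Fin vars) → ℕ → Prog
  walk d τ z []       r = moves d τ r
  walk d τ z (i ∷ is) r = seq (for (varTape i) (sweep d τ z (length is))) (walk d τ z is r)

  walkCost : ℕ → List (Fin vars) → ℕ → Cost
  walkCost z []       r = K (suc r)
  walkCost z (i ∷ is) r = X ⊗ (sweepCost z (length is) ⊕ K 2) ⊕ (X ⊕ K 4) ⊕ walkCost z is r

  dataTape : Source → TapeIx
  dataTape input       = inputTape
  dataTape certificate = certTape

  sizeTape≢dataTape : ∀ s k → sizeTape k ≢ dataTape s
  sizeTape≢dataTape input       zero          ()
  sizeTape≢dataTape input       (suc zero)    ()
  sizeTape≢dataTape input       (suc (suc k)) ()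
  sizeTape≢dataTape certificate zero          ()
  sizeTape≢dataTape certificate (suc zero)    ()
  sizeTape≢dataTape certificate (suc (suc k)) ()

  varTape≢dataTape : ∀ s i → varTape i ≢ dataTape s
  varTape≢dataTape input       i ()
  varTape≢dataTape certificate i ()

  ready-stable : ∀ {n ρ} s → Stable (Ready n ρ) (dataTape s)
  ready-stable s {σ} d P = record
    { sizes = λ i i<3 → trans (at-other σ d (sizeTape≢dataTape s i)) (Ready.sizes P i i<3)
    ; vals  = λ i → trans (at-other σ d (varTape≢dataTape s i)) (Ready.vals P i) }

  module _ {n : ℕ} {ρ : Fin vars → ℕ} (ρ≤n : ∀ i → ρ i ≤ n) where

    shifts-walk : ∀ s d z is r → length is ≤ 4 →
                  Shifts (Ready n ρ) (dataTape s) d (walk d (dataTape s) z is r) (offset n z ρ is r)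
                    (⟦ walkCost z is r ⟧ n)
    shifts-walk s d z []       r _ = shifts-moves d r (ready-stable s)
    shifts-walk s d z (i ∷ is) r (s≤s ≤3) =
      shifts-seq (ready-stable s)
        (shifting λ σ f a P e → within (+-mono-≤ (*-monoˡ-≤ (⟦ sweepCost z (length is) ⟧ n + 2) (ρ≤n i))
          (+-monoˡ-≤ 4 (ρ≤n i)))
          (shifts (shifts-for (varTape i) (varTape≢dataTape s i) (λ P → Ready.vals P i) (ready-stable s)
            (λ {σ} j P k k<l → trans (at-other σ _ (λ e → varTape≢sizeTape k (sym e)))
              (Ready.sizes P k (≤-trans k<l ≤3)))
            (shifts-sweep (sizeTape≢dataTape s) d z (length is) ≤3)) σ f a P e))
        (shifts-walk s d z is r (≤-trans ≤3 (n≤1+n 3)))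

  readBit : Source → List (Fin vars) → ℕ → Prog
  readBit s is r =
    seq (walk fwd τ z is r)
        (branch (test τ isOne) (seq (walk bwd τ z is r) (const! true))
          (seq (walk bwd τ z is r) (const! false)))
    where
    τ = dataTape s
    z = stride s

  readCost : Source → List (Fin vars) → ℕ → Cost
  readCost s is r = walkCost (stride s) is r ⊕ (K 1 ⊕ (walkCost (stride s) is r ⊕ K 1))

  t-readBit : ∀ {n ρ} (ρ≤n : ∀ i → ρ i ≤ n) s is r {σ f a} → length is ≤ 4 → Ready n ρ σ →
              σ (dataTape s) ≡ (f , a) →
              Triple (readBit s is r) σ (isOne (symAt f (a + offset n (stride s) ρ is r))) σ
                (⟦ readCost s is r ⟧ n)
  t-readBit {n} {ρ} ρ≤n s is r {σ} {f} {a} ≤4 P e =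
    t-seq (shifts (shifts-walk ρ≤n s fwd (stride s) is r ≤4) σ f a P e) reading
    where
    τ = dataTape s
    o = offset n (stride s) ρ is r
    σ′ = σ [ τ ↦ (f , a + o) ]
    back : ∀ b → Triple (seq (walk bwd τ (stride s) is r) (const! b)) σ′ b σ _
    back b = t-seq (post (λ x → trans (upd-twice σ τ _ _ x) (upd-id σ τ _ e x))
                     (shifts (shifts-walk ρ≤n s bwd (stride s) is r ≤4) σ′ f a (ready-stable s _ P)
                       (at-same σ τ _))) t-const
    reading : Triple _ σ′ (isOne (symAt f (a + o))) σ _
    reading with isOne (symAt f (a + o)) in eq
    ... | true  = t-then (t-test (trans (cong (isOne ∘ scanned) (at-same σ τ _)) eq)) (back true)
    ... | false = t-else (t-test (trans (cong (isOne ∘ scanned) (at-same σ τ _)) eq)) (back false)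

  -- A finished loop always answers true, so its outcome is recovered from the counter: it is still
  -- below n exactly if some instance of the quantified formula failed. `finish!` reads this off
  -- before erasing the counter.
  body! : TapeIx → Prog → Prog
  body! c p = branch (less c (sizeTape 0)) (branch p (increment c) (const! false)) (const! false)

  finish! : TapeIx → Prog
  finish! c = branch (less c (sizeTape 0)) (seq (clear c) (const! false)) (seq (clear c) (const! true))

  compile : ∀ {d} → Fm vars d → Prog
  compile (atom s is r) = readBit s is r
  compile (eq i j)      = equal (varTape i) (varTape j)
  compile (lt i j)      = less (varTape i) (varTape j)
  compile (neg φ)       = branch (compile φ) (const! false) (const! true)
  compile (bin c φ ψ)   =
    branch (compile φ) (branch (compile ψ) (const! (connect c true true)) (const! (connect c true false)))
                       (branch (compile ψ) (const! (connect c false true)) (const! (connect c false false)))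
  compile (all {ok = ok} φ) = seq (loop (body! c (compile φ))) (finish! c)
    where c = varTape (bound ok)

  cmpCost : Cost
  cmpCost = K 6 ⊗ X ⊕ K 14

  roundCost : Cost → Cost
  roundCost k = cmpCost ⊕ (k ⊕ (K 2 ⊗ X ⊕ K 6))

  finishCost : Cost
  finishCost = cmpCost ⊕ (K 2 ⊗ X ⊕ K 3 ⊕ K 1)

  cost : ∀ {d} → Fm vars d → Cost
  cost (atom s is r) = readCost s is r
  cost (eq i j)      = cmpCost
  cost (lt i j)      = cmpCost
  cost (neg φ)       = cost φ ⊕ K 1
  cost (bin c φ ψ)   = cost φ ⊕ (cost ψ ⊕ K 1)
  cost (all φ)       = X ⊗ roundCost (cost φ) ⊕ roundCost (cost φ) ⊕ finishCost

  set-same : ∀ (ρ : Fin vars → ℕ) c v → (ρ [ c ≔ v ]) c ≡ v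
  set-same ρ c v with c ≟ c
  ... | yes _  = refl
  ... | no c≢c = contradiction refl c≢c

  set-other : ∀ (ρ : Fin vars → ℕ) {c i} v → i ≢ c → (ρ [ c ≔ v ]) i ≡ ρ i
  set-other ρ {c} {i} v i≢c with i ≟ c
  ... | yes e = contradiction e i≢c
  ... | no _  = refl

  module _ {n : ℕ} (contents : Source → Desc) where

    bitAt : Source → ℕ → Bool
    bitAt s k = isOne (symAt (proj₁ (contents s)) (proj₂ (contents s) + k))

    -- Variables that are not yet bound have empty tapes. A quantifier counts up from 0 on its tape
    -- and erases it afterwards, so every evaluation restores the state exactly and evaluations
    -- compose.
    t-compile : ∀ {d} (φ : Fm vars d) {ρ σ} → (∀ i → ρ i ≤ n) → (∀ i → d ≤ toℕ i → ρ i ≡ 0) → Ready n ρ σ →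
                (∀ s → σ (dataTape s) ≡ contents s) →
                Triple (compile φ) σ (eval n bitAt φ ρ) σ (⟦ cost φ ⟧ n)
    t-compile (atom s is r {ok}) ρ≤n _ P D = t-readBit ρ≤n s is r (toWitness ok) P (D s)
    t-compile (eq i j {ok}) {ρ} ρ≤n _ P D =
      result (compared-equal (ρ i) (ρ j))
        (t-cmp _ _ _ _ (toWitnessFalse ok ∘ varTape-injective) (Ready.vals P i) (Ready.vals P j) (ρ≤n i)
          (ρ≤n j))
    t-compile (lt i j {ok}) {ρ} ρ≤n _ P D =
      result (compared-less (ρ i) (ρ j))
        (t-cmp _ _ _ _ (toWitnessFalse ok ∘ varTape-injective) (Ready.vals P i) (Ready.vals P j) (ρ≤n i)
          (ρ≤n j))
    t-compile (neg φ) {ρ} ρ≤n free P D with eval n bitAt φ ρ | t-compile φ ρ≤n free P D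
    ... | true  | h = t-then h t-const
    ... | false | h = t-else h t-const
    t-compile (bin c φ ψ) {ρ} ρ≤n free P D
      with eval n bitAt φ ρ | t-compile φ ρ≤n free P D | eval n bitAt ψ ρ | t-compile ψ ρ≤n free P D
    ... | true  | h | true  | g = t-then h (t-then g t-const)
    ... | true  | h | false | g = t-then h (t-else g t-const)
    ... | false | h | true  | g = t-else h (t-then g t-const)
    ... | false | h | false | g = t-else h (t-else g t-const)
    t-compile {d} (all {ok = ok} φ) {ρ} {σ} ρ≤n free P D = whole
      where
      i₀ = bound {d} ok
      c = varTape i₀
      toℕ-i₀ : toℕ i₀ ≡ d
      toℕ-i₀ = toℕ-fromℕ< (toWitness ok)
      f : ℕ → Bool
      f v = eval n bitAt φ (ρ [ i₀ ≔ v ])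
      at! : ℕ → State
      at! v = σ [ c ↦ (ones v , 1) ]
      k = ⟦ cost φ ⟧ n
      rc = ⟦ roundCost (cost φ) ⟧ n
      at-c : ∀ v → at! v c ≡ (ones v , 1)
      at-c v = at-same σ c _
      at-size : ∀ v i → i < 3 → at! v (sizeTape i) ≡ (ones n , 1)
      at-size v i i<3 = trans (at-other σ _ (λ e → varTape≢sizeTape i (sym e))) (Ready.sizes P i i<3)
      ready! : ∀ v → Ready n (ρ [ i₀ ≔ v ]) (at! v)
      ready! v = record { sizes = at-size v ; vals = vals! }
        where
        vals! : ∀ i → at! v (varTape i) ≡ (ones ((ρ [ i₀ ≔ v ]) i) , 1)
        vals! i = case i ≟ i₀ of λ
          { (yes refl) → trans (at-c v) (cong (λ w → ones w , 1) (sym (set-same ρ i₀ v)))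
          ; (no i≢)    → trans (at-other σ _ (i≢ ∘ varTape-injective))
                               (trans (Ready.vals P i) (cong (λ w → ones w , 1) (sym (set-other ρ v i≢)))) }
      bounded : ∀ v → v ≤ n → ∀ i → (ρ [ i₀ ≔ v ]) i ≤ n
      bounded v v≤n i with i ≟ i₀
      ... | yes _ = v≤n
      ... | no _  = ρ≤n i
      free! : ∀ v i → suc d ≤ toℕ i → (ρ [ i₀ ≔ v ]) i ≡ 0
      free! v i d<i with i ≟ i₀
      ... | yes refl = contradiction (sym toℕ-i₀) (<⇒≢ d<i)
      ... | no _     = free i (<⇒≤ d<i)
      inner : ∀ v → v ≤ n → Triple (compile φ) (at! v) (f v) (at! v) k
      inner v v≤n = t-compile φ (bounded v v≤n) (free! v) (ready! v)
                      (λ s → trans (at-other σ _ (λ e → varTape≢dataTape s i₀ (sym e))) (D s))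
      test! : ∀ v → v ≤ n → Triple (less c (sizeTape 0)) (at! v) (v <ᵇ n) (at! v) (6 * n + 14)
      test! v v≤n = result (compared-less v n)
        (t-cmp _ _ c (sizeTape 0) (varTape≢sizeTape 0) (at-c v) (at-size v 0 (s≤s z≤n)) v≤n ≤-refl)
      reset : ∀ v → v ≤ n → ∀ b → Triple (seq (clear c) (const! b)) (at! v) b σ (2 * n + 3 + 1)
      reset v v≤n b = t-seq (within (+-monoˡ-≤ 3 (*-monoʳ-≤ 2 v≤n))
        (post (λ x → trans (upd-twice σ c _ _ x) (upd-id σ c _
          (trans (Ready.vals P i₀) (cong (λ w → ones w , 1) (free i₀ (≤-reflexive (sym toℕ-i₀))))) x))
          (t-clear c (at-c v)))) t-const
      -- Where the loop stops depends on the first failing instance, so the intermediate state is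
      -- existential and the triple of the concluding test is carried along with it.
      iterate : ∀ m v → v + m ≡ n → ∃[ τ ] Triple (loop (body! c (compile φ))) (at! v) true τ (m * rc + rc) ×
                                           Triple (finish! c) τ (allFrom f m v) σ (⟦ finishCost ⟧ n)
      iterate zero v e =
        at! v ,
        t-stop (within (+-monoʳ-≤ (6 * n + 14) (≤-trans (m≤n+m 1 (2 * n + 5))
          (≤-trans (≤-reflexive (arith₁ n)) (m≤n+m _ k))))
          (t-else (result stop (test! v v≤n)) t-const)) ,
        t-else (result stop (test! v v≤n)) (reset v v≤n true)
        where
        v≡n : v ≡ n
        v≡n = trans (sym (+-identityʳ v)) e
        v≤n : v ≤ n
        v≤n = ≤-reflexive v≡n
        stop : (v <ᵇ n) ≡ false
        stop = notBelow (≤-reflexive (sym v≡n))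
        arith₁ : ∀ n → 2 * n + 5 + 1 ≡ 2 * n + 6
        arith₁ = solve-∀
      iterate (suc m) v e with f v | inner v (≤-trans (m≤m+n v (suc m)) (≤-reflexive e))
      ... | false | h =
        at! v ,
        within (m≤n+m rc (suc m * rc)) (t-stop (t-then (result go! (test! v v≤n))
          (t-else h (within (≤-trans (m≤n+m 1 5) (m≤n+m 6 (2 * n))) t-const)))) ,
        t-then (result go! (test! v v≤n)) (reset v v≤n false)
        where
        v<n : v < n
        v<n = subst (suc v ≤_) (trans (sym (+-suc v m)) e) (m≤m+n (suc v) m)
        v≤n : v ≤ n
        v≤n = <⇒≤ v<n
        go! : (v <ᵇ n) ≡ true
        go! = below v<n
      ... | true | h with iterate m (suc v) (trans (sym (+-suc v m)) e)
      ...   | τ , hl , hf =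
        τ ,
        within (≤-reflexive (sym (+-assoc rc (m * rc) rc)))
          (t-again (t-then (result go! (test! v v≤n))
            (t-then h (within (+-monoˡ-≤ 6 (*-monoʳ-≤ 2 v≤n))
              (post (upd-twice σ c _ _) (t-increment c (at-c v))))))
            hl) ,
        hf
        where
        v<n : v < n
        v<n = subst (suc v ≤_) (trans (sym (+-suc v m)) e) (m≤m+n (suc v) m)
        v≤n : v ≤ n
        v≤n = <⇒≤ v<n
        go! : (v <ᵇ n) ≡ true
        go! = below v<n
      whole : Triple (compile (all {ok = ok} φ)) σ (allFrom f n 0) σ (⟦ cost (all {ok = ok} φ) ⟧ n)
      whole with iterate n 0 refl
      ... | τ , hl , hf =
        pre (upd-id σ c _ (trans (Ready.vals P i₀) (cong (λ w → ones w , 1)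
          (free i₀ (≤-reflexive (sym toℕ-i₀))))))
            (t-seq hl hf)

-- The verifier of a sentence

⟦⟧-mono : ∀ e {m n} → m ≤ n → ⟦ e ⟧ m ≤ ⟦ e ⟧ n
⟦⟧-mono (K a)   m≤n = ≤-refl
⟦⟧-mono X       m≤n = m≤n
⟦⟧-mono (e ⊕ f) m≤n = +-mono-≤ (⟦⟧-mono e m≤n) (⟦⟧-mono f m≤n)
⟦⟧-mono (e ⊗ f) m≤n = *-mono-≤ (⟦⟧-mono e m≤n) (⟦⟧-mono f m≤n)

addPoly : List ℕ → List ℕ → List ℕ
addPoly []       q       = q
addPoly (a ∷ p)  []      = a ∷ p
addPoly (a ∷ p)  (b ∷ q) = a + b ∷ addPoly p q

mulPoly : List ℕ → List ℕ → List ℕ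
mulPoly []      q = []
mulPoly (a ∷ p) q = addPoly (map (a *_) q) (0 ∷ mulPoly p q)

polyOf : Cost → List ℕ
polyOf (K a)   = a ∷ []
polyOf X       = 0 ∷ 1 ∷ []
polyOf (e ⊕ f) = addPoly (polyOf e) (polyOf f)
polyOf (e ⊗ f) = mulPoly (polyOf e) (polyOf f)

poly-add : ∀ p q n → poly (addPoly p q) n ≡ poly p n + poly q n
poly-add []      q       n = refl
poly-add (a ∷ p) []      n = sym (+-identityʳ _)
poly-add (a ∷ p) (b ∷ q) n rewrite poly-add p q n = arith a b n (poly p n) (poly q n)
  where
  arith : ∀ a b n u v → a + b + n * (u + v) ≡ a + n * u + (b + n * v)
  arith = solve-∀

poly-scale : ∀ a q n → poly (map (a *_) q) n ≡ a * poly q n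
poly-scale a []      n = sym (*-zeroʳ a)
poly-scale a (b ∷ q) n rewrite poly-scale a q n = arith a b n (poly q n)
  where
  arith : ∀ a b n u → a * b + n * (a * u) ≡ a * (b + n * u)
  arith = solve-∀

poly-mul : ∀ p q n → poly (mulPoly p q) n ≡ poly p n * poly q n
poly-mul []      q n = refl
poly-mul (a ∷ p) q n
  rewrite poly-add (map (a *_) q) (0 ∷ mulPoly p q) n | poly-scale a q n | poly-mul p q n =
  arith a n (poly p n) (poly q n)
  where
  arith : ∀ a n u v → a * v + n * (u * v) ≡ (a + n * u) * v
  arith = solve-∀

poly-polyOf : ∀ e n → poly (polyOf e) n ≡ ⟦ e ⟧ n
poly-polyOf (K a)   n = trans (cong (a +_) (*-zeroʳ n)) (+-identityʳ a)
poly-polyOf X       n = arith n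
  where
  arith : ∀ n → n * (1 + n * 0) ≡ n
  arith = solve-∀
poly-polyOf (e ⊕ f) n = trans (poly-add (polyOf e) (polyOf f) n)
  (cong₂ _+_ (poly-polyOf e n) (poly-polyOf f n))
poly-polyOf (e ⊗ f) n = trans (poly-mul (polyOf e) (polyOf f) n)
  (cong₂ _*_ (poly-polyOf e n) (poly-polyOf f n))

isZero isBit : Sym → Bool
isZero (bit false) = true
isZero (bit true)  = false
isZero blank       = false
isZero (aux _)     = false
isBit (bit _)      = true
isBit blank        = false
isBit (aux _)      = false

leading : List Bool → ℕ
leading []          = 0
leading (true ∷ w)  = suc (leading w)
leading (false ∷ w) = 0

leading≤length : ∀ w → leading w ≤ length w
leading≤length []          = z≤n
leading≤length (true ∷ w)  = s≤s (leading≤length w)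
leading≤length (false ∷ w) = z≤n

-- The matrix occupies cells n + 2 to n + 1 + n². A bit in the last of these cells and a blank
-- behind it fix the length of the input; for n = 0 the bit tested is the separator. The form
-- `n * (n * 1)` is that of `volume n 1 2`.
formatted : List Bool → ℕ → Bool
formatted x n = isBlank (symAt (word x) (suc (suc n) + n * (n * 1))) ∧ isBit
  (symAt (word x) (suc n + n * (n * 1)))

sources : List Bool → List Bool → Source → Desc
sources x u input       = word x , suc (suc (leading x))
sources x u certificate = word u , 1

bitsOf : List Bool → List Bool → Source → ℕ → Bool
bitsOf x u s k = isOne (symAt (proj₁ (sources x u s)) (proj₂ (sources x u s) + k))

verdict : ∀ {vars} → Fm vars 0 → List Bool → List Bool → Bool
verdict φ x u =
  isZero (symAt (word x) (suc n)) ∧ (formatted x n ∧ eval n (bitsOf x u) φ (λ _ → 0))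
  where n = leading x

module Verifier (vars : ℕ) (φ : Fm vars 0) where
  open Compiler vars

  append : TapeIx → Prog
  append c = act! c λ _ → true , one , moveR

  countOne : Prog
  countOne = branch (test inputTape isOne)
    (seq (go moveR inputTape) (seq (append (sizeTape 0)) (seq (append (sizeTape 1)) (append (sizeTape 2)))))
    (const! false)

  rewindSizes : Prog
  rewindSizes = seq (rewind (sizeTape 0)) (seq (rewind (sizeTape 1)) (rewind (sizeTape 2)))

  checkFormat : Prog
  checkFormat = seq (sweep fwd inputTape 1 2)
    (branch (test inputTape isBlank)
      (seq (go moveL inputTape)
        (branch (test inputTape isBit)
                (seq (go moveR inputTape) (seq (sweep bwd inputTape 1 2) (const! true)))
                (const! false)))
      (const! false))

  verifier : Prog
  verifier = seq (loop countOne)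
    (branch (test inputTape isZero)
            (seq (go moveR inputTape) (seq rewindSizes (branch checkFormat (compile φ) (const! false))))
            (const! false))

  formatCost : Cost
  formatCost = sweepCost 1 2 ⊕ (K 1 ⊕ (K 1 ⊕ (K 1 ⊕ (K 1 ⊕ (sweepCost 1 2 ⊕ K 1)))))

  totalCost : Cost
  totalCost = X ⊗ K 5 ⊕ K 2 ⊕
    (K 1 ⊕ (K 1 ⊕ (X ⊕ K 2 ⊕ (X ⊕ K 2 ⊕ (X ⊕ K 2)) ⊕ (formatCost ⊕ (cost φ ⊕ K 1)))))

  module _ (x u : List Bool) where

    stage : (d d₀ d₁ d₂ : Desc) → State
    stage d d₀ d₁ d₂ zero                                = d
    stage d d₀ d₁ d₂ (suc zero)                          = word u , 1
    stage d d₀ d₁ d₂ (suc (suc zero))                    = d₀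
    stage d d₀ d₁ d₂ (suc (suc (suc zero)))              = d₁
    stage d d₀ d₁ d₂ (suc (suc (suc (suc zero))))        = d₂
    stage d d₀ d₁ d₂ (suc (suc (suc (suc (suc i)))))     = ones 0 , 1

    module _ {d d₀ d₁ d₂ : Desc} (e : Desc) where
      stage-input : (stage d d₀ d₁ d₂ [ inputTape ↦ e ]) ≗ stage e d₀ d₁ d₂
      stage-input zero = refl
      stage-input (suc zero) = refl
      stage-input (suc (suc zero)) = refl
      stage-input (suc (suc (suc zero))) = refl
      stage-input (suc (suc (suc (suc zero)))) = refl
      stage-input (suc (suc (suc (suc (suc i))))) = refl

      stage-size₀ : (stage d d₀ d₁ d₂ [ sizeTape 0 ↦ e ]) ≗ stage d e d₁ d₂
      stage-size₀ zero = refl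
      stage-size₀ (suc zero) = refl
      stage-size₀ (suc (suc zero)) = refl
      stage-size₀ (suc (suc (suc zero))) = refl
      stage-size₀ (suc (suc (suc (suc zero)))) = refl
      stage-size₀ (suc (suc (suc (suc (suc i))))) = refl

      stage-size₁ : (stage d d₀ d₁ d₂ [ sizeTape 1 ↦ e ]) ≗ stage d d₀ e d₂
      stage-size₁ zero = refl
      stage-size₁ (suc zero) = refl
      stage-size₁ (suc (suc zero)) = refl
      stage-size₁ (suc (suc (suc zero))) = refl
      stage-size₁ (suc (suc (suc (suc zero)))) = refl
      stage-size₁ (suc (suc (suc (suc (suc i))))) = refl

      stage-size₂ : (stage d d₀ d₁ d₂ [ sizeTape 2 ↦ e ]) ≗ stage d d₀ d₁ e
      stage-size₂ zero = refl
      stage-size₂ (suc zero) = refl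
      stage-size₂ (suc (suc zero)) = refl
      stage-size₂ (suc (suc (suc zero))) = refl
      stage-size₂ (suc (suc (suc (suc zero)))) = refl
      stage-size₂ (suc (suc (suc (suc (suc i))))) = refl

    counting : ℕ → State
    counting j = stage (word x , suc j) (ones j , suc j) (ones j , suc j) (ones j , suc j)

    cell-drop : ∀ j r → cell (map bit (replicate j true ++ r)) j ≡ cell (map bit r) 0
    cell-drop zero    r = refl
    cell-drop (suc j) r = cell-drop j r

    t-count : ∀ r j → x ≡ replicate j true ++ r →
              Triple (loop countOne) (counting j) true (counting (j + leading r)) (leading r * 5 + 2)
    t-count [] j e rewrite +-identityʳ j =
      t-stop (t-else (t-test (trans (cong (λ w → isOne (cell (map bit w) j)) e)
        (cong isOne (cell-drop j [])))) t-const)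
    t-count (false ∷ r) j e rewrite +-identityʳ j =
      t-stop (t-else (t-test (trans (cong (λ w → isOne (cell (map bit w) j)) e)
        (cong isOne (cell-drop j (false ∷ r))))) t-const)
    t-count (true ∷ r) j e rewrite +-suc j (leading r) =
      t-again (t-then (t-test (trans (cong (λ w → isOne (cell (map bit w) j)) e)
        (cong isOne (cell-drop j (true ∷ r)))))
                (t-seq (post (stage-input _) (t-right refl))
                  (t-seq (post (stage-size₀ _) (t-act refl (grow-right j)))
                    (t-seq (post (stage-size₁ _) (t-act refl (grow-right j)))
                      (post (stage-size₂ _) (t-act refl (grow-right j)))))))
              (t-count r (suc j) (trans e (shift-one j r)))
      where
      shift-one : ∀ j r → replicate j true ++ true ∷ r ≡ replicate (suc j) true ++ r
      shift-one zero    r = refl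
      shift-one (suc j) r = cong (true ∷_) (shift-one j r)

    n : ℕ
    n = leading x

    parked : ℕ → State
    parked p = stage (word x , p) (ones n , 1) (ones n , 1) (ones n , 1)

    sizes-parked : ∀ p → SizesParked n 3 (parked p)
    sizes-parked p zero _ = refl
    sizes-parked p (suc zero) _ = refl
    sizes-parked p (suc (suc zero)) _ = refl
    sizes-parked p (suc (suc (suc i))) (s≤s (s≤s (s≤s ())))

    t-rewindSizes : Triple rewindSizes (stage (word x , suc (suc n)) (ones n , suc n) (ones n , suc n)
      (ones n , suc n)) true
                           (parked (suc (suc n))) (n + 2 + (n + 2 + (n + 2)))
    t-rewindSizes =
      t-seq (post (stage-size₀ _) (t-rewind (sizeTape 0) refl ≤-refl))
        (t-seq (post (stage-size₁ _) (t-rewind (sizeTape 1) refl ≤-refl))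
               (post (stage-size₂ _) (t-rewind (sizeTape 2) refl ≤-refl)))

    square : ℕ
    square = n * (n * 1)

    two-sizes : ∀ p → SizesParked n 2 (parked p)
    two-sizes p i i<2 = sizes-parked p i (≤-trans i<2 (n≤1+n 2))

    t-sweep : ∀ d → Triple (sweep d inputTape 1 2) (parked (source d (suc (suc n)) square)) true
                           (parked (target d (suc (suc n)) square)) (⟦ sweepCost 1 2 ⟧ n)
    t-sweep d = post (stage-input _) (shifts (shifts-sweep (sizeTape≢dataTape input) d 1 2 (n≤1+n 2))
                  (parked (source d (suc (suc n)) square)) (word x) (suc (suc n)) (two-sizes _) refl)

    origin : ℕ
    origin = suc (suc n)

    -- A failed test ends the computation and may leave the head astray; only success has to bring
    -- it back to the start of the matrix, where the evaluation expects it.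
    t-format : ∀ b₁ b₂ → isBlank (symAt (word x) (origin + square)) ≡ b₁ →
               isBit (symAt (word x) (suc n + square)) ≡ b₂ →
               ∃[ τ ] Triple checkFormat (parked origin) (b₁ ∧ b₂) τ (⟦ formatCost ⟧ n) ×
                      (b₁ ∧ b₂ ≡ true → τ ≗ parked origin)
    t-format false b₂ e₁ e₂ =
      parked (origin + square) , t-seq (t-sweep fwd) (t-else (t-test e₁) (within (s≤s z≤n) t-const)) , λ ()
    t-format true false e₁ e₂ =
      parked (suc n + square) ,
      t-seq (t-sweep fwd) (t-then (t-test e₁) (t-seq (post (stage-input _) (t-left refl))
            (t-else (t-test e₂) (within (s≤s z≤n) t-const)))) , λ ()
    t-format true true e₁ e₂ =
      parked origin ,
      t-seq (t-sweep fwd) (t-then (t-test e₁) (t-seq (post (stage-input _) (t-left refl))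
            (t-then (t-test e₂) (t-seq (post (stage-input _) (t-right refl))
              (t-seq (t-sweep bwd) t-const))))) ,
      λ _ _ → refl

    ready : Ready n (λ _ → 0) (parked (suc (suc n)))
    ready = record { sizes = sizes-parked _ ; vals = λ _ → refl }

    checkCost : ℕ
    checkCost = ⟦ formatCost ⟧ n + (⟦ cost φ ⟧ n + 1)

    t-check : ∀ b {τ} → Triple checkFormat (parked origin) b τ (⟦ formatCost ⟧ n) →
      (b ≡ true → τ ≗ parked origin) →
              ∃[ τ′ ] Triple (branch checkFormat (compile φ) (const! false)) (parked origin)
                             (b ∧ eval n (bitsOf x u) φ (λ _ → 0)) τ′ checkCost
    t-check false {τ} h _ = τ , t-else h (within (m≤n+m 1 _) t-const)
    t-check true  {τ} h e =
      parked origin , t-then (post (e refl) h) (within (m≤m+n _ 1)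
        (t-compile {n} (sources x u) φ (λ _ → z≤n) (λ _ _ → refl) ready
          λ { input → refl ; certificate → refl }))

    afterCount : Prog
    afterCount = branch (test inputTape isZero)
      (seq (go moveR inputTape) (seq rewindSizes (branch checkFormat (compile φ) (const! false))))
      (const! false)

    t-afterCount : ∀ b v → isZero (symAt (word x) (suc n)) ≡ b →
                   ∃[ τ ] Triple (branch checkFormat (compile φ) (const! false)) (parked origin) v τ
                     checkCost →
                   ∃[ τ ] Triple afterCount (counting n) (b ∧ v) τ
                     (1 + (1 + (n + 2 + (n + 2 + (n + 2)) + checkCost)))
    t-afterCount false v e _       = counting n , t-else (t-test e) (within (s≤s z≤n) t-const)
    t-afterCount true  v e (τ , h) =
      τ , t-then (t-test e) (t-seq (post (stage-input _) (t-right refl)) (t-seq t-rewindSizes h))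

    formatChecked : ∃[ τ ] Triple (branch checkFormat (compile φ) (const! false)) (parked origin)
                                  (formatted x n ∧ eval n (bitsOf x u) φ (λ _ → 0)) τ checkCost
    formatChecked = t-check (formatted x n) (proj₁ (proj₂ format)) (proj₂ (proj₂ format))
      where
      format = t-format (isBlank (symAt (word x) (origin + square)))
        (isBit (symAt (word x) (suc n + square))) refl refl

    allChecked : ∃[ τ ] Triple afterCount (counting n) (verdict φ x u) τ
      (1 + (1 + (n + 2 + (n + 2 + (n + 2)) + checkCost)))
    allChecked = t-afterCount (isZero (symAt (word x) (suc n)))
      (formatted x n ∧ eval n (bitsOf x u) φ (λ _ → 0)) refl formatChecked

    t-verifier : ∃[ τ ] Triple verifier (counting 0) (verdict φ x u) τ (⟦ totalCost ⟧ n)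
    t-verifier = proj₁ allChecked , t-seq (t-count x 0 refl) (proj₂ allChecked)

    initially : (load x Vec.∷ load u Vec.∷ Vec.replicate (3 + vars) (load [])) ⊨ counting 0
    initially zero = load-shows x
    initially (suc zero) = load-shows u
    initially (suc (suc zero)) = load-ones
    initially (suc (suc (suc zero))) = load-ones
    initially (suc (suc (suc (suc zero)))) = load-ones
    initially (suc (suc (suc (suc (suc i))))) rewrite lookup-replicate i (load {Fin 0} []) = load-ones

    timeBound : ∀ {l} → l ≤ ⟦ totalCost ⟧ n → l ≤ poly (polyOf totalCost) (length x)
    timeBound l≤ = ≤-trans l≤ (≤-trans (⟦⟧-mono totalCost (leading≤length x))
                                        (≤-reflexive (sym (poly-polyOf totalCost (length x)))))

    decides : HaltsWithin (machineOf verifier) (poly (polyOf totalCost) (length x)) x u (verdict φ x u)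
    decides = halted (proj₂ t-verifier _ initially)
      where
      halted : ∀ {τ} → (∃[ l ] ∃[ ts ] l ≤ ⟦ totalCost ⟧ n × Reach verifier (start verifier)
                 (load x Vec.∷ load u Vec.∷ Vec.replicate (3 + vars) (load [])) l (verdict φ x u) ts ×
                   ts ⊨ τ) →
               HaltsWithin (machineOf verifier) (poly (polyOf totalCost) (length x)) x u (verdict φ x u)
      halted (l , _ , l≤ , r , _) =
        reach-haltsWithin {p = verifier} {k = l} {t = poly (polyOf totalCost) (length x)}
          {b = verdict φ x u} x u r (timeBound l≤)

  halt-injective : ∀ {Q : Set} {a b} → halt {Q} a ≡ halt b → a ≡ b
  halt-injective refl = refl

  -- The running time is governed by the leading ones of x alone: certificate bits are located by
  -- counting up to n, and cells beyond the end of u read as not one. Hence every u gets a verdict,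
  -- whatever its length.
  definable⇒NP : ∀ {ℓ} {L : Language ℓ} (size : Cost) →
                 (∀ x → L x → ∃[ u ] length u ≤ poly (polyOf size) (length x) × verdict φ x u ≡ true) →
                 (∀ x u → verdict φ x u ≡ true → L x) → NP L
  definable⇒NP size complete sound = record
    { machine = machineOf verifier
    ; size    = polyOf size
    ; time    = polyOf totalCost
    ; halts   = λ x u _ → verdict φ x u , decides x u
    ; correct = λ x → mk⇔
        (λ p → let u , l , e = complete x p in u , l , trans (decides x u) (cong halt e))
        (λ (u , _ , h) → sound x u (halt-injective (trans (sym (decides x u)) h)))
    }

-- Obstructions

-- `Q` is not assumed decidable, so an extremal index exists only up to double negation. This is
-- enough for `helly`, whose conclusion is absurdity.
¬¬-least : ∀ {ℓ m} (Q : Fin m → Set ℓ) {i} → Q i → ¬ ¬ (∃[ l ] Q l × (∀ j → Q j → l ≤ᶠ j))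
¬¬-least Q {i} q none = <-rec (λ k → ∀ i → toℕ i ≡ k → ¬ Q i)
  (λ k rec i e q → none (i , q , λ j q′ → case toℕ i ≤? toℕ j of λ
    { (yes i≤j) → i≤j
    ; (no i≰j)  → contradiction q′ (rec (subst (toℕ j <_) e (≰⇒> i≰j)) j refl) })) _ i refl q

¬¬-greatest : ∀ {ℓ m} (Q : Fin m → Set ℓ) {i} → Q i → ¬ ¬ (∃[ l ] Q l × (∀ j → Q j → j ≤ᶠ l))
¬¬-greatest {m = m} Q {i} q none = <-rec (λ k → ∀ i → m ∸ toℕ i ≡ k → ¬ Q i)
  (λ k rec i e q → none (i , q , λ j q′ → case toℕ j ≤? toℕ i of λ
    { (yes j≤i) → j≤i
    ; (no j≰i)  → contradiction q′ (rec (subst (m ∸ toℕ j <_) e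
                    (∸-monoʳ-< (≰⇒> j≰i) (<⇒≤ (toℕ<n j)))) j refl) })) _ i refl q

module Obstructions {n m : ℕ} (_∋_ : Fin n → Fin m → Set) (_∋?_ : ∀ v i → Dec (v ∋ i))
  (convex : ∀ {v i j k} → i ≤ᶠ j → j ≤ᶠ k → v ∋ i → v ∋ k → v ∋ j) where

  Touches : List (Fin m) → Fin n → Set
  Touches T v = ∃[ s ] s ∈ˡ T × v ∋ s

  touches? : ∀ T → Decidable (Touches T)
  touches? T v = map′ find (λ (_ , s∈T , v∋s) → lose s∈T v∋s) (Any.any? (v ∋?_) T)

  Crosses : List (Fin m) → List (Fin m) → Fin n → Set
  Crosses T₁ T₂ v = Touches T₁ v × Touches T₂ v

  AtMostOne : (Fin n → Set) → Set
  AtMostOne A = ∀ {v v′} → A v → A v′ → v ≡ v′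

  -- Staller's winning configurations on the points T, played with the vertices W: she takes the
  -- crossing vertex, after which Dominator can answer in only one of the two halves.
  data Ob (W : Fin n → Set) : List (Fin m) → Fin m → Fin m → Set₁ where
    leaf : ∀ s → AtMostOne (λ v → W v × v ∋ s) → Ob W [ s ] s s
    node : ∀ {T₁ T₂ p q a b} →
           Ob (λ v → W v × ¬ Crosses T₁ T₂ v) T₁ p a → Ob (λ v → W v × ¬ Crosses T₁ T₂ v) T₂ b q →
           a <ᶠ b → AtMostOne (λ v → W v × Crosses T₁ T₂ v) → Ob W (T₁ ++ T₂) p q

  touches-++ˡ : ∀ {T₁ T₂ v} → Touches T₁ v → Touches (T₁ ++ T₂) v
  touches-++ˡ (s , s∈ , v∋s) = s , ∈-++⁺ˡ s∈ , v∋s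

  touches-++ʳ : ∀ T₁ {T₂ v} → Touches T₂ v → Touches (T₁ ++ T₂) v
  touches-++ʳ T₁ (s , s∈ , v∋s) = s , ∈-++⁺ʳ T₁ s∈ , v∋s

  -- Taking vertices away only helps Staller, and vertices that miss all of T never enter the two
  -- rules.
  mono : ∀ {W W′ T p q} → (∀ {v} → W′ v → Touches T v → W v) → Ob W T p q → Ob W′ T p q
  mono f (leaf s u) = leaf s λ (w , ∋s) (w′ , ∋s′) →
    u (f w (s , here refl , ∋s) , ∋s) (f w′ (s , here refl , ∋s′) , ∋s′)
  mono {W′ = W′} f (node {T₁} {T₂} o₁ o₂ a<b u) =
    node (mono (λ (w , c) t → f w (touches-++ˡ t) , c) o₁)
         (mono (λ (w , c) t → f w (touches-++ʳ T₁ t) , c) o₂) a<b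
         λ (w , c) (w′ , c′) → u (f w (touches-++ˡ (proj₁ c)) , c) (f w′ (touches-++ˡ (proj₁ c′)) , c′)

  first∈ : ∀ {W T p q} → Ob W T p q → p ∈ˡ T
  first∈ (leaf s _)      = here refl
  first∈ (node o _ _ _)  = ∈-++⁺ˡ (first∈ o)

  last∈ : ∀ {W T p q} → Ob W T p q → q ∈ˡ T
  last∈ (leaf s _)             = here refl
  last∈ (node {T₁} _ o _ _)    = ∈-++⁺ʳ T₁ (last∈ o)

  range : ∀ {W T p q} → Ob W T p q → ∀ {s} → s ∈ˡ T → p ≤ᶠ s × s ≤ᶠ q
  range (leaf s _) (here refl) = ≤-refl , ≤-refl
  range (node {T₁} o₁ o₂ a<b _) s∈ with ∈-++⁻ T₁ s∈
  ... | inj₁ s∈₁ = let p≤s , s≤a = range o₁ s∈₁ in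
    p≤s , ≤-trans s≤a (≤-trans (<⇒≤ a<b) (proj₁ (range o₂ (last∈ o₂))))
  ... | inj₂ s∈₂ = let b≤s , s≤q = range o₂ s∈₂ in
    ≤-trans (proj₂ (range o₁ (first∈ o₁))) (≤-trans (<⇒≤ a<b) b≤s) , s≤q

  -- A gap of an obstruction that no vertex crosses splits off an obstruction on its left.
  cut : ∀ {W T p q l} → Ob W T p q → (∀ {s} → s ∈ˡ T → s ≢ l) →
        (∀ {v s s′} → W v → s ∈ˡ T → s′ ∈ˡ T → s <ᶠ l → l <ᶠ s′ → v ∋ s → v ∋ s′ → ⊥) → p <ᶠ l →
        ∃[ T′ ] ∃[ q′ ] Ob W T′ p q′ × q′ <ᶠ l × (∀ {s} → s ∈ˡ T′ → s ∈ˡ T) ×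
          (∀ {s} → s ∈ˡ T → s <ᶠ l → s ∈ˡ T′)
  cut (leaf s u) _ _ s<l = [ s ] , s , leaf s u , s<l , (λ x → x) , λ x _ → x
  cut {W} {l = l} (node {T₁} {T₂} {b = b} o₁ o₂ a<b u) l∉ no-cross p<l with toℕ b <? toℕ l
  -- The gap lies in the right half, so all of `T₁` is to the left of it. Vertices crossing from
  -- `T₁` to `T₂` already cross to the remainder `T′`, since otherwise they would span the gap.
  ... | yes b<l =
    let T′ , q′ , o′ , q′<l , sub , sup = cut o₂ (l∉ ∘ ∈-++⁺ʳ T₁)
          (λ (w , _) s∈ s′∈ → no-cross w (∈-++⁺ʳ T₁ s∈) (∈-++⁺ʳ T₁ s′∈)) b<l
        widen : ∀ {v} → Touches T′ v → Touches T₂ v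
        widen = λ (s , s∈ , ∋s) → s , sub s∈ , ∋s
        narrow : ∀ {v} → W v → Crosses T₁ T₂ v → Crosses T₁ T′ v
        narrow = λ { w (t₁@(s , s∈ , ∋s) , (s′ , s′∈ , ∋s′)) → t₁ , s′ , (case toℕ s′ <? toℕ l of λ
          { (yes s′<l) → sup s′∈ s′<l
          ; (no s′≮l)  → ⊥-elim (no-cross w (∈-++⁺ˡ s∈) (∈-++⁺ʳ T₁ s′∈)
              (≤-<-trans (proj₂ (range o₁ s∈)) (<-trans a<b b<l))
              (≤∧≢⇒< (≮⇒≥ s′≮l) (λ e → l∉ (∈-++⁺ʳ T₁ s′∈) (sym (toℕ-injective e)))) ∋s ∋s′) }) , ∋s′ }
    in T₁ ++ T′ , q′ ,
       node (mono (λ (w , c) _ → w , λ c′ → c (narrow w c′)) o₁)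
            (mono (λ (w , c) _ → w , λ c′ → c (narrow w c′)) o′) a<b
            (λ (w , c) (w′ , c′) → u (w , proj₁ c , widen (proj₂ c)) (w′ , proj₁ c′ , widen (proj₂ c′))) ,
       q′<l ,
       (λ s∈ → either ∈-++⁺ˡ (∈-++⁺ʳ T₁ ∘ sub) (∈-++⁻ T₁ s∈)) ,
       λ s∈ s<l → either ∈-++⁺ˡ (λ s∈₂ → ∈-++⁺ʳ T₁ (sup s∈₂ s<l)) (∈-++⁻ T₁ s∈)
  -- Now all of `T₂` is beyond the gap. A vertex touching both what remains of `T₁` and `T₂` would
  -- span the gap, so none of the vertices removed at this node matters for `T′`.
  ... | no b≮l =
    let T′ , q′ , o′ , q′<l , sub , sup = cut o₁ (l∉ ∘ ∈-++⁺ˡ)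
          (λ (w , _) s∈ s′∈ → no-cross w (∈-++⁺ˡ s∈) (∈-++⁺ˡ s′∈)) p<l
        right : ∀ {s} → s ∈ˡ T₂ → l <ᶠ s
        right = λ s∈ → ≤∧≢⇒< (≤-trans (≮⇒≥ b≮l) (proj₁ (range o₂ s∈)))
                              (λ e → l∉ (∈-++⁺ʳ T₁ s∈) (sym (toℕ-injective e)))
    in T′ , q′ ,
       mono (λ { w (s , s∈ , ∋s) → w , λ { (_ , s′ , s′∈ , ∋s′) →
         no-cross w (∈-++⁺ˡ (sub s∈)) (∈-++⁺ʳ T₁ s′∈)
           (≤-<-trans (proj₂ (range o′ s∈)) q′<l) (right s′∈) ∋s ∋s′ } }) o′ ,
       q′<l , ∈-++⁺ˡ ∘ sub ,
       λ s∈ s<l → either (λ s∈₁ → sup s∈₁ s<l) (λ s∈₂ → ⊥-elim (<-irrefl refl (<-trans s<l (right s∈₂))))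
         (∈-++⁻ T₁ s∈)

  ObIn : (W : Fin n → Set) (P : Fin m → Set) → Fin m → Fin m → Set₁
  ObIn W P p q = ∃[ T ] Ob W T p q × (∀ {s} → s ∈ˡ T → P s)

  Without : (Fin n → Set) → Fin n → Fin n → Set
  Without W x v = W v × v ≢ x

  -- Contrapositively, some y ≠ x touches every obstruction created by taking x. With l the least last
  -- point and r the greatest first point of these obstructions, take y through l and max l r that
  -- starts leftmost: an obstruction missing y straddles l with an uncrossed gap, and what is left of
  -- the gap ends before l.
  helly : ∀ {W P x i₀} → Decidable W → P i₀ → (∀ {p q} → ¬ ObIn W P p q) →
          (∀ y → W y → y ≢ x → ¬ ¬ (∃[ p ] ∃[ q ] ObIn (Without W x) (λ i → P i × ¬ y ∋ i) p q)) → ⊥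
  helly {W} {P} {x} {i₀} W? Pi₀ none missed =
    -- Some vertex other than x contains `i₀`, as otherwise `i₀` alone was an obstruction. The
    -- obstruction missed by this vertex shows that there is one to take `l` and `r` from.
    let y , w , y≢x , _ = choice (_∋ i₀) (_∋? i₀) λ nope →
          none ([ i₀ ] , leaf i₀ (unique nope) , λ { (here refl) → Pi₀ })
    in missed y w y≢x λ { (p , q , T , o , A) →
       ¬¬-least (λ q → ∃[ p ] Obₓ p q) (p , T , o , proj₁ ∘ A) λ { (l , (pL , oL) , l-least) →
       ¬¬-greatest (λ p → ∃[ q ] Obₓ p q) (l , oL) λ { (r , (qR , oR) , r-greatest) →
       main l r oL oR (λ o → l-least _ (_ , o)) (λ o → r-greatest _ (_ , o)) } } }
    where
    Obₓ : Fin m → Fin m → Set₁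
    Obₓ = ObIn (Without W x) P

    choice : ∀ (A : Fin n → Set) → Decidable A → (¬ (∃[ y ] W y × y ≢ x × A y) → ⊥) → ∃[ y ] W y × y ≢ x × A y
    choice A A? = decidable-stable (any? λ y → W? y ×-dec ¬? (y ≟ x) ×-dec A? y)

    unique : ∀ {A : Fin n → Set} → ¬ (∃[ y ] W y × y ≢ x × A y) → AtMostOne (λ v → W v × A v)
    unique none {v} {v′} (w , a) (w′ , a′) = trans (is-x w a) (sym (is-x w′ a′))
      where is-x = λ {v} w a → decidable-stable (v ≟ x) λ v≢x → none (v , w , v≢x , a)

    -- An obstruction that x does not touch would have existed before the move.
    touched : ∀ {T p q} → Ob (Without W x) T p q → (∀ {s} → s ∈ˡ T → P s) → Touches T x
    touched {T} o A = decidable-stable (touches? T x) λ untouched →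
      none (T , mono (λ { w t → w , λ { refl → untouched t } }) o , A)

    main : ∀ l r {pL qR} → Obₓ pL l → Obₓ r qR → (∀ {p q} → Obₓ p q → l ≤ᶠ q) →
      (∀ {p q} → Obₓ p q → p ≤ᶠ r) → ⊥
    main l r (TL , obL , AL) (TR , obR , AR) l-least r-greatest =
      case ≤-total (toℕ r) (toℕ l) of λ
        { (inj₁ r≤l) → transversal l r≤l ≤-refl (choice (λ v → v ∋ l × v ∋ l)
          (λ v → (v ∋? l) ×-dec (v ∋? l)) λ nope →
            none ([ l ] , leaf l (λ (w , ∋l) (w′ , ∋l′) → unique nope (w , ∋l , ∋l) (w′ , ∋l′ , ∋l′)) ,
                  λ { (here refl) → AL (last∈ obL) }))
        ; (inj₂ l≤r) → transversal r ≤-refl l≤r (choice (λ v → v ∋ l × v ∋ r)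
          (λ v → (v ∋? l) ×-dec (v ∋? r)) λ nope →
            separated l≤r λ (v , w , v≢x , ∋l , ∋r) → nope (v , w , v≢x , ∋l , ∋r)) }
      where
      -- An obstruction ending at `l` and one starting at `r` join to a node. If only x can contain
      -- both points, x is its only possible crossing vertex, so the node was an obstruction before
      -- the move. For l = r a leaf takes its place.
      separated : l ≤ᶠ r → ¬ (∃[ y ] W y × y ≢ x × (y ∋ l × y ∋ r)) → ⊥
      separated l≤r nope with toℕ l <? toℕ r
      ... | yes l<r =
        none (TL ++ TR ,
              node (mono (λ { (w , c) t → w , λ { refl → c (touched obL AL , touched obR AR) } }) obL)
                   (mono (λ { (w , c) t → w , λ { refl → c (touched obL AL , touched obR AR) } }) obR) l<r
                   (λ (w , c) (w′ , c′) → unique nope (w , spans c) (w′ , spans c′)) ,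
              λ s∈ → either AL AR (∈-++⁻ TL s∈))
        where
        spans : ∀ {v} → Crosses TL TR v → v ∋ l × v ∋ r
        spans ((s , s∈ , ∋s) , (s′ , s′∈ , ∋s′)) =
          let s≤l = proj₂ (range obL s∈) ; r≤s′ = proj₁ (range obR s′∈) in
          convex s≤l (≤-trans l≤r r≤s′) ∋s ∋s′ , convex (≤-trans s≤l l≤r) r≤s′ ∋s ∋s′
      ... | no l≮r with toℕ-injective (≤-antisym l≤r (≮⇒≥ l≮r))
      ...   | refl = none ([ l ] , leaf l (λ (w , ∋l) (w′ , ∋l′) →
        unique nope (w , ∋l , ∋l) (w′ , ∋l′ , ∋l′)) ,
                           λ { (here refl) → AL (last∈ obL) })

      transversal : ∀ h → r ≤ᶠ h → l ≤ᶠ h → ∃[ y ] W y × y ≢ x × (y ∋ l × y ∋ h) → ⊥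
      transversal h r≤h l≤h (y₀ , w₀ , y₀≢x , ∋l₀ , ∋h₀) =
        ¬¬-least (λ i → ∃[ y ] (W y × y ≢ x × (y ∋ l × y ∋ h)) × y ∋ i) (y₀ , (w₀ , y₀≢x , ∋l₀ , ∋h₀) , ∋l₀)
        λ { (i , (y , (w , y≢x , ∋l , ∋h) , ∋i) , i-least) → missed y w y≢x λ { (p , q , T , ob , A) →
        let avoids : ∀ {s} → s ∈ˡ T → ¬ y ∋ s
            avoids = λ s∈ → proj₂ (A s∈)
            alive : Obₓ p q
            alive = T , ob , λ s∈ → proj₁ (A s∈)
            right : ∀ {s} → s ∈ˡ T → l ≤ᶠ s → h <ᶠ s
            right = λ s∈ l≤s → ≰⇒> λ s≤h → avoids s∈ (convex l≤s s≤h ∋l ∋h)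
            p<l : p <ᶠ l
            p<l = ≰⇒> λ l≤p → avoids (first∈ ob) (convex l≤p (≤-trans (r-greatest alive) r≤h) ∋l ∋h)
            T′ , q′ , ob′ , q′<l , sub , _ = cut {l = l} ob (λ { s∈ refl → avoids s∈ ∋l })
              (λ { {v} (w′ , v≢x) s∈ s′∈ s<l l<s′ ∋s ∋s′ →
                let h<s′ = right s′∈ (<⇒≤ l<s′)
                    v∋l  = convex (<⇒≤ s<l) (<⇒≤ l<s′) ∋s ∋s′
                    v∋h  = convex (≤-trans (<⇒≤ s<l) l≤h) (<⇒≤ h<s′) ∋s ∋s′
                -- A vertex spanning the gap at l continues beyond h and is itself a candidate for
                -- y. As y starts leftmost, y contains the point s of the obstruction, which it was
                -- to miss.
                in avoids s∈ (convex (i-least _ (v , (w′ , v≢x , v∋l , v∋h) , ∋s)) (<⇒≤ s<l) ∋i ∋l) }) p<l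
        in <-irrefl refl (<-≤-trans q′<l (l-least (T′ , ob′ , λ s∈ → proj₁ (A (sub s∈))))) } }

-- The game

module _ {n : ℕ} (G : Graph n) where

  infix 4 _≈_
  _≈_ : Fin n → Fin n → Set
  u ≈ v = u ≡ v ⊎ Adjacent G u v

  dominating? : ∀ D → Dec (Dominating G D)
  dominating? D = all? λ v → any? λ u → (u ∈? D) ×-dec ((u ≟ v) ⊎-dec T? (Graph.adj G u v))

  ∪-grows : ∀ {D : Subset n} {v} → v ∉ D → (D ∪ ⁅ v ⁆) ⊃ D
  ∪-grows {D} {v} v∉D = p⊆p∪q ⁅ v ⁆ , v , q⊆p∪q D ⁅ v ⁆ (x∈⁅x⁆ v) , v∉D

  ∈∪⁻ : ∀ (D : Subset n) {v x} → x ∈ D ∪ ⁅ v ⁆ → x ∈ D ⊎ x ≡ v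
  ∈∪⁻ D {v} x∈ = either inj₁ (inj₂ ∘ x∈⁅y⁆⇒x≡y v) (x∈p∪q⁻ D ⁅ v ⁆ x∈)

  ∈∪ˡ : ∀ {D : Subset n} {v x} → x ∈ D → x ∈ D ∪ ⁅ v ⁆
  ∈∪ˡ {v = v} = p⊆p∪q ⁅ v ⁆

  ∈∪ʳ : ∀ (D : Subset n) v → v ∈ D ∪ ⁅ v ⁆
  ∈∪ʳ D v = q⊆p∪q D ⁅ v ⁆ (x∈⁅x⁆ v)

  free? : ∀ D S (v : Fin n) → Dec (v ∉ D × v ∉ S)
  free? D S v = ¬? (v ∈? D) ×-dec ¬? (v ∈? S)

  claim? : ∀ D S → (∀ v → v ∉ D → v ∉ S → Dec (DominatorWins G staller (D ∪ ⁅ v ⁆) S)) →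
           Dec (DominatorWins G dominator D S)
  claim? D S rec with dominating? D
  ... | yes d = yes (dominated d)
  ... | no ¬d with any? (λ v → good v)
    where
    good : ∀ v → Dec (∃[ fD ] ∃[ fS ] DominatorWins G staller (D ∪ ⁅ v ⁆) S × v ∉ D ×
      (v ∉ S × fD ≡ v × fS ≡ v))
    good v with free? D S v
    ... | no ¬f         = no λ (_ , _ , _ , fD , fS , _) → ¬f (fD , fS)
    ... | yes (fD , fS) = map′ (λ w → v , v , w , fD , fS , refl , refl) (λ (_ , _ , w , _) → w) (rec v fD fS)
  ...   | yes (v , _ , _ , w , fD , fS , _) = yes (claim v fD fS w)
  ...   | no none = no λ { (dominated d) → ¬d d ; (claim v fD fS w) →
    none (v , v , v , w , fD , fS , refl , refl) }

  reply? : ∀ D S → (∀ v → v ∉ D → v ∉ S → Dec (DominatorWins G dominator D (S ∪ ⁅ v ⁆))) →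
           Dec (DominatorWins G staller D S)
  reply? D S rec with dominating? D
  ... | yes d = yes (dominated d)
  ... | no ¬d with any? (free? D S) | all? good
    where
    good : ∀ v → Dec (v ∉ D → v ∉ S → DominatorWins G dominator D (S ∪ ⁅ v ⁆))
    good v with free? D S v
    ... | no ¬f         = yes λ fD fS → contradiction (fD , fS) ¬f
    ... | yes (fD , fS) = map′ (λ w _ _ → w) (λ f → f fD fS) (rec v fD fS)
  ...   | yes f | yes w = yes (reply f w)
  ...   | no ¬f | _     = no λ { (dominated d) → ¬d d ; (reply f _) → ¬f f }
  ...   | _     | no ¬w = no λ { (dominated d) → ¬d d ; (reply _ w) → ¬w w }

  dominatorWins? : ∀ p D S → Acc _⊃_ (D ∪ S) → Dec (DominatorWins G p D S)
  dominatorWins? dominator D S (acc rs) = claim? D S λ v v∉D v∉S →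
    dominatorWins? staller (D ∪ ⁅ v ⁆) S (rs
      ((λ {x} x∈ → x∈p∪q⁺ (either (inj₁ ∘ ∈∪ˡ) inj₂ (x∈p∪q⁻ D S x∈))) ,
       v , x∈p∪q⁺ (inj₁ (∈∪ʳ D v)) , λ v∈ → either v∉D v∉S (x∈p∪q⁻ D S v∈)))
  dominatorWins? staller D S (acc rs) = reply? D S λ v v∉D v∉S →
    dominatorWins? dominator D (S ∪ ⁅ v ⁆) (rs
      ((λ {x} x∈ → x∈p∪q⁺ (either inj₁ (inj₂ ∘ ∈∪ˡ) (x∈p∪q⁻ D S x∈))) ,
       v , x∈p∪q⁺ (inj₂ (∈∪ʳ S v)) , λ v∈ → either v∉D v∉S (x∈p∪q⁻ D S v∈)))

  -- Strategies of the two players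

  module _ {m : ℕ} (_∋_ : Fin n → Fin m → Set) (_∋?_ : ∀ v i → Dec (v ∋ i))
    (convex : ∀ {v i j k} → i ≤ᶠ j → j ≤ᶠ k → v ∋ i → v ∋ k → v ∋ j) where

    open Obstructions _∋_ _∋?_ convex public

    module _ (swallow : ∀ i → ∃[ t ] (∀ {v} → v ≈ t → v ∋ i)) where

      -- The target that `swallow` assigns to i has its whole closed neighbourhood among the
      -- vertices through i. All of them being Staller's, this persists under further moves.
      lost : ∀ {p D S} i → (∀ {v} → v ∋ i → v ∉ D) → (∀ {v} → v ∋ i → v ∈ S) → ¬ DominatorWins G p D S
      lost i i∉D i∈S (dominated d) =
        let t , near = swallow i ; u , u∈D , u≈t = d t in i∉D (near u≈t) u∈D
      lost {D = D} i i∉D i∈S (claim v v∉D v∉S w) =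
        lost i (λ ∋i v′∈ → either (i∉D ∋i) (λ { refl → v∉S (i∈S ∋i) }) (∈∪⁻ D v′∈)) i∈S w
      lost i i∉D i∈S (reply (v , v∉D , v∉S) w) = lost i i∉D (∈∪ˡ ∘ i∈S) (w v v∉D v∉S)

      undominated : ∀ {D} i → (∀ {v} → v ∋ i → v ∉ D) → ¬ Dominating G D
      undominated i i∉D d = let t , near = swallow i ; u , u∈D , u≈t = d t in i∉D (near u≈t) u∈D

      -- The invariant is that vertices touching T belong to Staller or are counted in W, and none
      -- is Dominator's. W may contain vertices of Staller, so a rule applies even if she already
      -- owns its crossing vertex.
      staller-wins : ∀ {W T p q D S} → Ob W T p q →
                     (∀ {v} → Touches T v → v ∉ D) → (∀ {v} → Touches T v → v ∈ S ⊎ W v) →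
                     ¬ DominatorWins G staller D S
      staller-wins {D = D} {S} (leaf s u) out avail win with any? (λ v → (v ∋? s) ×-dec ¬? (v ∈? S))
      ... | no none = lost s (λ ∋s → out (s , here refl , ∋s))
                             (λ {v} ∋s → decidable-stable (v ∈? S) λ v∉S → none (v , ∋s , v∉S)) win
      ... | yes (v , v∋s , v∉S) with win
      ...   | dominated d = undominated s (λ ∋s → out (s , here refl , ∋s)) d
      ...   | reply _ w   =
        lost s (λ ∋s → out (s , here refl , ∋s))
             (λ ∋s → either ∈∪ˡ (λ w → subst (_∈ S ∪ ⁅ v ⁆)
               (u (either (⊥-elim ∘ v∉S) (λ w → w) (avail (s , here refl , v∋s)) , v∋s) (w , ∋s)) (∈∪ʳ S v))
                            (avail (s , here refl , ∋s)))
             (w v (out (s , here refl , v∋s)) v∉S)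
      staller-wins {D = D} {S} (node {T₁} {T₂} {p} o₁ o₂ a<b u) out avail win
        with any? (λ v → (touches? T₁ v ×-dec touches? T₂ v) ×-dec ¬? (v ∈? S))
      ... | no none =
        staller-wins o₁ (out ∘ touches-++ˡ)
          (λ {v} t → either inj₁ (λ w → case v ∈? S of λ
            { (yes v∈S) → inj₁ v∈S
            ; (no v∉S)  → inj₂ (w , λ c → none (v , c , v∉S)) }) (avail (touches-++ˡ t))) win
      ... | yes (e , c@(e₁ , _) , e∉S) with win
      ...   | dominated d = undominated p (λ ∋p → out (p , ∈-++⁺ˡ (first∈ o₁) , ∋p)) d
      ...   | reply _ w with w e (out (touches-++ˡ e₁)) e∉S
      ...     | dominated d = undominated p (λ ∋p → out (p , ∈-++⁺ˡ (first∈ o₁) , ∋p)) d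
      -- All crossing vertices are Staller's by now, so y touches at most one half, and play goes on
      -- in a half that y misses.
      ...     | claim y y∉D y∉S w′ = case touches? T₁ y of λ
        { (no ¬t)  → staller-wins o₁
                       (λ t v∈ → either (out (touches-++ˡ t)) (λ { refl → ¬t t }) (∈∪⁻ D v∈))
                       (λ t → either (inj₁ ∘ ∈∪ˡ) (λ w → settle w λ t₂ → t , t₂) (avail (touches-++ˡ t))) w′
        ; (yes t₁) → staller-wins o₂
                       (λ t v∈ → either (out (touches-++ʳ T₁ t)) (λ { refl → y-crosses (t₁ , t) }) (∈∪⁻ D v∈))
                       (λ t → either (inj₁ ∘ ∈∪ˡ) (λ w → settle′ w t) (avail (touches-++ʳ T₁ t))) w′ }
        where
        is-e : ∀ {v} → _ → Crosses T₁ T₂ v → e ≡ v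
        is-e w c′ = u (either (⊥-elim ∘ e∉S) (λ w → w) (avail (touches-++ˡ e₁)) , c) (w , c′)
        y-crosses : ¬ Crosses T₁ T₂ y
        y-crosses c′ = either (y∉S ∘ ∈∪ˡ) (λ w → y∉S (subst (_∈ S ∪ ⁅ e ⁆) (is-e w c′) (∈∪ʳ S e)))
          (avail (touches-++ˡ (proj₁ c′)))
        settle′ : ∀ {v} (w : _) → Touches T₂ v → v ∈ S ∪ ⁅ e ⁆ ⊎ (_ × ¬ Crosses T₁ T₂ v)
        settle′ {v} w t = case touches? T₁ v of λ
          { (yes t₁) → inj₁ (subst (_∈ S ∪ ⁅ e ⁆) (is-e w (t₁ , t)) (∈∪ʳ S e))
          ; (no ¬t₁) → inj₂ (w , ¬t₁ ∘ proj₁) }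
        settle : ∀ {v} (w : _) → (Touches T₂ v → Crosses T₁ T₂ v) → v ∈ S ∪ ⁅ e ⁆ ⊎ (_ × ¬ Crosses T₁ T₂ v)
        settle {v} w f = case touches? T₂ v of λ
          { (yes t₂) → inj₁ (subst (_∈ S ∪ ⁅ e ⁆) (is-e w (f t₂)) (∈∪ʳ S e))
          ; (no ¬t₂) → inj₂ (w , ¬t₂ ∘ proj₂) }

    module _ (reach : ∀ t → ∃[ i ] (∀ {v} → v ∋ i → v ≈ t)) where

      Free : Subset n → Subset n → Fin n → Set
      Free D S v = v ∉ D × v ∉ S

      Open : Subset n → Fin m → Set
      Open D i = ∀ v → v ∈ D → ¬ v ∋ i

      -- Finite games are decidable, which permits the classical choice of the reply in helly.
      stable : ∀ {p D S} → ¬ ¬ DominatorWins G p D S → DominatorWins G p D S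
      stable {p} {D} {S} = decidable-stable (dominatorWins? p D S (⊃-wellFounded _))

      -- The invariant speaks of free vertices and of points not yet hit. The recursion is on
      -- Staller's set, which grows in every round.
      dominator-wins : ∀ {D S} → Acc _⊃_ S → (∀ {p q} → ¬ ObIn (Free D S) (Open D) p q) →
        DominatorWins G staller D S
      dominator-wins {D} {S} (acc rs) none with all? (λ i → any? λ v → (v ∈? D) ×-dec (v ∋? i))
      ... | yes hit = dominated λ t → let i , near = reach t ; v , v∈D , v∋i = hit i in v , v∈D , near v∋i
      ... | no ¬hit with ¬∀⟶∃¬ m _ (λ i → any? λ v → (v ∈? D) ×-dec (v ∋? i)) ¬hit
      ...   | i , unhit = reply some λ x x∉D x∉S → stable λ stuck →
        helly {W = Free D S} {P = Open D} {x = x} (free? D S) open-i none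
          λ y (y∉D , y∉S) y≢x nothing → stuck (claim y y∉D (λ y∈ → either y∉S y≢x (∈∪⁻ S y∈))
            (dominator-wins (rs (∪-grows x∉S)) λ (T , ob , A) → nothing (_ , _ , T ,
              mono (λ { (( v∉D , v∉S) , v≢x) (s , s∈ , v∋s) →
                (λ v∈ → either v∉D (λ { refl → A s∈ y (∈∪ʳ D y) v∋s }) (∈∪⁻ D v∈)) ,
                (λ v∈ → either v∉S v≢x (∈∪⁻ S v∈)) }) ob ,
              λ s∈ → (λ v v∈D → A s∈ v (∈∪ˡ v∈D)) , A s∈ y (∈∪ʳ D y))))
        where
        open-i : Open D i
        open-i v v∈D v∋i = unhit (v , v∈D , v∋i)
        some : ∃[ v ] v ∉ D × v ∉ S
        -- With an open point left but no free vertex, that point alone would be an obstruction.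
        some = decidable-stable (any? (free? D S)) λ nobody →
          none ([ i ] , leaf i (λ {v} (w , _) → ⊥-elim (nobody (v , w))) , λ { (here refl) → open-i })

      outcome𝒟 : (∀ {T p q} → ¬ Ob (λ _ → ⊤) T p q) → Outcome𝒟 G
      outcome𝒟 none staller   =
        dominator-wins (⊃-wellFounded _) λ (T , ob , _) → none (mono (λ _ _ → ∉⊥ , ∉⊥) ob)
      outcome𝒟 none dominator = case any? (λ (v : Fin n) → yes tt) of λ
        -- Any opening move is safe: an obstruction among the points it leaves open contains no
        -- point of v, so it was one on the empty board.
        { (yes (v , _)) → claim v ∉⊥ ∉⊥ (dominator-wins (⊃-wellFounded _) λ (T , ob , A) →
            none (mono (λ { _ (s , s∈ , ∋s) →
              (λ v∈ → either ∉⊥ (λ { refl → A s∈ v (∈∪ʳ ∅ v) ∋s }) (∈∪⁻ ∅ v∈)) , ∉⊥ }) ob))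
        ; (no nobody)   → dominated λ v → contradiction (v , tt) nobody }

    -- The bounds p and q stand for the neighbouring chosen points beyond the first point a and the
    -- last point b; p ≡ a and q ≡ b encode that there are none.
    Avoids : Fin m → Fin m → Fin n → Set
    Avoids p a v = p ≡ a ⊎ ¬ v ∋ p

    Window : (p q a b : Fin m) → Fin n → Set
    Window p q a b v = Avoids p a v × Avoids q b v

    record Closed (R : (p q a b : Fin m) → Set) : Set where
      field
        closed-leaf : ∀ p q s → AtMostOne (λ v → Window p q s s v × v ∋ s) → R p q s s
        closed-node : ∀ p q a b c d → c <ᶠ d → AtMostOne (λ v → Window p q a b v × v ∋ c × v ∋ d) →
                      R p d a c → R c q d b → R p q a b

    module _ {R : (p q a b : Fin m) → Set} (closed : Closed R) where
      open Closed closed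

      -- A vertex that touches the left part but avoids d cannot reach q, by convexity, and
      -- symmetrically for c and p. So the windows of the two parts stay inside the sets of vertices
      -- available there, and `AtMostOne` passes from these sets to the windows.
      ob⇒related : ∀ {W T a b} → Ob W T a b → ∀ p q → p ≡ a ⊎ p <ᶠ a → q ≡ b ⊎ b <ᶠ q →
                   (∀ {v} → Window p q a b v → Touches T v → W v) → R p q a b
      ob⇒related (leaf s u) p q _ _ f =
        closed-leaf p q s λ (w , ∋s) (w′ , ∋s′) → u (f w (s , here refl , ∋s) , ∋s)
          (f w′ (s , here refl , ∋s′) , ∋s′)
      ob⇒related {a = a} {b} (node {T₁} {T₂} {a = c} {d} o₁ o₂ c<d u) p q p≤ q≥ f =
        closed-node p q a b c d c<d
          (λ (w , ∋c , ∋d) (w′ , ∋c′ , ∋d′) → u (crossing w ∋c ∋d) (crossing w′ ∋c′ ∋d′))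
          (ob⇒related o₁ p d p≤ (inj₂ c<d) λ { (ap , inj₁ refl) _ → ⊥-elim (<-irrefl refl c<d)
                                             ; (ap , inj₂ ∌d) t → left ap ∌d t })
          (ob⇒related o₂ c q (inj₂ c<d) q≥ λ { (inj₁ refl , aq) _ → ⊥-elim (<-irrefl refl c<d)
                                             ; (inj₂ ∌c , aq) t → right aq ∌c t })
        where
        crossing : ∀ {v} → Window p q a b v → v ∋ c → v ∋ d → _ × Crosses T₁ T₂ v
        crossing w ∋c ∋d =
          let t₁ = c , last∈ o₁ , ∋c ; t₂ = d , first∈ o₂ , ∋d in f w (touches-++ˡ t₁) , t₁ , t₂
        left : ∀ {v} → Avoids p a v → ¬ v ∋ d → Touches T₁ v → _ × ¬ Crosses T₁ T₂ v
        left ap ∌d t@(s , s∈ , ∋s) =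
          f (ap , either inj₁ (λ b<q → inj₂ λ ∋q →
               ∌d (convex s≤d (≤-trans (proj₂ (range o₂ (first∈ o₂))) (<⇒≤ b<q)) ∋s ∋q)) q≥) (touches-++ˡ t) ,
          λ { (_ , s′ , s′∈ , ∋s′) → ∌d (convex s≤d (proj₁ (range o₂ s′∈)) ∋s ∋s′) }
          where s≤d = ≤-trans (proj₂ (range o₁ s∈)) (<⇒≤ c<d)
        right : ∀ {v} → Avoids q b v → ¬ v ∋ c → Touches T₂ v → _ × ¬ Crosses T₁ T₂ v
        right aq ∌c t@(s , s∈ , ∋s) =
          f (either inj₁ (λ p<a → inj₂ λ ∋p →
               ∌c (convex (≤-trans (<⇒≤ p<a) (proj₁ (range o₁ (last∈ o₁)))) c≤s ∋p ∋s)) p≤ , aq)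
                 (touches-++ʳ T₁ t) ,
          λ { ((s′ , s′∈ , ∋s′) , _) → ∌c (convex (proj₂ (range o₁ s′∈)) c≤s ∋s′ ∋s) }
          where c≤s = ≤-trans (<⇒≤ c<d) (proj₁ (range o₂ s∈))

      no-ob : (∀ a b → ¬ R a b a b) → ∀ {T a b} → ¬ Ob (λ _ → ⊤) T a b
      no-ob none ob = none _ _ (ob⇒related ob _ _ (inj₁ refl) (inj₁ refl) λ _ _ → tt)

    -- The relation an honest certificate tabulates: actual obstructions with ends a and b among the
    -- vertices of the window. It is a large type with no decision procedure at hand, so its table
    -- is obtained up to double negation.
    obRelation : (p q a b : Fin m) → Set₁
    obRelation p q a b = ∃[ T ] Ob (Window p q a b) T a b

    obRelation-leaf : ∀ p q s → AtMostOne (λ v → Window p q s s v × v ∋ s) → obRelation p q s s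
    obRelation-leaf p q s u = [ s ] , leaf s u

    obRelation-node : ∀ p q a b c d → c <ᶠ d → AtMostOne (λ v → Window p q a b v × v ∋ c × v ∋ d) →
                      obRelation p d a c → obRelation c q d b → obRelation p q a b
    obRelation-node p q a b c d c<d u (T₁ , o₁) (T₂ , o₂) =
      T₁ ++ T₂ ,
      node (mono (λ { ((ap , _) , ¬c) t → ap , inj₂ λ ∋d → ¬c (t , d , first∈ o₂ , ∋d) }) o₁)
           (mono (λ { ((_ , aq) , ¬c) t → (inj₂ λ ∋c → ¬c ((c , last∈ o₁ , ∋c) , t)) , aq }) o₂)
           c<d
           λ (w , c) (w′ , c′) → u (w , spans c) (w′ , spans c′)
      where
      spans : ∀ {v} → Crosses T₁ T₂ v → v ∋ c × v ∋ d
      spans ((s , s∈ , ∋s) , (s′ , s′∈ , ∋s′)) =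
        let s≤c = proj₂ (range o₁ s∈) ; d≤s′ = proj₁ (range o₂ s′∈) in
        convex s≤c (≤-trans (<⇒≤ c<d) d≤s′) ∋s ∋s′ , convex (≤-trans s≤c (<⇒≤ c<d)) d≤s′ ∋s ∋s′

    -- For p = a and q = b the window is the whole vertex set, so such an obstruction would let
    -- Staller win from the empty board.
    obRelation-root : (∀ i → ∃[ t ] (∀ {v} → v ≈ t → v ∋ i)) → Outcome𝒟 G → ∀ a b → ¬ obRelation a b a b
    obRelation-root swallow win a b (T , ob) =
      staller-wins swallow ob (λ _ → ∉⊥) (λ _ → inj₂ (inj₁ refl , inj₁ refl)) (win staller)

-- The sentence describing a certificate

module Semantics {vars : ℕ} (n : ℕ) (rd : Source → ℕ → Bool) where

  Sat : ∀ {d} → Fm vars d → (Fin vars → ℕ) → Set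
  Sat (atom s is r)     ρ = T (rd s (offset n (stride s) ρ is r))
  Sat (eq i j)          ρ = ρ i ≡ ρ j
  Sat (lt i j)          ρ = ρ i < ρ j
  Sat (neg φ)           ρ = ¬ Sat φ ρ
  Sat (bin conj φ ψ)    ρ = Sat φ ρ × Sat ψ ρ
  Sat (bin disj φ ψ)    ρ = Sat φ ρ ⊎ Sat ψ ρ
  Sat (bin impl φ ψ)    ρ = Sat φ ρ → Sat ψ ρ
  Sat (all {ok = ok} φ) ρ = ∀ (v : Fin n) → Sat φ (ρ [ bound ok ≔ toℕ v ])

  allFrom-reflects : ∀ {f : ℕ → Bool} {P : ℕ → Set} → (∀ k → Reflects (P k) (f k)) → ∀ m v →
                     Reflects (∀ k → v ≤ k → k < v + m → P k) (allFrom f m v)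
  allFrom-reflects h zero v =
    ofʸ λ k v≤k k<v → contradiction (≤-trans k<v (≤-trans (≤-reflexive (+-identityʳ v)) v≤k)) (<-irrefl refl)
  allFrom-reflects {f} {P} h (suc m) v with f v | h v | allFrom f m (suc v) | allFrom-reflects h m (suc v)
  ... | false | ofⁿ ¬p | _     | _       = ofⁿ λ a → ¬p
    (a v ≤-refl (subst (suc v ≤_) (sym (+-suc v m)) (s≤s (m≤m+n v m))))
  ... | true  | ofʸ p  | true  | ofʸ rest = ofʸ λ k v≤k k< → go k (m≤n⇒m<n∨m≡n v≤k) k<
    where
    go : ∀ k → v < k ⊎ v ≡ k → k < v + suc m → P k
    go k (inj₁ v<k)  k< = rest k v<k (subst (k <_) (+-suc v m) k<)
    go k (inj₂ refl) _  = p
  ... | true  | ofʸ p  | false | ofⁿ ¬a  = ofⁿ λ a → ¬a λ k v<k k< →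
    a k (≤-trans (n≤1+n v) v<k) (subst (k <_) (sym (+-suc v m)) k<)

  sat-reflects : ∀ {d} (φ : Fm vars d) ρ → Reflects (Sat φ ρ) (eval n rd φ ρ)
  sat-reflects (atom s is r)  ρ = T-reflects _
  sat-reflects (eq i j)       ρ = fromEquivalence (≡ᵇ⇒≡ _ _) (≡⇒≡ᵇ _ _)
  sat-reflects (lt i j)       ρ = <ᵇ-reflects-< _ _
  sat-reflects (neg φ)        ρ = ¬-reflects (sat-reflects φ ρ)
  sat-reflects (bin conj φ ψ) ρ = sat-reflects φ ρ ×-reflects sat-reflects ψ ρ
  sat-reflects (bin disj φ ψ) ρ = sat-reflects φ ρ ⊎-reflects sat-reflects ψ ρ
  sat-reflects (bin impl φ ψ) ρ = sat-reflects φ ρ →-reflects sat-reflects ψ ρ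
  sat-reflects (all {ok = ok} φ) ρ
    with allFrom (λ v → eval n rd φ (ρ [ bound ok ≔ v ])) n 0
       | allFrom-reflects (λ v → sat-reflects φ (ρ [ bound ok ≔ v ])) n 0
  ... | true  | ofʸ h  = ofʸ λ v → h (toℕ v) z≤n (toℕ<n v)
  ... | false | ofⁿ ¬h = ofⁿ λ h → ¬h λ k _ k<n →
    subst (λ j → Sat φ (ρ [ bound ok ≔ j ])) (toℕ-fromℕ< k<n) (h (fromℕ< k<n))

  sat? : ∀ {d} (φ : Fm vars d) ρ → Dec (Sat φ ρ)
  sat? φ ρ = _ because sat-reflects φ ρ

  -- Existence is expressed by negated universality; over a finite domain with decidable
  -- satisfaction a witness can be recovered.
  sat-ex : ∀ {d} {ok : True (d <? vars)} (φ : Fm vars (suc d)) {ρ} →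
           Sat (neg (all {ok = ok} (neg φ))) ρ → ∃[ v ] Sat φ (ρ [ bound ok ≔ toℕ {n} v ])
  sat-ex {ok = ok} φ {ρ} h = decidable-stable (any? λ v → sat? φ (ρ [ bound ok ≔ toℕ v ])) λ none →
    h λ v s → none (v , s)

-- B is an interval model, D the incidence of vertices with the points to be hit, and O a relation
-- containing every obstruction; equalities are stated on indices, as the formula sees them.
record Model {n : ℕ} (A B D : Fin n → Fin n → Set) (O : (p q a b : Fin n) → Set) : Set where
  field
    loopless    : ∀ v → ¬ A v v
    symmetric   : ∀ u v → A u v → A v u
    shared      : ∀ u v → toℕ u ≢ toℕ v → A u v → ∃[ i ] B u i × B v i
    adjacent    : ∀ u v i → toℕ u ≢ toℕ v × B u i × B v i → A u v
    inhabited   : ∀ v → ∃[ i ] B v i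
    B-convex    : ∀ v i j k → (i <ᶠ j × j <ᶠ k) × B v i × B v k → B v j
    D-convex    : ∀ v i j k → (i <ᶠ j × j <ᶠ k) × D v i × D v k → D v j
    reaching    : ∀ t → ∃[ i ] (∀ v → D v i → toℕ v ≡ toℕ t ⊎ A v t)
    leaf-closed : ∀ p q s →
      (∀ v w → ((toℕ p ≡ toℕ s ⊎ ¬ D v p) × (toℕ q ≡ toℕ s ⊎ ¬ D v q) × D v s) ×
               ((toℕ p ≡ toℕ s ⊎ ¬ D w p) × (toℕ q ≡ toℕ s ⊎ ¬ D w q) × D w s) → toℕ v ≡ toℕ w) →
      O p q s s
    node-closed : ∀ p q a b c d → c <ᶠ d →
      (∀ v w → ((toℕ p ≡ toℕ a ⊎ ¬ D v p) × (toℕ q ≡ toℕ b ⊎ ¬ D v q) × D v c × D v d) ×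
               ((toℕ p ≡ toℕ a ⊎ ¬ D w p) × (toℕ q ≡ toℕ b ⊎ ¬ D w q) × D w c × D w d) → toℕ v ≡ toℕ w) →
      O p d a c → O c q d b → O p q a b
    root-free   : ∀ a b → ¬ O a b a b

infixr 4 _⇒_
infixr 6 _∨f_
infixr 7 _∧f_
pattern _⇒_ φ ψ  = bin impl φ ψ
pattern _∨f_ φ ψ = bin disj φ ψ
pattern _∧f_ φ ψ = bin conj φ ψ

pattern v₀ = zero
pattern v₁ = suc v₀
pattern v₂ = suc v₁
pattern v₃ = suc v₂
pattern v₄ = suc v₃
pattern v₅ = suc v₄
pattern v₆ = suc v₅
pattern v₇ = suc v₆

module _ {d : ℕ} where

  -- The certificate holds three bits for every 4-tuple; B and D use the tuples (v , i , v , v) only.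
  Af Bf Df : Fin 8 → Fin 8 → Fm 8 d
  Af i j = atom input (i ∷ j ∷ []) 0
  Bf v i = atom certificate (v ∷ i ∷ v ∷ v ∷ []) 0
  Df v i = atom certificate (v ∷ i ∷ v ∷ v ∷ []) 1

  Of : (p q a b : Fin 8) → Fm 8 d
  Of p q a b = atom certificate (p ∷ q ∷ a ∷ b ∷ []) 2

exists : ∀ {d} {ok : True (d <? 8)} → Fm 8 (suc d) → Fm 8 d
exists {ok = ok} φ = neg (all {ok = ok} (neg φ))

looplessF symmetricF sharedF adjacentF inhabitedF B-convexF D-convexF reachingF leafF nodeF rootF : Fm 8 0
looplessF  = all (neg (Af v₀ v₀))
symmetricF = all (all (Af v₀ v₁ ⇒ Af v₁ v₀))
sharedF    = all (all (neg (eq v₀ v₁) ⇒ Af v₀ v₁ ⇒ exists (Bf v₀ v₂ ∧f Bf v₁ v₂)))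
adjacentF  = all (all (all (neg (eq v₀ v₁) ∧f Bf v₀ v₂ ∧f Bf v₁ v₂ ⇒ Af v₀ v₁)))
inhabitedF = all (exists (Bf v₀ v₁))
B-convexF  = all (all (all (all ((lt v₁ v₂ ∧f lt v₂ v₃) ∧f Bf v₀ v₁ ∧f Bf v₀ v₃ ⇒ Bf v₀ v₂))))
D-convexF  = all (all (all (all ((lt v₁ v₂ ∧f lt v₂ v₃) ∧f Df v₀ v₁ ∧f Df v₀ v₃ ⇒ Df v₀ v₂))))
reachingF  = all (exists (all (Df v₂ v₁ ⇒ eq v₂ v₀ ∨f Af v₂ v₀)))
leafF      = all (all (all (all (all (only v₃ ∧f only v₄ ⇒ eq v₃ v₄)) ⇒ Of v₀ v₁ v₂ v₂)))
  where
  only : Fin 8 → Fm 8 5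
  only v = (eq v₀ v₂ ∨f neg (Df v v₀)) ∧f (eq v₁ v₂ ∨f neg (Df v v₁)) ∧f Df v v₂
-- This rule sets the number of variables: six points p, q, a, b, c, d, and two vertices to express
-- uniqueness.
nodeF      = all (all (all (all (all (all
  (lt v₄ v₅ ⇒ all (all (only v₆ ∧f only v₇ ⇒ eq v₆ v₇)) ⇒ Of v₀ v₅ v₂ v₄ ⇒ Of v₄ v₁ v₅ v₃ ⇒ Of v₀ v₁ v₂
    v₃))))))
  where
  only : Fin 8 → Fm 8 8
  only v = (eq v₀ v₂ ∨f neg (Df v v₀)) ∧f (eq v₁ v₃ ∨f neg (Df v v₁)) ∧f Df v v₄ ∧f Df v v₅
rootF      = all (all (neg (Of v₀ v₁ v₀ v₁)))

opaque
  modelF : Fm 8 0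
  modelF = looplessF ∧f symmetricF ∧f sharedF ∧f adjacentF ∧f inhabitedF ∧f B-convexF ∧f D-convexF ∧f
           reachingF ∧f leafF ∧f nodeF ∧f rootF

module _ {n : ℕ} (rd : Source → ℕ → Bool) where
  open Semantics {8} n rd

  -- The arithmetic is spelled the way `offset` unfolds, so that satisfaction and `Model` agree by
  -- computation except for the existential fields.
  InputRel : Fin n → Fin n → Set
  InputRel u v = T (rd input (toℕ u * (n * 1) + (toℕ v * 1 + 0)))

  CertRel : ℕ → (p q a b : Fin n) → Set
  CertRel r p q a b =
    T (rd certificate (toℕ p * (n * (n * (n * 3))) + (toℕ q * (n * (n * 3)) +
      (toℕ a * (n * 3) + (toℕ b * 3 + r)))))

  ReadModel : Set
  ReadModel = Model InputRel (λ v i → CertRel 0 v i v v) (λ v i → CertRel 1 v i v v) (CertRel 2)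

  ¬¬ex : ∀ {P : Fin n → Set} → ∃[ v ] P v → ¬ (∀ v → ¬ P v)
  ¬¬ex (v , p) h = h v p

  opaque
    unfolding modelF

    sat⇒model : Sat modelF (λ _ → 0) → ReadModel
    sat⇒model (f₁ , f₂ , f₃ , f₄ , f₅ , f₆ , f₇ , f₈ , f₉ , f₁₀ , f₁₁) = record
      { loopless    = f₁
      ; symmetric   = f₂
      ; shared      = λ u v u≢v a → sat-ex {2} (Bf v₀ v₂ ∧f Bf v₁ v₂)
        {ρ = (λ _ → 0) [ v₀ ≔ toℕ u ] [ v₁ ≔ toℕ v ]} (f₃ u v u≢v a)
      ; adjacent    = f₄
      ; inhabited   = λ v → sat-ex {1} (Bf v₀ v₁) {ρ = (λ _ → 0) [ v₀ ≔ toℕ v ]} (f₅ v)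
      ; B-convex    = f₆
      ; D-convex    = f₇
      ; reaching    = λ t → sat-ex {1} (all (Df v₂ v₁ ⇒ eq v₂ v₀ ∨f Af v₂ v₀))
        {ρ = (λ _ → 0) [ v₀ ≔ toℕ t ]} (f₈ t)
      ; leaf-closed = f₉
      ; node-closed = f₁₀
      ; root-free   = f₁₁
      }

    model⇒sat : ReadModel → Sat modelF (λ _ → 0)
    model⇒sat M = loopless , symmetric , (λ u v u≢v a → ¬¬ex (shared u v u≢v a)) , adjacent ,
      (λ v → ¬¬ex (inhabited v)) ,
      B-convex , D-convex , (λ t → ¬¬ex (reaching t)) , leaf-closed , node-closed , root-free
      where open Model M

-- Real and integral interval models

fromℤ : ℤ → ℚ
fromℤ i = mkℚ i 0 (coprime-sym (1-coprimeTo ℤ.∣ i ∣))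

fromℤ-mono : ∀ {i j} → i ℤ.< j → fromℤ i ℚ.< fromℤ j
fromℤ-mono {i} {j} i<j = *<* (subst₂ ℤ._<_ (sym (ℤP.*-identityʳ i)) (sym (ℤP.*-identityʳ j)) i<j)

ι : ℕ → ℝ
ι k = record
  { Lower         = ℚ._< a
  ; Upper         = a ℚ.<_
  ; lower-inhab   = fromℤ -[1+ 0 ] , fromℤ-mono ℤ.-<+
  ; upper-inhab   = fromℤ (ℤ.+ suc k) , fromℤ-mono (ℤ.+<+ ≤-refl)
  ; lower-rounded = λ q → mk⇔ ℚP.<-dense (λ (r , q<r , r<a) → ℚP.<-trans q<r r<a)
  ; upper-rounded = λ q → mk⇔ (λ a<q → let r , a<r , r<q = ℚP.<-dense a<q in r , r<q , a<r)
                              (λ (r , r<q , a<r) → ℚP.<-trans a<r r<q)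
  ; disjoint      = λ q (q<a , a<q) → ℚP.<-asym q<a a<q
  ; located       = λ q r q<r → case q ℚP.<? a of λ
      { (yes q<a) → inj₁ q<a
      ; (no q≮a)  → inj₂ (ℚP.≤-<-trans (ℚP.≮⇒≥ q≮a) q<r) }
  }
  where a = fromℤ (ℤ.+ k)

ι-mono : ∀ {j k} → j ≤ k → ι j ≤ℝ ι k
ι-mono {j} {k} j≤k q q<j with j ℕP.≟ k
... | yes refl = q<j
... | no j≢k   = ℚP.<-trans q<j (fromℤ-mono (ℤ.+<+ (ℕP.≤∧≢⇒< j≤k j≢k)))

ι-reflects : ∀ {j k} → ι j ≤ℝ ι k → j ≤ k
ι-reflects {j} {k} h with j ≤? k
... | yes j≤k = j≤k
... | no j≰k  = contradiction (h (fromℤ (ℤ.+ k)) (fromℤ-mono (ℤ.+<+ (≰⇒> j≰k)))) (ℚP.<-irrefl refl)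

≤ℝ-refl : ∀ {x} → x ≤ℝ x
≤ℝ-refl q l = l

≤ℝ-trans : ∀ {x y z} → x ≤ℝ y → y ≤ℝ z → x ≤ℝ z
≤ℝ-trans f g q l = g q (f q l)

-- For q below y, roundedness gives r with q < r below y, and locatedness puts q below x or r above
-- x. The latter would make x ≤ y.
≰ℝ⇒≥ : ∀ {x y} → ¬ x ≤ℝ y → y ≤ℝ x
≰ℝ⇒≥ {x} {y} x≰y q q<y = case to (ℝ.lower-rounded y q) q<y of λ
  { (r , q<r , r<y) → case ℝ.located x q r q<r of λ
    { (inj₁ q<x) → q<x
    ; (inj₂ x<r) → ⊥-elim (x≰y λ s s<x → case s ℚP.<? r of λ
        { (yes s<r) → from (ℝ.lower-rounded y s) (r , s<r , r<y)
        ; (no s≮r)  → ⊥-elim (ℝ.disjoint x s (s<x , upward (ℚP.≮⇒≥ s≮r) x<r)) }) } }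
  where
  upward : ∀ {r s} → r ℚ.≤ s → ℝ.Upper x r → ℝ.Upper x s
  upward {r} {s} r≤s x<r with to (ℝ.upper-rounded x r) x<r
  ... | t , t<r , x<t = from (ℝ.upper-rounded x s) (t , ℚP.<-≤-trans t<r r≤s , x<t)

¬¬-choice : ∀ {ℓ n} {A : Fin n → Set ℓ} → (∀ i → ¬ ¬ A i) → ¬ ¬ (∀ i → A i)
¬¬-choice {n = zero}  h k = k λ ()
¬¬-choice {n = suc n} h k = h zero λ a → ¬¬-choice (h ∘ suc) λ f → k λ { zero → a ; (suc i) → f i }

¬¬-decided : ∀ {ℓ} {A : Set ℓ} → ¬ ¬ (∃[ b ] T b ⇔ A)
¬¬-decided k = ¬¬-excluded-middle λ
  { (yes a) → k (true , mk⇔ (λ _ → a) (λ _ → tt))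
  ; (no ¬a) → k (false , mk⇔ (λ ()) ¬a) }

-- Ranks of endpoints

maximal : ∀ {n} {P : Fin n → Set} → Decidable P → (f : Fin n → ℕ) → ∃[ i ] P i →
          ∃[ t ] P t × (∀ s → P s → f s ≤ f t)
maximal {suc n} {P} P? f (i , p) with any? (P? ∘ suc)
... | no none = zero , first i p ,
                λ { zero _ → ≤-refl ; (suc s) p → ⊥-elim (none (s , p)) }
  where
  first : ∀ i → P i → P zero
  first zero    p = p
  first (suc i) p = ⊥-elim (none (i , p))
... | yes some with maximal (P? ∘ suc) (f ∘ suc) some
...   | t , pt , best with P? zero | f (suc t) ≤? f zero
...     | yes p₀ | yes ≤₀ = zero , p₀ , λ { zero _ → ≤-refl ; (suc s) p → ≤-trans (best s p) ≤₀ }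
...     | yes p₀ | no ≰₀  = suc t , pt , λ { zero _ → <⇒≤ (≰⇒> ≰₀) ; (suc s) p → best s p }
...     | no ¬p₀ | _      = suc t , pt , λ { zero p → contradiction p ¬p₀ ; (suc s) p → best s p }

count : ∀ {n} → (Fin n → Bool) → ℕ
count {zero}  f = 0
count {suc n} f = if f zero then suc (count (f ∘ suc)) else count (f ∘ suc)

count-mono : ∀ {n} {f g : Fin n → Bool} → (∀ i → T (f i) → T (g i)) → count f ≤ count g
count-mono {zero} h = z≤n
count-mono {suc n} {f} {g} h with f zero | g zero | h zero
... | true  | true  | _ = s≤s (count-mono (h ∘ suc))
... | true  | false | k = ⊥-elim (k tt)
... | false | true  | _ = m≤n⇒m≤1+n (count-mono (h ∘ suc))
... | false | false | _ = count-mono (h ∘ suc)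

count-strict : ∀ {n} {f g : Fin n → Bool} → (∀ i → T (f i) → T (g i)) → ∀ i → ¬ T (f i) → T (g i) →
  count f < count g
count-strict {suc n} {f} {g} h zero ¬f₀ g₀ with f zero | g zero
... | true  | _    = ⊥-elim (¬f₀ tt)
... | false | true = s≤s (count-mono (h ∘ suc))
count-strict {suc n} {f} {g} h (suc i) ¬f g₁ with f zero | g zero | h zero
... | true  | true  | _ = s≤s (count-strict (h ∘ suc) i ¬f g₁)
... | true  | false | k = ⊥-elim (k tt)
... | false | true  | _ = m≤n⇒m≤1+n (count-strict (h ∘ suc) i ¬f g₁)
... | false | false | _ = count-strict (h ∘ suc) i ¬f g₁

count-all : ∀ n → count {n} (λ _ → true) ≡ n
count-all zero    = refl
count-all (suc n) = cong suc (count-all n)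

count-none : ∀ {n} {f : Fin n → Bool} → (∀ i → ¬ T (f i)) → count f ≡ 0
count-none {zero} h = refl
count-none {suc n} {f} h with f zero | h zero
... | true  | k = ⊥-elim (k tt)
... | false | _ = count-none (h ∘ suc)

count<n : ∀ {n} {f : Fin n → Bool} i → ¬ T (f i) → count f < n
count<n {n} {f} i ¬f = subst (count f <_) (count-all n)
  (count-strict {f = f} {g = λ _ → true} (λ _ _ → tt) i ¬f tt)

T-not : ∀ {b} → T (not b) → ¬ T b
T-not {false} _ ()

not-T : ∀ {b} → ¬ T b → T (not b)
not-T {true}  h = h tt
not-T {false} h = tt

-- Right endpoints below n allow the indices of vertices to serve as points. `bottom` guarantees
-- that some interval ends at or before each point, so that no point is without a target.
record NatIntervals {n : ℕ} (G : Graph n) : Set where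
  field
    L R      : Fin n → ℕ
    L≤R      : ∀ v → L v ≤ R v
    R<n      : ∀ v → R v < n
    bottom   : Fin n → ∃[ t ] R t ≡ 0
    adjacent : ∀ {u v} → u ≢ v → Adjacent G u v ⇔ (L u ≤ R v × L v ≤ R u)

-- Endpoints are replaced by the number of right endpoints strictly to their left.
natIntervals : ∀ {n} (G : Graph n) → IsInterval G → ¬ ¬ NatIntervals G
natIntervals {n} G (I , adj⇔) k =
  ¬¬-choice (λ u → ¬¬-choice λ v → ¬¬-decided {A = left u ≤ℝ right v}) λ LR →
  ¬¬-choice (λ u → ¬¬-choice λ v → ¬¬-decided {A = right u ≤ℝ right v}) λ RR →
  k (model (λ u v → proj₁ (LR u v)) (λ u v → proj₁ (RR u v)) (λ u v → proj₂ (LR u v))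
    (λ u v → proj₂ (RR u v)))
  where
  open module C v = ClosedInterval (I v)
  module _ (lr rr : Fin n → Fin n → Bool) (lr⇔ : ∀ u v → T (lr u v) ⇔ (left u ≤ℝ right v))
           (rr⇔ : ∀ u v → T (rr u v) ⇔ (right u ≤ℝ right v)) where
    lf rk : Fin n → ℕ
    lf v = count λ u → not (lr v u)
    rk v = count λ u → not (rr v u)

    lf≤rk : ∀ {u v} → left v ≤ℝ right u → lf v ≤ rk u
    lf≤rk {u} {v} l≤r = count-mono λ w r<l → not-T λ t →
      T-not r<l (from (lr⇔ v w) (≤ℝ-trans {left v} {right u} {right w} l≤r (to (rr⇔ u w) t)))

    -- The right endpoint of u itself makes the inequality strict: it is counted in the rank of the
    -- left end of v but not in its own.
    rk<lf : ∀ {u v} → ¬ left v ≤ℝ right u → rk u < lf v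
    rk<lf {u} {v} l≰r = count-strict
      (λ w r<r → not-T λ t → l≰r (≤ℝ-trans {left v} {right w} {right u} (to (lr⇔ v w) t)
                                    (≰ℝ⇒≥ {right u} {right w} (T-not r<r ∘ from (rr⇔ u w)))))
      u (λ t → T-not t (from (rr⇔ u u) (≤ℝ-refl {right u}))) (not-T (l≰r ∘ to (lr⇔ v u)))

    rk<rk : ∀ {u v} → ¬ right v ≤ℝ right u → rk u < rk v
    rk<rk {u} {v} r≰r = count-strict
      (λ w r<r → not-T λ t → r≰r (≤ℝ-trans {right v} {right w} {right u} (to (rr⇔ v w) t)
                                    (≰ℝ⇒≥ {right u} {right w} (T-not r<r ∘ from (rr⇔ u w)))))
      u (λ t → T-not t (from (rr⇔ u u) (≤ℝ-refl {right u}))) (not-T (r≰r ∘ to (rr⇔ v u)))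

    rk<n : ∀ v → rk v < n
    rk<n v = count<n v λ t → T-not t (from (rr⇔ v v) (≤ℝ-refl {right v}))

    least : Fin n → ∃[ t ] rk t ≡ 0
    least v with maximal {P = λ _ → ⊤} (λ _ → yes tt) (λ t → n ∸ rk t) (v , tt)
    ... | t , _ , best = t , count-none λ u r<r →
      <⇒≱ (∸-monoʳ-< (rk<rk {u} {t} (T-not r<r ∘ from (rr⇔ t u))) (<⇒≤ (rk<n t))) (best u tt)

    le : ∀ {u v} → lf u ≤ rk v → left u ≤ℝ right v
    le {u} {v} l≤r = to (lr⇔ u v) (decidable-stable (T? _) λ ¬t →
      <⇒≱ (rk<lf {v} {u} (¬t ∘ from (lr⇔ u v))) l≤r)

    model : NatIntervals G
    model = record
      { L = lf ; R = rk
      ; L≤R = λ v → lf≤rk {v} {v} (left≤right v)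
      ; R<n = rk<n
      ; bottom = least
      ; adjacent = λ {u} {v} u≢v → mk⇔
          (λ a → case to (adj⇔ u v u≢v) a of λ { (x , (l≤x , x≤r) , (l′≤x , x≤r′)) →
             lf≤rk {v} {u} (≤ℝ-trans {left u} {x} {right v} l≤x x≤r′) ,
             lf≤rk {u} {v} (≤ℝ-trans {left v} {x} {right u} l′≤x x≤r) })
          -- Adjacency being decidable, the left endpoints may be compared classically; the later
          -- one lies in both intervals.
          (λ (a , b) → decidable-stable (T? _) λ ¬adj → ¬¬-excluded-middle λ
            { (yes l≤l) → ¬adj (from (adj⇔ u v u≢v)
                (left v , (l≤l , le {v} {u} b) , (≤ℝ-refl {left v} , left≤right v)))
            ; (no l≰l)  → ¬adj (from (adj⇔ u v u≢v)
                (left u , (≤ℝ-refl {left u} , left≤right u) , (≰ℝ⇒≥ {left u} {left v} l≰l , le {u} {v} a))) })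
      }

-- Certificates and interval graphs

weakly-convex : ∀ {n} {P : Fin n → Set} → (∀ i j k → (i <ᶠ j × j <ᶠ k) × P i × P k → P j) →
                ∀ {i j k} → i ≤ᶠ j → j ≤ᶠ k → P i → P k → P j
weakly-convex h {i} {j} {k} i≤j j≤k pi pk with i ≟ j | j ≟ k
... | yes refl | _        = pi
... | no _     | yes refl = pk
... | no i≢j   | no j≢k   = h i j k ((≤∧≢⇒< i≤j (i≢j ∘ toℕ-injective) , ≤∧≢⇒< j≤k (j≢k ∘ toℕ-injective)) ,
  pi , pk)

module _ {n : ℕ} (G : Graph n) {B D : Fin n → Fin n → Set} {O : (p q a b : Fin n) → Set}
  (B? : ∀ v i → Dec (B v i)) (D? : ∀ v i → Dec (D v i)) (M : Model (Adjacent G) B D O) where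
  open Model M

  lastPoint : ∀ v → ∃[ t ] B v t × (∀ s → B v s → toℕ s ≤ toℕ t)
  lastPoint v = maximal (B? v) toℕ (inhabited v)

  firstPoint : ∀ v → ∃[ t ] B v t × (∀ s → B v s → toℕ t ≤ toℕ s)
  firstPoint v with maximal (B? v) (λ i → n ∸ toℕ i) (inhabited v)
  ... | t , bt , best = t , bt , λ s bs → case toℕ t ≤? toℕ s of λ
    { (yes t≤s) → t≤s
    ; (no t≰s)  → contradiction (best s bs) (<⇒≱ (∸-monoʳ-< (≰⇒> t≰s) (<⇒≤ (toℕ<n t)))) }

  model⇒interval : IsInterval G
  model⇒interval = interval , λ u v u≢v → mk⇔ (meet u v u≢v) (join u v u≢v)
    where
    l r : Fin n → Fin n
    l = proj₁ ∘ firstPoint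
    r = proj₁ ∘ lastPoint
    l∈ : ∀ v → B v (l v)
    l∈ v = proj₁ (proj₂ (firstPoint v))
    r∈ : ∀ v → B v (r v)
    r∈ v = proj₁ (proj₂ (lastPoint v))
    l≤ : ∀ {v i} → B v i → l v ≤ᶠ i
    l≤ {v} {i} = proj₂ (proj₂ (firstPoint v)) i
    ≤r : ∀ {v i} → B v i → i ≤ᶠ r v
    ≤r {v} {i} = proj₂ (proj₂ (lastPoint v)) i
    interval : Fin n → ClosedInterval
    interval v = record { left = ι (toℕ (l v)) ; right = ι (toℕ (r v)) ; left≤right = ι-mono (l≤ (r∈ v)) }
    meet : ∀ u v → u ≢ v → Adjacent G u v → Intersect (interval u) (interval v)
    meet u v u≢v a with shared u v (u≢v ∘ toℕ-injective) a
    ... | i , bu , bv = ι (toℕ i) , (ι-mono (l≤ bu) , ι-mono (≤r bu)) , (ι-mono (l≤ bv) , ι-mono (≤r bv))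
    within : ∀ {v i} → l v ≤ᶠ i → i ≤ᶠ r v → B v i
    within {v} lo hi = weakly-convex (B-convex v) lo hi (l∈ v) (r∈ v)
    join : ∀ u v → u ≢ v → Intersect (interval u) (interval v) → Adjacent G u v
    -- The real x is used only to compare endpoints; the common point is the later of the two first
    -- points, an index.
    join u v u≢v (x , (lu≤x , x≤ru) , (lv≤x , x≤rv)) with ≤-total (toℕ (l u)) (toℕ (l v))
    ... | inj₁ lu≤lv = adjacent u v (l v) (u≢v ∘ toℕ-injective ,
      within {u} lu≤lv (ι-reflects (≤ℝ-trans {ι (toℕ (l v))} {x} {ι (toℕ (r u))} lv≤x x≤ru)) , l∈ v)
    ... | inj₂ lv≤lu = adjacent u v (l u) (u≢v ∘ toℕ-injective ,
      l∈ u , within {v} lv≤lu (ι-reflects (≤ℝ-trans {ι (toℕ (l u))} {x} {ι (toℕ (r v))} lu≤x x≤rv)))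

  -- Soundness rests on `reaching`: hitting all points suffices to dominate. That hitting them is
  -- also necessary (`hits-swallow`) enters where an honest table must be free of obstructions.
  model⇒outcome : Outcome𝒟 G
  model⇒outcome = outcome𝒟 G D D? convex
    (λ t → let i , near = reaching t in i , λ {v} d → Sum.map₁ toℕ-injective (near v d))
    (no-ob G D D? convex closed root-free)
    where
    convex : ∀ {v i j k} → i ≤ᶠ j → j ≤ᶠ k → D v i → D v k → D v j
    convex {v} = weakly-convex (D-convex v)
    closed : Closed G D D? convex O
    closed = record
      { closed-leaf = λ p q s u → leaf-closed p q s λ v w ((a , b , c) , (a′ , b′ , c′)) →
          cong toℕ (u ((Sum.map₁ toℕ-injective a , Sum.map₁ toℕ-injective b) , c)
            ((Sum.map₁ toℕ-injective a′ , Sum.map₁ toℕ-injective b′) , c′))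
      ; closed-node = λ p q a b c d c<d u → node-closed p q a b c d c<d λ v w ((x , y , z) , (x′ , y′ , z′)) →
          cong toℕ (u ((Sum.map₁ toℕ-injective x , Sum.map₁ toℕ-injective y) , z)
            ((Sum.map₁ toℕ-injective x′ , Sum.map₁ toℕ-injective y′) , z′))
      }

module _ {n : ℕ} {G : Graph n} (N : NatIntervals G) where
  open NatIntervals N renaming (adjacent to adjacent⇔)

  Covers : Fin n → Fin n → Set
  Covers v i = L v ≤ toℕ i × toℕ i ≤ R v

  -- Point i stands for the targets ending at or before i that start last: v dominates one of them as
  -- soon as it starts by i and does not end before any of them starts.
  Hits : Fin n → Fin n → Set
  Hits v i = L v ≤ toℕ i × (∀ t → R t ≤ toℕ i → L t ≤ R v)

  hits? : ∀ v i → Dec (Hits v i)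
  hits? v i = (L v ≤? toℕ i) ×-dec all? λ t → (R t ≤? toℕ i) →-dec (L t ≤? R v)

  -- The first condition passes to larger points, the second to smaller ones.
  hits-convex : ∀ {v i j k} → i ≤ᶠ j → j ≤ᶠ k → Hits v i → Hits v k → Hits v j
  hits-convex i≤j j≤k (l≤i , _) (_ , h) = ≤-trans l≤i i≤j , λ t r≤j → h t (≤-trans r≤j j≤k)

  -- Take the target t that starts last among those ending by i: a neighbour of t starts by R t ≤ i
  -- and reaches L t, hence the start of every such target.
  hits-swallow : ∀ i → ∃[ t ] (∀ {v} → _≈_ G v t → Hits v i)
  hits-swallow i with bottom i
  ... | t₀ , R≡0 with maximal (λ t → R t ≤? toℕ i) L (t₀ , ≤-trans (≤-reflexive R≡0) z≤n)
  ...   | t , R≤i , best = t , λ {v} near → case v ≟ t of λ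
    { (yes refl) → ≤-trans (L≤R t) R≤i , λ s R≤ → ≤-trans (best s R≤) (L≤R t)
    ; (no v≢t)   → case near of λ
      { (inj₁ v≡t) → contradiction v≡t v≢t
      ; (inj₂ a)   → let L≤ , ≤R = to (adjacent⇔ v≢t) a in
                     ≤-trans L≤ R≤i , λ s R≤ → ≤-trans (best s R≤) ≤R } }

  Winning : (p q a b : Fin n) → Set₁
  Winning = obRelation G Hits hits? hits-convex

  intervals⇒model : ∀ {A B D : Fin n → Fin n → Set} {O : (p q a b : Fin n) → Set} → Outcome𝒟 G →
                    (∀ u v → A u v ⇔ Adjacent G u v) → (∀ v i → B v i ⇔ Covers v i) →
                    (∀ v i → D v i ⇔ Hits v i) → (∀ p q a b → O p q a b ⇔ Winning p q a b) → Model A B D O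
  intervals⇒model {A} {B} {D} {O} win a⇔ b⇔ d⇔ o⇔ = record
    { loopless    = λ v a → subst T (Graph.irrefl G v) (to (a⇔ v v) a)
    ; symmetric   = λ u v a → from (a⇔ v u) (subst T (Graph.sym G u v) (to (a⇔ u v) a))
    ; shared      = λ u v u≢v a → let Lu≤ , Lv≤ = to (adjacent⇔ (u≢v ∘ cong toℕ)) (to (a⇔ u v) a) in
        case ≤-total (L u) (L v) of λ
          { (inj₁ Lu≤Lv) → point v , from (b⇔ u _) (subst (λ i → L u ≤ i × i ≤ R u) (sym (at-point v))
            (Lu≤Lv , Lv≤)) ,
                                     from (b⇔ v _) (self v)
          ; (inj₂ Lv≤Lu) → point u , from (b⇔ u _) (self u) ,
                                     from (b⇔ v _) (subst (λ i → L v ≤ i × i ≤ R v) (sym (at-point u))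
                                       (Lv≤Lu , Lu≤)) }
    ; adjacent    = λ u v i (u≢v , bu , bv) → let lu , ru = to (b⇔ u i) bu ; lv , rv = to (b⇔ v i) bv in
        from (a⇔ u v) (from (adjacent⇔ (u≢v ∘ cong toℕ)) (≤-trans lu rv , ≤-trans lv ru))
    ; inhabited   = λ v → point v , from (b⇔ v _) (self v)
    ; B-convex    = λ v i j k ((i<j , j<k) , bi , bk) →
        from (b⇔ v j) (≤-trans (proj₁ (to (b⇔ v i) bi)) (<⇒≤ i<j) ,
          ≤-trans (<⇒≤ j<k) (proj₂ (to (b⇔ v k) bk)))
    ; D-convex    = λ v i j k ((i<j , j<k) , di , dk) →
        from (d⇔ v j) (hits-convex {v} {i} {j} {k} (<⇒≤ i<j) (<⇒≤ j<k) (to (d⇔ v i) di) (to (d⇔ v k) dk))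
    -- The point of t is its right endpoint. Hitting it means starting by R t and, since t itself
    -- ends by then, reaching L t, which is intersection with t.
    ; reaching    = λ t → fromℕ< (R<n t) , λ v d → let L≤ , h = to (d⇔ v _) d ; e = toℕ-fromℕ< (R<n t) in
        case v ≟ t of λ
          { (yes refl) → inj₁ refl
          ; (no v≢t)   → inj₂ (from (a⇔ v t) (from (adjacent⇔ v≢t)
            (subst (L v ≤_) e L≤ , h t (≤-reflexive (sym e))))) }
    ; leaf-closed = λ p q s u → from (o⇔ p q s s) (obRelation-leaf G Hits hits? hits-convex p q s
        λ {v} {w} ((x , y) , z) ((x′ , y′) , z′) → toℕ-injective (u v w
          ((avoid x , avoid y , from (d⇔ v s) z) , (avoid x′ , avoid y′ , from (d⇔ w s) z′))))
    ; node-closed = λ p q a b c d c<d u o₁ o₂ → from (o⇔ p q a b)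
      (obRelation-node G Hits hits? hits-convex p q a b c d c<d
        (λ {v} {w} ((x , y) , z₁ , z₂) ((x′ , y′) , z₁′ , z₂′) → toℕ-injective (u v w
          ((avoid x , avoid y , from (d⇔ v c) z₁ , from (d⇔ v d) z₂) ,
           (avoid x′ , avoid y′ , from (d⇔ w c) z₁′ , from (d⇔ w d) z₂′))))
        (to (o⇔ p d a c) o₁) (to (o⇔ c q d b) o₂))
    ; root-free   = λ a b o → obRelation-root G Hits hits? hits-convex hits-swallow win a b
      (to (o⇔ a b a b) o)
    }
    where
    L<n : ∀ v → L v < n
    L<n v = ≤-<-trans (L≤R v) (R<n v)
    point : Fin n → Fin n
    point v = fromℕ< (L<n v)
    at-point : ∀ v → toℕ (point v) ≡ L v
    at-point v = toℕ-fromℕ< (L<n v)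
    self : ∀ v → Covers v (point v)
    self v = subst (λ i → L v ≤ i × i ≤ R v) (sym (at-point v)) (≤-refl , L≤R v)
    avoid : ∀ {v p a} → p ≡ a ⊎ ¬ Hits v p → toℕ p ≡ toℕ a ⊎ ¬ D v p
    avoid         (inj₁ p≡a) = inj₁ (cong toℕ p≡a)
    avoid {v} {p} (inj₂ ¬h)  = inj₂ (¬h ∘ to (d⇔ v p))

-- Encodings

bitOf : List Bool → ℕ → Bool
bitOf []      _       = false
bitOf (b ∷ w) zero    = b
bitOf (b ∷ w) (suc k) = bitOf w k

isOne-cell : ∀ w k → isOne (cell (map bit w) k) ≡ bitOf w k
isOne-cell []          k       = refl
isOne-cell (true ∷ w)  zero    = refl
isOne-cell (false ∷ w) zero    = refl
isOne-cell (b ∷ w)     (suc k) = isOne-cell w k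

bitOf-++ʳ : ∀ v {w} k → bitOf (v ++ w) (length v + k) ≡ bitOf w k
bitOf-++ʳ []      k = refl
bitOf-++ʳ (b ∷ v) k = bitOf-++ʳ v k

bitOf-++ˡ : ∀ v {w k} → k < length v → bitOf (v ++ w) k ≡ bitOf v k
bitOf-++ˡ (b ∷ v) {k = zero}  _         = refl
bitOf-++ˡ (b ∷ v) {k = suc k} (s≤s k<l) = bitOf-++ˡ v k<l

bitOf-tabulate : ∀ {n} (f : Fin n → Bool) i → bitOf (tabulate f) (toℕ i) ≡ f i
bitOf-tabulate f zero    = refl
bitOf-tabulate f (suc i) = bitOf-tabulate (f ∘ suc) i

module _ {m : ℕ} where

  length-concat : ∀ {n} (f : Fin n → List Bool) → (∀ i → length (f i) ≡ m) →
    length (concat (tabulate f)) ≡ n * m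
  length-concat {zero}  f h = refl
  length-concat {suc n} f h = trans (length-++ (f zero))
    (cong₂ _+_ (h zero) (length-concat (f ∘ suc) (h ∘ suc)))

  bitOf-concat : ∀ {n} (f : Fin n → List Bool) → (∀ i → length (f i) ≡ m) → ∀ i {k} → k < m →
                 bitOf (concat (tabulate f)) (toℕ i * m + k) ≡ bitOf (f i) k
  bitOf-concat f h zero    k<m = bitOf-++ˡ (f zero) (subst (_ <_) (sym (h zero)) k<m)
  bitOf-concat f h (suc i) {k} k<m = trans
    (cong (bitOf (concat (tabulate f))) (trans (+-assoc m (toℕ i * m) k)
      (cong (_+ (toℕ i * m + k)) (sym (h zero)))))
    (trans (bitOf-++ʳ (f zero) (toℕ i * m + k)) (bitOf-concat (f ∘ suc) (h ∘ suc) i k<m))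

bitOf-drop : ∀ m w k → bitOf w (m + k) ≡ bitOf (drop m w) k
bitOf-drop zero    w       k = refl
bitOf-drop (suc m) []      k = refl
bitOf-drop (suc m) (b ∷ w) k = bitOf-drop m w k

tabulate-take : ∀ m w → m ≤ length w → tabulate {n = m} (bitOf w ∘ toℕ) ≡ take m w
tabulate-take zero    w       _         = refl
tabulate-take (suc m) (b ∷ w) (s≤s m≤l) = cong (b ∷_) (tabulate-take m w m≤l)

rows : ∀ n m → (ℕ → Bool) → List Bool
rows n m f = concat (tabulate {n = n} λ u → tabulate {n = m} λ v → f (toℕ u * m + toℕ v))

rows-cong : ∀ n m {f g : ℕ → Bool} → f ≗ g → rows n m f ≡ rows n m g
rows-cong n m e = cong concat (tabulate-cong {n = n} λ u → tabulate-cong {n = m} λ v → e (toℕ u * m + toℕ v))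

rows-suc : ∀ n m f → rows (suc n) m f ≡ tabulate {n = m} (f ∘ toℕ) ++ rows n m (λ k → f (m + k))
rows-suc n m f = cong (λ r → tabulate {n = m} (f ∘ toℕ) ++ concat r)
  (tabulate-cong {n = n} λ u → tabulate-cong {n = m} λ v → cong f (+-assoc m (toℕ u * m) (toℕ v)))

-- Any word of the right length is the matrix read from it, so an input that passes the format test
-- is the encoding of a graph once the matrix is loopless and symmetric.
concat-rows : ∀ n m w → length w ≡ n * m → rows n m (bitOf w) ≡ w
concat-rows zero    m []      e = refl
concat-rows (suc n) m w e = trans (rows-suc n m (bitOf w)) (trans
  (cong₂ _++_ (tabulate-take m w (subst (m ≤_) (sym e) (m≤m+n m (n * m))))
    (trans (rows-cong n m (bitOf-drop m w))
           (concat-rows n m (drop m w) (trans (length-drop m w)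
             (trans (cong (_∸ m) e) (m+n∸m≡n m (n * m)))))))
  (take++drop≡id m w))

reflected : ∀ {P : Set} {b} → Reflects P b → T b → P
reflected (ofʸ p) _ = p

reflecting : ∀ {P : Set} {b} → Reflects P b → P → T b
reflecting (ofʸ _)  _ = _
reflecting (ofⁿ ¬p) p = ⊥-elim (¬p p)

T-ext : ∀ {a b} → (T a → T b) → (T b → T a) → a ≡ b
T-ext {true}  {true}  _ _ = refl
T-ext {true}  {false} f _ = ⊥-elim (f _)
T-ext {false} {true}  _ g = ⊥-elim (g _)
T-ext {false} {false} _ _ = refl

¬T⇒false : ∀ {b} → ¬ T b → b ≡ false
¬T⇒false {true}  h = ⊥-elim (h _)
¬T⇒false {false} h = refl

blank-beyond : ∀ w {k} → length w ≤ k → isBlank (cell (map bit w) k) ≡ true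
blank-beyond []      _         = refl
blank-beyond (b ∷ w) (s≤s l≤k) = blank-beyond w l≤k

blank⇒beyond : ∀ w {k} → T (isBlank (cell (map bit w) k)) → length w ≤ k
blank⇒beyond []      _ = z≤n
blank⇒beyond (b ∷ w) {suc k} t = s≤s (blank⇒beyond w t)

bit-within : ∀ w {k} → k < length w → isBit (cell (map bit w) k) ≡ true
bit-within (b ∷ w) {zero}  _         = refl
bit-within (b ∷ w) {suc k} (s≤s k<l) = bit-within w k<l

bit⇒within : ∀ w {k} → T (isBit (cell (map bit w) k)) → k < length w
bit⇒within (b ∷ w) {zero}  _ = s≤s z≤n
bit⇒within (b ∷ w) {suc k} t = s≤s (bit⇒within w t)

header : ∀ x → T (isZero (cell (map bit x) (leading x))) → ∃[ w ] x ≡ replicate (leading x) true ++ false ∷ w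
header (true ∷ x)  t = let w , e = header x t in w , cong (true ∷_) e
header (false ∷ x) t = x , refl

leading-header : ∀ n w → leading (replicate n true ++ false ∷ w) ≡ n
leading-header zero    w = refl
leading-header (suc n) w = cong suc (leading-header n w)

zero-header : ∀ n w → isZero (cell (map bit (replicate n true ++ false ∷ w)) n) ≡ true
zero-header zero    w = refl
zero-header (suc n) w = zero-header n w

length-header : ∀ n w → length (replicate n true ++ false ∷ w) ≡ suc n + length w
length-header n w = trans (length-++ (replicate n true))
  (trans (cong (_+ suc (length w)) (length-replicate n)) (+-suc n (length w)))

bitOf-header : ∀ n w k → bitOf (replicate n true ++ false ∷ w) (suc n + k) ≡ bitOf w k
bitOf-header zero    w k = refl
bitOf-header (suc n) w k = bitOf-header n w k

-- The certificate as a table of three bits per 4-tuple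

certificateCost : Cost
certificateCost = X ⊗ (X ⊗ (X ⊗ (X ⊗ K 3)))

module _ {n : ℕ} (table : Fin n → Fin n → Fin n → Fin n → List Bool)
  (three : ∀ p q a b → length (table p q a b) ≡ 3) where

  cube : Fin n → Fin n → Fin n → List Bool
  cube p q a = concat (tabulate (table p q a))

  plane : Fin n → Fin n → List Bool
  plane p q = concat (tabulate (cube p q))

  slab : Fin n → List Bool
  slab p = concat (tabulate (plane p))

  flatten : List Bool
  flatten = concat (tabulate slab)

  length-cube : ∀ p q a → length (cube p q a) ≡ n * 3
  length-cube p q a = length-concat (table p q a) (three p q a)

  length-plane : ∀ p q → length (plane p q) ≡ n * (n * 3)
  length-plane p q = length-concat (cube p q) (length-cube p q)

  length-slab : ∀ p → length (slab p) ≡ n * (n * (n * 3))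
  length-slab p = length-concat (plane p) (length-plane p)

  length-flatten : length flatten ≡ ⟦ certificateCost ⟧ n
  length-flatten = length-concat slab length-slab

  digit : ∀ {m k} (i : Fin n) → k < m → toℕ i * m + k < n * m
  digit {m} {k} i k<m = <-≤-trans (+-monoʳ-< (toℕ i * m) k<m)
    (≤-trans (≤-reflexive (+-comm (toℕ i * m) m)) (*-monoˡ-≤ m (toℕ<n i)))

  bitOf-flatten : ∀ p q a b {r} → r < 3 →
    bitOf flatten (toℕ p * (n * (n * (n * 3))) + (toℕ q * (n * (n * 3)) +
      (toℕ a * (n * 3) + (toℕ b * 3 + r)))) ≡
    bitOf (table p q a b) r
  bitOf-flatten p q a b r<3 =
    trans (bitOf-concat slab length-slab p (digit q (digit a (digit b r<3))))
      (trans (bitOf-concat (plane p) (length-plane p) q (digit a (digit b r<3)))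
        (trans (bitOf-concat (cube p q) (length-cube p q) a (digit b r<3))
          (bitOf-concat (table p q a) (three p q a) b r<3)))

T-cong : ∀ {a b} → a ≡ b → T a ⇔ T b
T-cong refl = mk⇔ (λ t → t) (λ t → t)

⇔-via : ∀ {a b} {ℓ} {P : Set ℓ} → a ≡ b → T b ⇔ P → T a ⇔ P
⇔-via refl e = e

anyList? : ∀ {P : List Bool → Set} → (∀ u → Dec (P u)) → ∀ N → Dec (∃[ u ] length u ≤ N × P u)
anyList? P? zero = map′ (λ p → [] , z≤n , p) (λ { ([] , _ , p) → p }) (P? [])
anyList? P? (suc N) =
  map′ (λ { (inj₁ p) → [] , z≤n , p
          ; (inj₂ (inj₁ (u , l , p))) → true ∷ u , s≤s l , p
          ; (inj₂ (inj₂ (u , l , p))) → false ∷ u , s≤s l , p })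
       (λ { ([] , _ , p) → inj₁ p
          ; (true ∷ u , s≤s l , p) → inj₂ (inj₁ (u , l , p))
          ; (false ∷ u , s≤s l , p) → inj₂ (inj₂ (u , l , p)) })
       (P? [] ⊎-dec (anyList? (P? ∘ (true ∷_)) N ⊎-dec anyList? (P? ∘ (false ∷_)) N))
  where open import Data.Sum.Base as Sum using (inj₁; inj₂)

-- Accepted inputs are exactly the yes-instances

Problem : Language _
Problem = ProblemRestrictedTo IsInterval Outcome𝒟

inputBit : ∀ x u k → bitsOf x u input k ≡ bitOf x (suc (leading x) + k)
inputBit x u k = isOne-cell x (suc (leading x) + k)

certificateBit : ∀ x u k → bitsOf x u certificate k ≡ bitOf u k
certificateBit x u k = isOne-cell u k

verdict⇒problem : ∀ x u → T (verdict modelF x u) → Problem x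
verdict⇒problem x u t with to T-∧ t
... | t₁ , t₂ with to T-∧ t₂
...   | t₃ , t₄ with to T-∧ t₃ | header x t₁
...     | t₅ , t₆ | w , x≡ =
  n , G , sym encoded , model⇒interval G (λ _ _ → T? _) (λ _ _ → T? _) M ,
    model⇒outcome G (λ _ _ → T? _) (λ _ _ → T? _) M
  where
  n : ℕ
  n = leading x
  rd : Source → ℕ → Bool
  rd = bitsOf x u
  M : ReadModel {n} rd
  M = sat⇒model rd (reflected (Semantics.sat-reflects n rd modelF (λ _ → 0)) t₄)
  G : Graph n
  G = record
    { adj    = λ u v → rd input (toℕ u * (n * 1) + (toℕ v * 1 + 0))
    ; sym    = λ u v → T-ext (Model.symmetric M u v) (Model.symmetric M v u)
    ; irrefl = λ v → ¬T⇒false (Model.loopless M v) }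
  length-x : length x ≡ suc n + n * (n * 1)
  -- No blank occurs inside a word, so the blank cell bounds the length from above and the bit
  -- before it from below.
  length-x = ≤-antisym (blank⇒beyond x t₅) (bit⇒within x t₆)
  length-w : length w ≡ n * n
  length-w = trans (+-cancelˡ-≡ (suc n) _ _ (trans (sym (length-header n w))
    (trans (cong length (sym x≡)) length-x)))
                   (cong (n *_) (*-identityʳ n))
  entry : ∀ (u v : Fin n) → Graph.adj G u v ≡ bitOf w (toℕ u * n + toℕ v)
  entry i j = trans (inputBit x u _) (trans (cong (λ y →
    bitOf y (suc n + (toℕ i * (n * 1) + (toℕ j * 1 + 0)))) x≡)
    (trans (bitOf-header n w _) (cong (bitOf w) (cong₂ _+_ (cong (toℕ i *_) (*-identityʳ n))
      (trans (+-identityʳ _) (*-identityʳ (toℕ j)))))))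
  encoded : encode G ≡ x
  encoded = trans (cong (λ r → replicate n true ++ false ∷ r)
    (trans (cong concat (tabulate-cong λ i → tabulate-cong λ j → entry i j))
      (concat-rows n n w length-w))) (sym x≡)

module _ {n : ℕ} (G : Graph n) (u : List Bool) where

  matrix : List Bool
  matrix = concat (tabulate λ i → tabulate λ j → Graph.adj G i j)

  length-matrix : length matrix ≡ n * n
  length-matrix = length-concat _ λ i → length-tabulate (Graph.adj G i)

  matrix-entry : ∀ i j → bitOf matrix (toℕ i * (n * 1) + (toℕ j * 1 + 0)) ≡ Graph.adj G i j
  matrix-entry i j = trans
    (cong (bitOf matrix) (cong₂ _+_ (cong (toℕ i *_) (*-identityʳ n))
      (trans (+-identityʳ _) (*-identityʳ (toℕ j)))))
    (trans (bitOf-concat (λ i → tabulate (Graph.adj G i)) (λ i → length-tabulate (Graph.adj G i)) i (toℕ<n j))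
           (bitOf-tabulate (Graph.adj G i) j))

  encode-leading : leading (encode G) ≡ n
  encode-leading = leading-header n matrix

  encode-formatted : T (formatted (encode G) n)
  encode-formatted = from T-∧
    (from T-≡ (blank-beyond (encode G) (≤-reflexive length-encode)) ,
     from T-≡ (bit-within (encode G) (≤-reflexive (sym length-encode))))
    where
    length-encode : length (encode G) ≡ suc n + n * (n * 1)
    length-encode = trans (length-header n matrix) (cong (suc n +_)
      (trans length-matrix (cong (n *_) (sym (*-identityʳ n)))))

  model⇒verdict : ReadModel {leading (encode G)} (bitsOf (encode G) u) → T (verdict modelF (encode G) u)
  model⇒verdict M = from T-∧
    ( subst (λ k → T (isZero (cell (map bit (encode G)) k))) (sym encode-leading)
      (from T-≡ (zero-header n matrix))
    , from T-∧
      ( subst (λ k → T (formatted (encode G) k)) (sym encode-leading) encode-formatted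
      , reflecting (Semantics.sat-reflects (leading (encode G)) (bitsOf (encode G) u) modelF (λ _ → 0))
        (model⇒sat _ M)))

-- Each bit of the table answers a question that is decided only up to double negation; the index
-- sets being finite, all of them can be decided together.
certificateFor : ∀ {n} (G : Graph n) → IsInterval G → Outcome𝒟 G →
                 ¬ ¬ (∃[ u ] length u ≡ ⟦ certificateCost ⟧ n × T (verdict modelF (encode G) u))
certificateFor {n} G int win k = natIntervals G int λ N →
  ¬¬-choice (λ v → ¬¬-choice λ i → ¬¬-decided {A = Covers N v i}) λ B →
  ¬¬-choice (λ v → ¬¬-choice λ i → ¬¬-decided {A = Hits N v i}) λ D →
  ¬¬-choice (λ p → ¬¬-choice λ q → ¬¬-choice λ a → ¬¬-choice λ b → ¬¬-decided {A = Winning N p q a b}) λ O →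
  k (certify N B D O)
  where
  certify : (N : NatIntervals G) → (∀ v i → ∃[ b ] T b ⇔ Covers N v i) → (∀ v i → ∃[ b ] T b ⇔ Hits N v i) →
            (∀ p q a b → ∃[ c ] T c ⇔ Winning N p q a b) →
            ∃[ u ] length u ≡ ⟦ certificateCost ⟧ n × T (verdict modelF (encode G) u)
  certify N B D O = u , length-flatten table (λ _ _ _ _ → refl) , model⇒verdict G u
    (subst (λ l → ReadModel {l} (bitsOf (encode G) u)) (sym (encode-leading G u)) M)
    where
    table : Fin n → Fin n → Fin n → Fin n → List Bool
    table p q a b = proj₁ (B p q) ∷ proj₁ (D p q) ∷ proj₁ (O p q a b) ∷ []
    u : List Bool
    u = flatten table (λ _ _ _ _ → refl)
    rd : Source → ℕ → Bool
    rd = bitsOf (encode G) u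
    entry : ∀ p q a b {r} → r < 3 → rd certificate
      (toℕ p * (n * (n * (n * 3))) + (toℕ q * (n * (n * 3)) + (toℕ a * (n * 3) + (toℕ b * 3 + r)))) ≡
        bitOf (table p q a b) r
    entry p q a b r<3 = trans (certificateBit (encode G) u _)
      (bitOf-flatten table (λ _ _ _ _ → refl) p q a b r<3)
    input-entry : ∀ i j → rd input (toℕ i * (n * 1) + (toℕ j * 1 + 0)) ≡ Graph.adj G i j
    input-entry i j = trans (inputBit (encode G) u _)
      (trans (cong (λ l → bitOf (encode G) (suc l + (toℕ i * (n * 1) + (toℕ j * 1 + 0))))
        (encode-leading G u))
        (trans (bitOf-header n (matrix G u) _) (matrix-entry G u i j)))
    M : ReadModel {n} rd
    M = intervals⇒model N win
      (λ i j → T-cong (input-entry i j))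
      (λ v i → ⇔-via (entry v i v v (s≤s z≤n)) (proj₂ (B v i)))
      (λ v i → ⇔-via (entry v i v v (s≤s (s≤s z≤n))) (proj₂ (D v i)))
      (λ p q a b → ⇔-via (entry p q a b (s≤s (s≤s (s≤s z≤n)))) (proj₂ (O p q a b)))

-- Endpoints in ℝ are comparable only up to double negation; a bounded search removes it.
problem⇒verdict : ∀ x → Problem x → ∃[ u ] length u ≤ poly (polyOf certificateCost) (length x) ×
  T (verdict modelF x u)
problem⇒verdict x (n , G , x≡ , int , win) =
  decidable-stable (anyList? (λ u → T? (verdict modelF x u)) _) λ none →
  certificateFor G int win λ (u , l , t) → none (u ,
    ≤-trans (≤-reflexive l) (≤-trans (⟦⟧-mono certificateCost
      (subst (_≤ length x) (trans (cong leading x≡) (encode-leading G u)) (leading≤length x)))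
                                     (≤-reflexive (sym (poly-polyOf certificateCost (length x))))) ,
    subst (λ y → T (verdict modelF y u)) (sym x≡) t)

corollary4p16 : NP (ProblemRestrictedTo IsInterval Outcome𝒟)
corollary4p16 = Verifier.definable⇒NP 8 modelF certificateCost
  (λ x p → let u , l , t = problem⇒verdict x p in u , l , to T-≡ t)
  (λ x u e → verdict⇒problem x u (from T-≡ e))
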